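{- Let $(W,S)$ be the Coxeter group of type $D_n$ ($n\ge 4$) with $S=\{u,s_1,\dots,s_{n-1}\}$, let $S'=\{s_1,\dots,s_{n-1}\}$, let $p$ be a prime, and let $K\in E$, $L\in F$. If $p\neq 2$ then $d_{KL}=1$ if and only if $c_K$ and $c_L$ have conjugate $p$-regular parts (conjugate in $W$). If $p=2$ and $n$ is even then $F=\{S\}$ and $d_{KS}=1$ for all $K\in E$. If $p=2$ and $n$ is odd (and $E$ is chosen to contain $S'$) then $F=\{S',S\}$ and $d_{KL}=1$ if and only if either $L=S$ and $K\neq S'$, or $L=S'$ and $K=S'$.
   Context: $W$ is realized as the index-2 subgroup, generated by $S$, of the group of all permutations of $\{\pm1,\dots,\pm n\}$ commuting with $i\mapsto -i$, where $s_i=(i,i+1)(-i,-i-1)$ for $1\le i\le n-1$ and $u=(-1,2)(1,-2)$. For $J\subseteq S$, $W_J=\langle J\rangle$ and $c_J$ is a Coxeter element of $W_J$ (the product of the elements of $J$ in some order). $E$ is a set of representatives of the $W$-conjugacy classes of subsets of $S$. For $J,K\subseteq S$, $\beta_{JK}$ is the number of fixed points of $W_K$ on the coset space $W/W_J$; $M^c(W)=(\beta_{JK})_{J,K\in E}$ is the parabolic table of marks. For a prime $p$, $F\subseteq E$ is the set of $J\in E$ whose row of $M^c(W)$ is non-zero modulo $p$ (equivalently, $p\nmid [N_W(W_J):W_J]$). For $K\in E$, $L\in F$, $d_{KL}=1$ if columns $K$ and $L$ of $M^c(W)$ are equal modulo $p$, and $d_{KL}=0$ otherwise; $D=(d_{KL})$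 is the decomposition matrix of the descent algebra $\Sigma_W$ modulo $p$. The $p$-regular part of $w\in W$ is the element $w'$ in the unique factorization $w=w'w''=w''w'$ with $w'$ of order prime to $p$ and $w''$ of $p$-power order. -}

module Defs where

open import Algebra.Bundles using (Group)
open import Algebra.Definitions.RawMonoid using () renaming (_×_ to multiple)
import Algebra.Properties.Group as GroupProperties
open import Data.Bool.Base using (if_then_else_)
open import Data.Fin.Base using (Fin; zero; suc; inject₁)
import Data.Fin.Permutation as Perm
import Data.Fin.Properties as Fin
open import Data.Fin.Subset using (Subset; outside; ⊤) renaming (_∈_ to _∈ₛ_)
open import Data.Fin.Subset.Properties using (_∈?_)
open import Data.List.Base using (List; []; _∷_; map; foldr; length; lookup; deduplicate; allFin; cartesianProduct; cartesianProductWith)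
open import Data.List.Membership.Propositional using () renaming (_∈_ to _∈ₗ_)
import Data.List.Membership.Propositional.Properties as Memₚ
import Data.List.Membership.Setoid as SetoidMembership
import Data.List.Membership.Setoid.Properties as Memₛ
open import Data.List.Relation.Unary.All as All using (All; []; _∷_)
open import Data.List.Relation.Unary.Any as Any using (Any; here; there)
import Data.List.Relation.Unary.Any.Properties as Anyₚ
open import Data.List.Relation.Unary.AllPairs using (_∷_)
open import Data.List.Relation.Unary.Enumerates.Setoid using (IsEnumeration)
open import Data.List.Relation.Unary.Enumerates.Setoid.Properties using (deduplicate⁺)
open import Data.List.Relation.Unary.Unique.DecSetoid.Properties using (deduplicate-!)
open import Data.List.Relation.Unary.Unique.Propositional using (Unique)
import Data.List.Relation.Unary.Unique.Setoid as SetoidUnique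
open import Data.Nat.Base using (ℕ; zero; suc; _≤_; _<_; _^_; s≤s; ∣_-_∣)
open import Data.Nat.Coprimality using (Coprime)
open import Data.Nat.Divisibility using (_∣_; _∤_; _∣?_)
open import Data.Product.Base using (Σ; ∃-syntax; ∃₂; _×_; _,_; proj₁; proj₂)
open import Data.Product using (∃!)
open import Data.Product.Properties using (≡-dec)
open import Data.Sign.Base as Sign using (Sign; opposite)
import Data.Sign.Properties as Sign
open import Data.Sum.Base using (_⊎_; inj₁; inj₂)
open import Data.Vec.Base as Vec using (Vec; []; _∷_; tabulate)
import Data.Vec.Properties as Vec
open import Function.Base using (const)
open import Function.Bundles using (Inverse; _↔_; _⇔_; mk↔ₛ′)
open import Function.Construct.Composition using (_↔-∘_)
open import Function.Construct.Identity using (↔-id)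
open import Function.Construct.Symmetry using (↔-sym)
open import Level using (0ℓ)
open import Relation.Binary.Bundles using (Setoid; DecSetoid)
open import Relation.Binary.Definitions using (Decidable; _Respects_)
open import Relation.Binary.PropositionalEquality as ≡ using (_≡_; refl; sym; trans; cong; cong₂)
import Relation.Binary.Reasoning.Setoid as SetoidReasoning
open import Relation.Nullary using (Dec; yes; no; does; ¬_; contradiction)
open import Relation.Nullary.Decidable using (map′; _×-dec_; _⊎-dec_; _→-dec_)
open import Relation.Unary using (Pred) renaming (Decidable to Decidable₁)

HasSize : Setoid 0ℓ 0ℓ → ℕ → Set
HasSize S m = Inverse S (≡.setoid (Fin m))

record Enumerable (S : Setoid 0ℓ 0ℓ) : Set where
  open Setoid S using (Carrier; _≈_)
  field
    _≟_      : Decidable _≈_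
    elements : List Carrier
    complete : IsEnumeration S elements

module _ {S : Setoid 0ℓ 0ℓ} (enum : Enumerable S) where
  open Setoid S using (Carrier; _≈_) renaming (refl to ≈-refl; sym to ≈-sym; trans to ≈-trans)
  open Enumerable enum
  open SetoidMembership S using (_∈_)
  open SetoidUnique S using () renaming (Unique to Uniqueₛ)

  private
    D : DecSetoid 0ℓ 0ℓ
    D = record { isDecEquivalence = record { isEquivalence = Setoid.isEquivalence S ; _≟_ = _≟_ } }

    index-unique : ∀ {xs x y} → Uniqueₛ xs → (p : x ∈ xs) (q : y ∈ xs) → x ≈ y → Any.index p ≡ Any.index q
    index-unique (_ ∷ _) (here _) (here _) _ = refl
    index-unique (_ ∷ u) (there p) (there q) x≈y = cong suc (index-unique u p q x≈y)
    index-unique (a ∷ _) (here x≈z) (there q) x≈y =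
      contradiction (≈-trans (≈-sym x≈z) x≈y) (distinct a q)
      where
      distinct : ∀ {z y ws} → All (λ w → ¬ z ≈ w) ws → y ∈ ws → ¬ z ≈ y
      distinct (n ∷ _)  (here y≈w)  z≈y = n (≈-trans z≈y y≈w)
      distinct (_ ∷ ns) (there y∈)  z≈y = distinct ns y∈ z≈y
    index-unique u@(_ ∷ _) p@(there _) q@(here _) x≈y =
      sym (index-unique u q p (≈-sym x≈y))

  Enumerable⇒size : ∃[ m ] HasSize S m
  Enumerable⇒size = length xs , record
    { to        = λ x → Any.index (x ∈xs)
    ; from      = lookup xs
    ; to-cong   = λ {x} {y} → index-unique xs! (x ∈xs) (y ∈xs)
    ; from-cong = λ { refl → ≈-refl }
    ; inverse   = (λ {i} {x} x≈xᵢ → trans (index-unique xs! (x ∈xs) (at xs i) x≈xᵢ) (index-at xs i))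
                , (λ { {x} refl → ≈-sym (Anyₚ.lookup-index (x ∈xs)) })
    }
    where
    xs : List Carrier
    xs = deduplicate _≟_ elements

    xs! : Uniqueₛ xs
    xs! = deduplicate-! D elements

    _∈xs : IsEnumeration S xs
    _∈xs = deduplicate⁺ D complete

    at : ∀ ys i → lookup ys i ∈ ys
    at (_ ∷ _)  zero    = here ≈-refl
    at (_ ∷ ys) (suc i) = there (at ys i)

    index-at : ∀ ys i → Any.index (at ys i) ≡ i
    index-at (_ ∷ _)  zero    = refl
    index-at (_ ∷ ys) (suc i) = cong suc (index-at ys i)

  all-elements? : {P : Pred Carrier 0ℓ} → Decidable₁ P → P Respects _≈_ → Dec (∀ x → P x)
  all-elements? P? resp = map′
    (λ all x → let (y , p , x≈y) = pick all (complete x) in resp (≈-sym x≈y) p)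
    (λ all → All.universal all elements)
    (All.all? P? elements)
    where
    pick : ∀ {P : Pred Carrier 0ℓ} {x ys} → All P ys → x ∈ ys → ∃[ y ] P y × x ≈ y
    pick (p ∷ _)  (here x≈y) = _ , p , x≈y
    pick (_ ∷ ps) (there x∈) = pick ps x∈

  subsetoid : Pred Carrier 0ℓ → Setoid 0ℓ 0ℓ
  subsetoid P = record
    { Carrier = Σ Carrier P
    ; _≈_ = λ x y → proj₁ x ≈ proj₁ y
    ; isEquivalence = record { refl = ≈-refl ; sym = ≈-sym ; trans = ≈-trans }
    }

  subsetoid-enumerable : {P : Pred Carrier 0ℓ} → Decidable₁ P → P Respects _≈_ → Enumerable (subsetoid P)
  subsetoid-enumerable {P} P? resp = record
    { _≟_ = λ x y → proj₁ x ≟ proj₁ y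
    ; elements = select elements
    ; complete = λ x → select-complete x (complete (proj₁ x))
    }
    where
    select : List Carrier → List (Σ Carrier P)
    select [] = []
    select (x ∷ xs) with P? x
    ... | yes p = (x , p) ∷ select xs
    ... | no _  = select xs

    select-complete : ∀ (x : Σ Carrier P) {xs} → proj₁ x ∈ xs → Any (λ y → proj₁ x ≈ proj₁ y) (select xs)
    select-complete x {y ∷ ys} x∈ with P? y | x∈
    ... | yes _ | here x≈y = here x≈y
    ... | yes _ | there x∈ys = there (select-complete x x∈ys)
    ... | no ¬p | here x≈y = contradiction (resp x≈y (proj₂ x)) ¬p
    ... | no _  | there x∈ys = select-complete x x∈ys

module _ (G : Group 0ℓ 0ℓ) where
  open Group G renaming (refl to ≈-refl; sym to ≈-sym; trans to ≈-trans)
  open GroupProperties G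
  open SetoidReasoning setoid

  data ⟨_⟩ (P : Pred Carrier 0ℓ) : Pred Carrier 0ℓ where
    gen  : ∀ {x} → P x → ⟨ P ⟩ x
    unit : ⟨ P ⟩ ε
    mul  : ∀ {x y} → ⟨ P ⟩ x → ⟨ P ⟩ y → ⟨ P ⟩ (x ∙ y)
    inv  : ∀ {x} → ⟨ P ⟩ x → ⟨ P ⟩ (x ⁻¹)
    resp : ∀ {x y} → x ≈ y → ⟨ P ⟩ x → ⟨ P ⟩ y

  subgroup : Pred Carrier 0ℓ → Group 0ℓ 0ℓ
  subgroup P = record
    { Carrier = Σ Carrier ⟨ P ⟩
    ; _≈_ = λ x y → proj₁ x ≈ proj₁ y
    ; _∙_ = λ x y → proj₁ x ∙ proj₁ y , mul (proj₂ x) (proj₂ y)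
    ; ε   = ε , unit
    ; _⁻¹ = λ x → proj₁ x ⁻¹ , inv (proj₂ x)
    ; isGroup = record
      { isMonoid = record
        { isSemigroup = record
          { isMagma = record
            { isEquivalence = record { refl = ≈-refl ; sym = ≈-sym ; trans = ≈-trans }
            ; ∙-cong = ∙-cong
            }
          ; assoc = λ x y z → assoc (proj₁ x) (proj₁ y) (proj₁ z)
          }
        ; identity = (λ x → identityˡ (proj₁ x)) , (λ x → identityʳ (proj₁ x))
        }
      ; inverse = (λ x → inverseˡ (proj₁ x)) , (λ x → inverseʳ (proj₁ x))
      ; ⁻¹-cong = ⁻¹-cong
      }
    }

  Conjugate : Carrier → Carrier → Set
  Conjugate x y = ∃[ g ] g ∙ x ∙ g ⁻¹ ≈ y

  pow : Carrier → ℕ → Carrier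
  pow x k = multiple rawMonoid k x

  HasOrder : Carrier → ℕ → Set
  HasOrder x k = 0 < k × pow x k ≈ ε × (∀ m → 0 < m → pow x m ≈ ε → k ≤ m)

  IsRegularPart : ℕ → Carrier → Carrier → Set
  IsRegularPart p w w′ = ∃[ w″ ]
      w ≈ w′ ∙ w″
    × w ≈ w″ ∙ w′
    × (∃[ k ] HasOrder w′ k × Coprime k p)
    × (∃[ a ] HasOrder w″ (p ^ a))

  ConjugateRegularParts : ℕ → Carrier → Carrier → Set
  ConjugateRegularParts p v w =
    ∃₂ λ v′ w′ → IsRegularPart p v v′ × IsRegularPart p w w′ × Conjugate v′ w′

  -- The left cosets x⟨P⟩, each given by its representatives.
  cosets : Pred Carrier 0ℓ → Setoid 0ℓ 0ℓ
  cosets P = record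
    { Carrier = Carrier
    ; _≈_ = λ x y → ⟨ P ⟩ (x ⁻¹ ∙ y)
    ; isEquivalence = record
      { refl  = λ {x} → resp (≈-sym (inverseˡ x)) unit
      ; sym   = λ {x} {y} q → resp (flip-quotient x y) (inv q)
      ; trans = λ {x} {y} {z} q r → resp (cancel x y z) (mul q r)
      }
    }
    where
    flip-quotient : ∀ x y → (x ⁻¹ ∙ y) ⁻¹ ≈ y ⁻¹ ∙ x
    flip-quotient x y = begin
      (x ⁻¹ ∙ y) ⁻¹      ≈⟨ ⁻¹-anti-homo-∙ (x ⁻¹) y ⟩
      y ⁻¹ ∙ (x ⁻¹) ⁻¹   ≈⟨ ∙-congˡ (⁻¹-involutive x) ⟩
      y ⁻¹ ∙ x           ∎

    cancel : ∀ x y z → (x ⁻¹ ∙ y) ∙ (y ⁻¹ ∙ z) ≈ x ⁻¹ ∙ z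
    cancel x y z = begin
      (x ⁻¹ ∙ y) ∙ (y ⁻¹ ∙ z)  ≈⟨ assoc (x ⁻¹) y (y ⁻¹ ∙ z) ⟩
      x ⁻¹ ∙ (y ∙ (y ⁻¹ ∙ z))  ≈⟨ ∙-congˡ (assoc y (y ⁻¹) z) ⟨
      x ⁻¹ ∙ ((y ∙ y ⁻¹) ∙ z)  ≈⟨ ∙-congˡ (∙-congʳ (inverseʳ y)) ⟩
      x ⁻¹ ∙ (ε ∙ z)           ≈⟨ ∙-congˡ (identityˡ z) ⟩
      x ⁻¹ ∙ z                 ∎

  IsFixed : Pred Carrier 0ℓ → Pred Carrier 0ℓ → Pred Carrier 0ℓ
  IsFixed P Q x = ∀ g → ⟨ Q ⟩ g → Setoid._≈_ (cosets P) (g ∙ x) x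

  -- Note the order: ⟨Q⟩ acts, by left multiplication, on the cosets of ⟨P⟩.
  fixedPoints : Pred Carrier 0ℓ → Pred Carrier 0ℓ → Setoid 0ℓ 0ℓ
  fixedPoints P Q = record
    { Carrier = Σ Carrier (IsFixed P Q)
    ; _≈_ = λ x y → Setoid._≈_ (cosets P) (proj₁ x) (proj₁ y)
    ; isEquivalence = record
      { refl  = Setoid.refl (cosets P)
      ; sym   = Setoid.sym (cosets P)
      ; trans = Setoid.trans (cosets P)
      }
    }

  module _ (enum : Enumerable setoid) where
    open Enumerable enum

    -- Decidability of generation: Warshall's algorithm on the Cayley graph.
    module _ {P : Pred Carrier 0ℓ} (P? : Decidable₁ P) (P-resp : P Respects _≈_) where
      private
        Edge : Carrier → Carrier → Set
        Edge x y = x ≈ y ⊎ P (x ⁻¹ ∙ y) ⊎ P (y ⁻¹ ∙ x)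

        Path : List Carrier → Carrier → Carrier → Set
        Path []       x y = Edge x y
        Path (v ∷ vs) x y = Path vs x y ⊎ (Path vs x v × Path vs v y)

        path? : ∀ vs → Decidable (Path vs)
        path? []       x y = (x ≟ y) ⊎-dec (P? (x ⁻¹ ∙ y) ⊎-dec P? (y ⁻¹ ∙ x))
        path? (v ∷ vs) x y = path? vs x y ⊎-dec (path? vs x v ×-dec path? vs v y)

        path-sym : ∀ vs {x y} → Path vs x y → Path vs y x
        path-sym [] (inj₁ x≈y) = inj₁ (≈-sym x≈y)
        path-sym [] (inj₂ (inj₁ e)) = inj₂ (inj₂ e)
        path-sym [] (inj₂ (inj₂ e)) = inj₂ (inj₁ e)
        path-sym (v ∷ vs) (inj₁ p) = inj₁ (path-sym vs p)
        path-sym (v ∷ vs) (inj₂ (p , q)) = inj₂ (path-sym vs q , path-sym vs p)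

        path-respʳ : ∀ vs {x y z} → y ≈ z → Path vs x y → Path vs x z
        path-respʳ [] y≈z (inj₁ x≈y) = inj₁ (≈-trans x≈y y≈z)
        path-respʳ [] y≈z (inj₂ (inj₁ e)) = inj₂ (inj₁ (P-resp (∙-congˡ y≈z) e))
        path-respʳ [] y≈z (inj₂ (inj₂ e)) = inj₂ (inj₂ (P-resp (∙-congʳ (⁻¹-cong y≈z)) e))
        path-respʳ (v ∷ vs) y≈z (inj₁ p) = inj₁ (path-respʳ vs y≈z p)
        path-respʳ (v ∷ vs) y≈z (inj₂ (p , q)) = inj₂ (p , path-respʳ vs y≈z q)

        path-respˡ : ∀ vs {x y z} → x ≈ z → Path vs x y → Path vs z y
        path-respˡ vs x≈z p = path-sym vs (path-respʳ vs x≈z (path-sym vs p))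

        join : ∀ vs {x v y} → SetoidMembership._∈_ setoid v vs → Path vs x v → Path vs v y → Path vs x y
        join (w ∷ vs) (here v≈w) p q = inj₂ (to p , from q)
          where
          to : Path (w ∷ vs) _ _ → Path vs _ w
          to (inj₁ p) = path-respʳ vs v≈w p
          to (inj₂ (p , _)) = p
          from : Path (w ∷ vs) _ _ → Path vs w _
          from (inj₁ q) = path-respˡ vs v≈w q
          from (inj₂ (_ , q)) = q
        join (w ∷ vs) (there v∈) (inj₁ p) (inj₁ q) = inj₁ (join vs v∈ p q)
        join (w ∷ vs) (there v∈) (inj₁ p) (inj₂ (q , r)) = inj₂ (join vs v∈ p q , r)
        join (w ∷ vs) (there v∈) (inj₂ (p , q)) (inj₁ r) = inj₂ (p , join vs v∈ q r)
        join (w ∷ vs) (there v∈) (inj₂ (p , _)) (inj₂ (_ , r)) = inj₂ (p , r)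

        open Setoid (cosets P) using () renaming (_≈_ to _∼_; sym to ∼-sym; trans to ∼-trans)

        sound : ∀ vs {x y} → Path vs x y → x ∼ y
        sound [] {x} (inj₁ x≈y) = resp (≈-trans (≈-sym (inverseˡ x)) (∙-congˡ x≈y)) unit
        sound [] (inj₂ (inj₁ e)) = gen e
        sound [] {x} {y} (inj₂ (inj₂ e)) = ∼-sym {y} {x} (gen e)
        sound (v ∷ vs) (inj₁ p) = sound vs p
        sound (v ∷ vs) {x} {y} (inj₂ (p , q)) = ∼-trans {x} {v} {y} (sound vs p) (sound vs q)

        edge : ∀ vs {x y} → Edge x y → Path vs x y
        edge []       e = e
        edge (_ ∷ vs) e = inj₁ (edge vs e)

        walk : ∀ {g} → ⟨ P ⟩ g → ∀ x → Path elements x (x ∙ g)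
        walk {g} (gen p) x = edge elements (inj₂ (inj₁ (P-resp (≈-sym (cancelled x g)) p)))
          where
          cancelled : ∀ x g → x ⁻¹ ∙ (x ∙ g) ≈ g
          cancelled x g = begin
            x ⁻¹ ∙ (x ∙ g)  ≈⟨ assoc (x ⁻¹) x g ⟨
            (x ⁻¹ ∙ x) ∙ g  ≈⟨ ∙-congʳ (inverseˡ x) ⟩
            ε ∙ g           ≈⟨ identityˡ g ⟩
            g               ∎
        walk unit x = edge elements (inj₁ (≈-sym (identityʳ x)))
        walk (mul {g} {h} p q) x = path-respʳ elements (assoc x g h)
          (join elements (complete (x ∙ g)) (walk p x) (walk q (x ∙ g)))
        walk (inv {g} p) x = path-sym elements
          (path-respʳ elements restored (walk p (x ∙ g ⁻¹)))
          where
          restored : (x ∙ g ⁻¹) ∙ g ≈ x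
          restored = begin
            (x ∙ g ⁻¹) ∙ g  ≈⟨ assoc x (g ⁻¹) g ⟩
            x ∙ (g ⁻¹ ∙ g)  ≈⟨ ∙-congˡ (inverseˡ g) ⟩
            x ∙ ε           ≈⟨ identityʳ x ⟩
            x               ∎
        walk (resp g≈h p) x = path-respʳ elements (∙-congˡ g≈h) (walk p x)

      ⟨⟩? : Decidable₁ ⟨ P ⟩
      ⟨⟩? g = map′
        (λ p → resp (≈-trans (∙-congʳ ε⁻¹≈ε) (identityˡ g)) (sound elements p))
        (λ q → path-respʳ elements (identityˡ g) (walk q ε))
        (path? elements ε g)

    subgroup-enumerable : {P : Pred Carrier 0ℓ} → Decidable₁ P → P Respects _≈_ →
                          Enumerable (Group.setoid (subgroup P))
    subgroup-enumerable P? P-resp =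
      record { Enumerable (subsetoid-enumerable enum (⟨⟩? P? P-resp) resp) }

    fixedPoints-enumerable : {P Q : Pred Carrier 0ℓ} →
                             Decidable₁ P → P Respects _≈_ →
                             Decidable₁ Q → Q Respects _≈_ →
                             Enumerable (fixedPoints P Q)
    fixedPoints-enumerable {P} {Q} P? P-resp Q? Q-resp =
      record { Enumerable (subsetoid-enumerable cosets-enumerable fixed? fixed-resp) }
      where
      open Setoid (cosets P) using () renaming (_≈_ to _∼_; sym to ∼-sym; trans to ∼-trans)

      ≈⇒∼ : ∀ {x y} → x ≈ y → x ∼ y
      ≈⇒∼ {x} x≈y = resp (≈-trans (≈-sym (inverseˡ x)) (∙-congˡ x≈y)) unit

      cosets-enumerable : Enumerable (cosets P)
      cosets-enumerable = record
        { _≟_ = λ x y → ⟨⟩? P? P-resp (x ⁻¹ ∙ y)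
        ; elements = elements
        ; complete = λ x → Any.map ≈⇒∼ (complete x)
        }

      fixed? : Decidable₁ (IsFixed P Q)
      fixed? x = all-elements? enum
        (λ g → ⟨⟩? Q? Q-resp g →-dec ⟨⟩? P? P-resp ((g ∙ x) ⁻¹ ∙ x))
        (λ g≈h f h∈ → resp (∙-congʳ (⁻¹-cong (∙-congʳ g≈h))) (f (resp (≈-sym g≈h) h∈)))

      translate : ∀ g {x y} → x ∼ y → (g ∙ x) ∼ (g ∙ y)
      translate g {x} {y} = resp (begin
        x ⁻¹ ∙ y                    ≈⟨ ∙-congˡ (identityˡ y) ⟨
        x ⁻¹ ∙ (ε ∙ y)              ≈⟨ ∙-congˡ (∙-congʳ (inverseˡ g)) ⟨
        x ⁻¹ ∙ ((g ⁻¹ ∙ g) ∙ y)     ≈⟨ ∙-congˡ (assoc (g ⁻¹) g y) ⟩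
        x ⁻¹ ∙ (g ⁻¹ ∙ (g ∙ y))     ≈⟨ assoc (x ⁻¹) (g ⁻¹) (g ∙ y) ⟨
        (x ⁻¹ ∙ g ⁻¹) ∙ (g ∙ y)     ≈⟨ ∙-congʳ (⁻¹-anti-homo-∙ g x) ⟨
        (g ∙ x) ⁻¹ ∙ (g ∙ y)        ∎)

      fixed-resp : IsFixed P Q Respects _∼_
      fixed-resp {x} {y} x∼y fix g g∈ =
        ∼-trans {g ∙ y} {g ∙ x} {y} (translate g (∼-sym {x} {y} x∼y))
          (∼-trans {g ∙ x} {x} {y} (fix g g∈) x∼y)

-- The set of generators S is given as a family s, and a subset J of S by
-- the indices of its elements.

module ParabolicMarks (W : Group 0ℓ 0ℓ) (enum : Enumerable (Group.setoid W))
                      {r : ℕ} (s : Fin r → Group.Carrier W) where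
  open Group W using (Carrier; _≈_; _∙_; ε; _⁻¹) renaming (sym to ≈-sym; trans to ≈-trans)

  Among : Subset r → Pred Carrier 0ℓ
  Among J x = ∃[ j ] j ∈ₛ J × x ≈ s j

  private
    among? : ∀ J → Decidable₁ (Among J)
    among? J x = Fin.any? (λ j → (j ∈? J) ×-dec Enumerable._≟_ enum x (s j))

    among-resp : ∀ J → Among J Respects _≈_
    among-resp J x≈y (j , j∈J , x≈sⱼ) = j , j∈J , ≈-trans (≈-sym x≈y) x≈sⱼ

  -- w {s j ∣ j ∈ J} w⁻¹ = {s k ∣ k ∈ K} as subsets of W.
  _∼_ : Subset r → Subset r → Set
  J ∼ K = ∃[ w ] (∀ j → j ∈ₛ J → Among K (w ∙ s j ∙ w ⁻¹))
               × (∀ k → k ∈ₛ K → ∃[ j ] j ∈ₛ J × w ∙ s j ∙ w ⁻¹ ≈ s k)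

  IsCoxeterElement : Subset r → Carrier → Set
  IsCoxeterElement J c = ∃[ js ]
    Unique js × (∀ j → j ∈ₗ js ⇔ j ∈ₛ J) × c ≈ foldr _∙_ ε (map s js)

  FixedPoints : Subset r → Subset r → Setoid 0ℓ 0ℓ
  FixedPoints J K = fixedPoints W (Among J) (Among K)

  abstract
    fixedPoints-finite : ∀ J K → ∃[ m ] HasSize (FixedPoints J K) m
    fixedPoints-finite J K = Enumerable⇒size
      (fixedPoints-enumerable W enum (among? J) (among-resp J) (among? K) (among-resp K))

  β : Subset r → Subset r → ℕ
  β J K = proj₁ (fixedPoints-finite J K)

  -- E is read as the set of its members; repetitions are irrelevant.
  IsTransversal : List (Subset r) → Set
  IsTransversal E = ∀ J → ∃! _≡_ (λ K → K ∈ₗ E × J ∼ K)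

  InF : ℕ → List (Subset r) → Subset r → Set
  InF p E J = J ∈ₗ E × ∃[ K ] K ∈ₗ E × p ∤ β J K

  -- p ∣ ∣ a - b ∣ is a ≡ b (mod p); the rows of the table are indexed by E.
  SameColumn : ℕ → List (Subset r) → Subset r → Subset r → Set
  SameColumn p E K L = All (λ J → p ∣ ∣ β J K - β J L ∣) E

  sameColumn? : ∀ p E K L → Dec (SameColumn p E K L)
  sameColumn? p E K L = All.all? (λ J → p ∣? ∣ β J K - β J L ∣) E

  d : ℕ → List (Subset r) → Subset r → Subset r → ℕ
  d p E K L = if does (sameColumn? p E K L) then 1 else 0

-- (Sign.+ , i) and (Sign.- , i) are the letters i + 1 and - (i + 1).
Letter : ℕ → Set
Letter n = Sign × Fin n

neg : ∀ {n} → Letter n → Letter n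
neg (σ , i) = opposite σ , i

record SignedPerm (n : ℕ) : Set where
  field
    perm     : Letter n ↔ Letter n
  open Inverse perm public using (to; from; strictlyInverseˡ; strictlyInverseʳ)
  field
    commutes : ∀ x → to (neg x) ≡ neg (to x)

open SignedPerm

module _ {n : ℕ} where

  neg-involutive : (x : Letter n) → neg (neg x) ≡ x
  neg-involutive (σ , i) = cong (_, i) (Sign.opposite-selfInverse refl)

  private
    from-commutes : (w : SignedPerm n) → ∀ x → from w (neg x) ≡ neg (from w x)
    from-commutes w x = trans
      (cong (from w) (trans (cong neg (sym (strictlyInverseˡ w x))) (sym (commutes w (from w x)))))
      (strictlyInverseʳ w (neg (from w x)))

  _∘ₛ_ : SignedPerm n → SignedPerm n → SignedPerm n
  v ∘ₛ w = record
    { perm = perm v ↔-∘ perm w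
    ; commutes = λ x → trans (cong (to v) (commutes w x)) (commutes v (to w x))
    }

  idₛ : SignedPerm n
  idₛ = record { perm = ↔-id _ ; commutes = λ _ → refl }

  invₛ : SignedPerm n → SignedPerm n
  invₛ w = record { perm = ↔-sym (perm w) ; commutes = from-commutes w }

hyperoctahedral : ℕ → Group 0ℓ 0ℓ
hyperoctahedral n = record
  { Carrier = SignedPerm n
  ; _≈_ = λ v w → ∀ x → to v x ≡ to w x
  ; _∙_ = _∘ₛ_
  ; ε   = idₛ
  ; _⁻¹ = invₛ
  ; isGroup = record
    { isMonoid = record
      { isSemigroup = record
        { isMagma = record
          { isEquivalence = record
            { refl  = λ _ → refl
            ; sym   = λ e x → sym (e x)
            ; trans = λ e f x → trans (e x) (f x)
            }
          ; ∙-cong = λ {v} {v′} {w} {w′} e f x → trans (cong (to v) (f x)) (e (to w′ x))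
          }
        ; assoc = λ _ _ _ _ → refl
        }
      ; identity = (λ _ _ → refl) , (λ _ _ → refl)
      }
    ; inverse = (λ w → strictlyInverseʳ w) , (λ w → strictlyInverseˡ w)
    ; ⁻¹-cong = λ {v} {w} e x → trans
        (cong (from v) (trans (sym (strictlyInverseˡ w x)) (sym (e (from w x)))))
        (strictlyInverseʳ v (from w x))
    }
  }

-- The signed permutation i ↦ σ i · π i.
signed : ∀ {n} → (Fin n → Sign) → Perm.Permutation′ n → SignedPerm n
signed {n} σ π = record
  { perm = mk↔ₛ′
      (λ (τ , i) → σ i Sign.* τ , π Perm.⟨$⟩ʳ i)
      (λ (τ , i) → σ (π Perm.⟨$⟩ˡ i) Sign.* τ , π Perm.⟨$⟩ˡ i)
      (λ (τ , i) → cong₂ _,_ (twice (σ (π Perm.⟨$⟩ˡ i)) τ) (Perm.inverseʳ π))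
      (λ (τ , i) → cong₂ _,_
        (trans (cong (λ j → σ j Sign.* (σ i Sign.* τ)) (Perm.inverseˡ π)) (twice (σ i) τ))
        (Perm.inverseˡ π))
  ; commutes = λ (τ , i) → cong (_, π Perm.⟨$⟩ʳ i) (*-opposite (σ i) τ)
  }
  where
  twice : ∀ a b → a Sign.* (a Sign.* b) ≡ b
  twice Sign.+ _ = refl
  twice Sign.- b = Sign.opposite-selfInverse refl

  *-opposite : ∀ a b → a Sign.* opposite b ≡ opposite (a Sign.* b)
  *-opposite Sign.+ _ = refl
  *-opposite Sign.- _ = refl

abstract
  hyperoctahedral-enumerable : ∀ n → Enumerable (Group.setoid (hyperoctahedral n))
  hyperoctahedral-enumerable n = record
    { _≟_ = λ v w → ∀Letter (λ x → to v x ≟ to w x)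
    ; elements = build (cartesianProduct codes codes)
    ; complete = λ w → build-complete w
        (Memₚ.∈-cartesianProduct⁺ (∈-codes (code (to w))) (∈-codes (code (from w))))
    }
    where
    _≟_ : Decidable {A = Letter n} _≡_
    _≟_ = ≡-dec Sign._≟_ Fin._≟_

    letters : List (Letter n)
    letters = cartesianProduct (Sign.+ ∷ Sign.- ∷ []) (allFin n)

    ∈-letters : ∀ x → x ∈ₗ letters
    ∈-letters (σ , i) = Memₚ.∈-cartesianProduct⁺ (∈-signs σ) (Memₚ.∈-allFin i)
      where
      ∈-signs : ∀ σ → σ ∈ₗ (Sign.+ ∷ Sign.- ∷ [])
      ∈-signs Sign.+ = here refl
      ∈-signs Sign.- = there (here refl)

    ∀Letter : {P : Letter n → Set} → Decidable₁ P → Dec (∀ x → P x)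
    ∀Letter P? = map′ (λ all x → All.lookup all (∈-letters x)) (λ all → All.universal all letters)
                      (All.all? P? letters)

    vecs : ∀ m → List (Vec (Letter n) m)
    vecs zero    = [] ∷ []
    vecs (suc m) = cartesianProductWith _∷_ letters (vecs m)

    ∈-vecs : ∀ {m} (xs : Vec (Letter n) m) → xs ∈ₗ vecs m
    ∈-vecs []       = here refl
    ∈-vecs (x ∷ xs) = Memₚ.∈-cartesianProductWith⁺ _∷_ (∈-letters x) (∈-vecs xs)

    codes : List (Vec (Letter n) n)
    codes = vecs n

    ∈-codes : ∀ c → c ∈ₗ codes
    ∈-codes = ∈-vecs

    code : (Letter n → Letter n) → Vec (Letter n) n
    code f = tabulate (λ i → f (Sign.+ , i))

    decode : Vec (Letter n) n → Letter n → Letter n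
    decode c (Sign.+ , i) = Vec.lookup c i
    decode c (Sign.- , i) = neg (Vec.lookup c i)

    decode-neg : ∀ c x → decode c (neg x) ≡ neg (decode c x)
    decode-neg c (Sign.+ , i) = refl
    decode-neg c (Sign.- , i) = sym (neg-involutive _)

    decode-code : ∀ (f : Letter n → Letter n) → (∀ x → f (neg x) ≡ neg (f x)) → ∀ x → decode (code f) x ≡ f x
    decode-code f f-neg (Sign.+ , i) = Vec.lookup∘tabulate _ i
    decode-code f f-neg (Sign.- , i) = trans (cong neg (Vec.lookup∘tabulate _ i)) (sym (f-neg (Sign.+ , i)))

    Inverses : Vec (Letter n) n × Vec (Letter n) n → Set
    Inverses (c , c′) = (∀ x → decode c (decode c′ x) ≡ x) × (∀ x → decode c′ (decode c x) ≡ x)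

    inverses? : Decidable₁ Inverses
    inverses? (c , c′) = ∀Letter (λ x → decode c (decode c′ x) ≟ x)
                   ×-dec ∀Letter (λ x → decode c′ (decode c x) ≟ x)

    make : ∀ {cc} → Inverses cc → SignedPerm n
    make {c , c′} (p , q) = record { perm = mk↔ₛ′ (decode c) (decode c′) p q ; commutes = decode-neg c }

    build : List (Vec (Letter n) n × Vec (Letter n) n) → List (SignedPerm n)
    build [] = []
    build (cc ∷ ccs) with inverses? cc
    ... | yes p = make p ∷ build ccs
    ... | no _  = build ccs

    build-complete : ∀ w {ccs} → (code (to w) , code (from w)) ∈ₗ ccs →
                     Any (λ v → ∀ x → to w x ≡ to v x) (build ccs)
    build-complete w {cc ∷ ccs} cc∈ with inverses? cc | cc∈
    ... | yes _ | here refl  = here (λ x → sym (decode-code (to w) (commutes w) x))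
    ... | yes _ | there cc∈′ = there (build-complete w cc∈′)
    ... | no _  | there cc∈′ = build-complete w cc∈′
    ... | no ¬p | here refl  = contradiction
      ( (λ x → trans (decode-to (decode (code (from w)) x))
                 (trans (cong (to w) (decode-from x)) (strictlyInverseˡ w x)))
      , (λ x → trans (decode-from (decode (code (to w)) x))
                 (trans (cong (from w) (decode-to x)) (strictlyInverseʳ w x))) )
      ¬p
      where
      decode-to : ∀ x → decode (code (to w)) x ≡ to w x
      decode-to = decode-code (to w) (commutes w)
      decode-from : ∀ x → decode (code (from w)) x ≡ from w x
      decode-from = decode-code (from w) (commutes (invₛ w))

-- s-perm i is (i+1, i+2)(-(i+1), -(i+2)), positions in Fin being zero-based.
s-perm : ∀ {m} → Fin m → SignedPerm (suc m)
s-perm i = signed (const Sign.+) (Perm.transpose (inject₁ i) (suc i))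

-- (-1, 2)(1, -2), that is 1 ↦ -2 and 2 ↦ -1.
u-perm : ∀ {m} → SignedPerm (suc (suc m))
u-perm = signed u-sign (Perm.transpose zero (suc zero))
  where
  u-sign : ∀ {m} → Fin (suc (suc m)) → Sign
  u-sign zero          = Sign.-
  u-sign (suc zero)    = Sign.-
  u-sign (suc (suc _)) = Sign.+

module TypeD {n : ℕ} (4≤n : 4 ≤ n) where

  -- Index zero is u and index i > 0 is sᵢ.
  generator : Fin n → SignedPerm n
  generator = go 4≤n
    where
    go : ∀ {n} → 4 ≤ n → Fin n → SignedPerm n
    go (s≤s (s≤s _)) zero    = u-perm
    go (s≤s (s≤s _)) (suc i) = s-perm i

  IsGenerator : Pred (SignedPerm n) 0ℓ
  IsGenerator w = ∃[ i ] Group._≈_ (hyperoctahedral n) w (generator i)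

  W : Group 0ℓ 0ℓ
  W = subgroup (hyperoctahedral n) IsGenerator

  abstract
    W-enumerable : Enumerable (Group.setoid W)
    W-enumerable = subgroup-enumerable (hyperoctahedral n) (hyperoctahedral-enumerable n)
      (λ w → Fin.any? (λ i → Enumerable._≟_ (hyperoctahedral-enumerable n) w (generator i)))
      (λ v≈w (i , v≈gᵢ) → i , λ x → trans (sym (v≈w x)) (v≈gᵢ x))

  generatorW : Fin n → Group.Carrier W
  generatorW i = generator i , gen (i , λ _ → refl)

  open ParabolicMarks W W-enumerable generatorW public

  S : Subset n
  S = ⊤

  S′ : Subset n
  S′ = go 4≤n
    where
    go : ∀ {n} → 4 ≤ n → Subset n
    go (s≤s _) = outside ∷ ⊤

{-# OPTIONS --safe #-}
module Submission where

-- W acts on integer vectors, and W_J is the stabilizer of a vector generic in the face of J.  Since the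
-- simple roots are linearly independent, a Coxeter element c_K fixes a vector only if W_K does, so β_JK
-- is the number of fixed points of c_K on W/W_J.  Counting fixed points modulo p, c_K may be replaced by
-- its p^a-th power; and c_K, c_L have conjugate p-regular parts iff some p^a-th powers are conjugate.
-- Hence conjugate regular parts give equal columns.
--
-- Conversely, by Cauchy's theorem row K vanishes modulo p iff N(W_K) has an element y outside W_K with
-- y^p in W_K.  For p odd, y permutes p blocks of K of equal size cyclically.  Merging them into one block
-- replaces p cycles of length j by one of length p j, which does not affect the class of the regular part.
-- Repeating this, c_K has the same regular part as c_M for some M with β_MM prime to p.  If the columns
-- of K and L agree, so do those of M and L; if also L ∈ F, then β_LM and β_ML are nonzero, W_L and W_M
-- are contained in conjugates of each other, and c_L is conjugate to c_M.
--
-- For p = 2, sign changes of the letters provide elements y for all J except S and, if n is odd, S′.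

open import Defs
open import Algebra.Bundles using (Group)
import Algebra.Properties.CommutativeMonoid.Sum as Sum
import Algebra.Properties.Group as GroupProperties
import Algebra.Properties.Monoid.Mult as Mult
open import Data.Bool.Base using (Bool; true; false; not; if_then_else_)
import Data.Bool.Properties as Bool
open import Data.Empty using (⊥)
open import Data.Fin.Base as Fin using (Fin; zero; suc; toℕ; fromℕ<; inject₁)
import Data.Fin.Permutation as Perm
import Data.Fin.Permutation.Components as PC
import Data.Fin.Properties as Fin
open import Data.Fin.Subset using (Subset; inside; outside; ⊤) renaming (_∈_ to _∈ₛ_)
open import Data.Fin.Subset.Properties using (_∈?_; ∈⊤; ⊆-antisym; ⊆⊤)
open import Data.Integer.Base as ℤ using (ℤ; +_; -[1+_]; 0ℤ; 1ℤ; -1ℤ; +≤+; +<+)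
import Data.Integer.Properties as ℤ
open import Data.Integer.Solver using () renaming (module +-*-Solver to ℤ-Solver)
open import Data.List.Base as List using (List; []; _∷_; allFin; _++_; foldr; length; replicate; map)
open import Data.List.Membership.Propositional using (_∈_)
import Data.List.Membership.Propositional.Properties as Memₚ
open import Data.List.Properties using (length-++; ++-assoc; ++-identityʳ; length-replicate)
open import Data.List.Relation.Binary.Permutation.Propositional as Perm↭ using (_↭_; ↭-refl; ↭-sym; ↭-trans; ↭-prep; ↭-swap)
import Data.List.Relation.Binary.Permutation.Propositional.Properties as ↭ₚ
import Data.List.Relation.Binary.Permutation.Setoid.Properties as SetoidPermₚ
open import Data.List.Relation.Binary.Pointwise as Pointwise using (Pointwise; []; _∷_)
open import Data.List.Relation.Unary.All as All using (All; []; _∷_)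
open import Data.List.Relation.Unary.All.Properties using (¬Any⇒All¬)
open import Data.List.Relation.Unary.AllPairs using ([]; _∷_)
open import Data.List.Relation.Unary.Any as Any using (Any; here; there)
open import Data.List.Relation.Unary.Unique.Propositional using (Unique)
import Data.List.Relation.Unary.Unique.Propositional.Properties as Uniqueₚ
open import Data.Nat.Base
open import Data.Nat.Coprimality as Coprime using (Coprime; coprime-Bézout)
open import Data.Nat.Divisibility
open import Data.Nat.DivMod
open import Data.Nat.GCD using (module Bézout)
open import Data.Nat.GeneralisedArithmetic using (fold; fold-+)
open import Data.Nat.Induction using (<-rec)
open import Data.Nat.Primality using (Prime; prime[2]; ¬prime[0]; prime⇒nonZero; prime⇒nonTrivial; prime⇒irreducible; euclidsLemma)
open import Data.Nat.Properties
open import Data.Nat.Solver using (module +-*-Solver)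
open import Data.Product.Base using (Σ; ∃; ∃-syntax; ∃₂; _×_; _,_; proj₁; proj₂)
open import Data.Product.Properties using (≡-dec)
open import Data.Product.Relation.Binary.Pointwise.NonDependent using (×-setoid)
open import Data.Sign.Base as Sign using (Sign; opposite)
import Data.Sign.Properties as Sign
open import Data.Sum.Base as Sum⊎ using (_⊎_; inj₁; inj₂; [_,_]′)
open import Data.Sum.Function.Propositional using (_⊎-↔_)
open import Data.Sum.Properties using (inj₁-injective; inj₂-injective)
open import Data.Vec.Base as Vec using (Vec; []; _∷_; here; there)
import Data.Vec.Properties as Vec
open import Function.Base using (_∘_; id; case_of_)
open import Function.Bundles using (Inverse; _↔_; mk↔ₛ′; _⇔_; mk⇔; Equivalence)
import Function.Construct.Composition as Comp
import Function.Construct.Symmetry as Symm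
open import Level using (0ℓ)
open import Relation.Binary.Bundles using (Setoid)
import Relation.Binary.Construct.On as On
open import Relation.Binary.Definitions using (Decidable; _Respects_; tri<; tri≈; tri>)
open import Relation.Binary.PropositionalEquality as ≡ using (_≡_; _≢_; refl; sym; trans; cong; cong₂; subst; _≗_)
import Relation.Binary.Reasoning.Setoid as SetoidReasoning
open import Relation.Nullary using (Dec; yes; no; does; ¬_; contradiction; ¬?)
open import Relation.Nullary.Decidable using (dec-true; dec-false; map′; _×-dec_)
open import Relation.Unary using (Pred; ∁) renaming (Decidable to Decidable₁)

open Sum +-0-commutativeMonoid using (sum; sum-cong-≗; ∑-comm; sum-permute)

-- Coxeter length is replaced by the `defect` of `w`, half the squared distance between ρ and its
-- image under `w`. A simple reflection changes it by a single pairing, so it drives the induction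
-- showing that the stabilizer of a dominant vector is generated by simple reflections; an element
-- of least defect in a coset turns conjugacy of parabolic subgroups into conjugacy of their sets of
-- generators.
--
-- Conjugacy is needed in W, while cycle types only control it in the group of all signed
-- permutations, some of whose classes split in W. The conjugators obtained from cycle types are
-- therefore unsigned permutations, which lie in W; near a block of type D they are chosen to
-- commute with `u`. A subset containing u but not s₁ has no such description and is carried into S′
-- by the diagram automorphism.
--
-- The prime 2 differs because an element of the normalizer may map a block to its own negative. For
-- odd p this cannot happen along an orbit of length p, so p different blocks are met. Merging adds
-- generators and therefore terminates.

-- Periods and free maps of prime order on finite sets.

prime∤⇒coprime : ∀ {p d} → Prime p → p ∤ d → Coprime p d
prime∤⇒coprime pp p∤d (e∣p , e∣d) with prime⇒irreducible pp e∣p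
... | inj₁ e≡1  = e≡1
... | inj₂ refl = contradiction e∣d p∤d

-- The periods of an orbit of length dividing p.
prime∣period : ∀ {p} → Prime p → (P : ℕ → Set) →
               (∀ a b → P a → P b → P (a + b)) → (∀ a b → P a → P (a + b) → P b) →
               P p → ¬ P 1 → ∀ {d} → P d → p ∣ d
prime∣period {p} pp P add sub Pp ¬P1 {d} Pd with p ∣? d
... | yes p∣d = p∣d
... | no  p∤d = contradiction P1 ¬P1
  where
  mult : ∀ {m} → P m → ∀ k → P (k * m)
  mult {m} Pm zero    = sub m 0 Pm (subst P (sym (+-identityʳ m)) Pm)
  mult {m} Pm (suc k) = add m (k * m) Pm (mult Pm k)

  -- If p did not divide d, Bézout would write 1 as a difference of multiples of p and d, all of
  -- which are periods.
  P1 : P 1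
  P1 with coprime-Bézout (prime∤⇒coprime pp p∤d)
  ... | Bézout.+- x y eq = sub (y * d) 1 (mult Pd y) (subst P (trans (sym eq) (+-comm 1 _)) (mult Pp x))
  ... | Bézout.-+ x y eq = sub (x * p) 1 (mult Pp x) (subst P (trans (sym eq) (+-comm 1 _)) (mult Pd y))

indicator : ∀ {A : Set} → Dec A → ℕ
indicator a? = if does a? then 1 else 0

indicator-cong : ∀ {A B : Set} (a? : Dec A) (b? : Dec B) → (A → B) → (B → A) → indicator a? ≡ indicator b?
indicator-cong (yes a) (yes b) f g = refl
indicator-cong (yes a) (no ¬b) f g = contradiction (f a) ¬b
indicator-cong (no ¬a) (yes b) f g = contradiction (g b) ¬a
indicator-cong (no ¬a) (no ¬b) f g = refl

sum-const : ∀ n c → sum {n} (λ _ → c) ≡ n * c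
sum-const zero    c = refl
sum-const (suc n) c = cong (λ w → c + w) (sum-const n c)

sum-indicator-≡ : ∀ {n} (j : Fin n) → sum (λ i → indicator (i Fin.≟ j)) ≡ 1
sum-indicator-≡ {suc n} zero = cong suc (trans (sum-const n 0) (*-zeroʳ n))
sum-indicator-≡ {suc n} (suc j) = trans
  (sum-cong-≗ {n} (λ i → indicator-cong (suc i Fin.≟ suc j) (i Fin.≟ j) Fin.suc-injective (cong suc)))
  (sum-indicator-≡ j)

argmin : ∀ {q} (g : Fin (suc q) → ℕ) → ∃[ k ] ∀ l → g k ≤ g l
argmin {zero}  g = zero , λ { zero → ≤-refl }
argmin {suc q} g with argmin (g ∘ suc)
... | k , k-min with ≤-total (g zero) (g (suc k))
...   | inj₁ le = zero , λ { zero → ≤-refl ; (suc l) → ≤-trans le (k-min l) }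
...   | inj₂ ge = suc k , λ { zero → ge ; (suc l) → k-min l }

module _ {A : Set} (f : A → A) where

  fold-comm : ∀ x m n → fold (fold x f n) f m ≡ fold (fold x f m) f n
  fold-comm x m n = trans (sym (fold-+ x f m)) (trans (cong (fold x f) (+-comm m n)) (fold-+ x f n))

-- Each orbit has exactly p elements: count its least element.
module _ {p m} (pp : Prime p) (f : Fin m → Fin m) (f^p≡id : ∀ i → fold i f p ≡ i) (free : ∀ i → f i ≢ i) where
  private
    instance _ = prime⇒nonZero pp

    f^ : ℕ → Fin m → Fin m
    f^ k i = fold i f k

    f^-+ : ∀ i k l → f^ (k + l) i ≡ f^ k (f^ l i)
    f^-+ i k l = fold-+ i f k

    f^-mult : ∀ i q → f^ (q * p) i ≡ i
    f^-mult i zero    = refl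
    f^-mult i (suc q) = trans (f^-+ i p (q * p)) (trans (f^p≡id _) (f^-mult i q))

    f^-% : ∀ i k → f^ (k % p) i ≡ f^ k i
    f^-% i k = sym (trans (cong (λ z → f^ z i) (m≡m%n+[m/n]*n k p))
      (trans (f^-+ i (k % p) _) (cong (f^ (k % p)) (f^-mult i (k / p)))))

    period : ∀ i {d} → f^ d i ≡ i → p ∣ d
    period i = prime∣period pp (λ d → f^ d i ≡ i)
      (λ a b Pa Pb → trans (f^-+ i a b) (trans (cong (f^ a) Pb) Pa))
      (λ a b Pa Pab → trans (cong (f^ b) (sym Pa)) (trans (sym (f^-+ i b a)) (trans (cong (λ z → f^ z i) (+-comm b a)) Pab)))
      (f^p≡id i) (free i)

    back : ∀ i k → k ≤ p → f^ (p ∸ k) (f^ k i) ≡ i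
    back i k k≤p = trans (sym (f^-+ i (p ∸ k) k)) (trans (cong (λ z → f^ z i) (m∸n+n≡m k≤p)) (f^p≡id i))

    distinct≤ : ∀ i {k l} → k ≤ l → l < p → f^ k i ≡ f^ l i → k ≡ l
    distinct≤ i {k} {l} k≤l l<p eq = ≤-antisym k≤l (m∸n≡0⇒m≤n (d≡0 (l ∸ k) p∣d (≤-<-trans (m∸n≤m l k) l<p)))
      where
      d≡0 : ∀ d → p ∣ d → d < p → d ≡ 0
      d≡0 zero    _ _   = refl
      d≡0 (suc d) p∣d d<p = contradiction p∣d (>⇒∤ d<p)
      p∣d : p ∣ l ∸ k
      p∣d = period i {l ∸ k} (trans (sym (back _ k (≤-trans k≤l (<⇒≤ l<p))))
        (trans (cong (f^ (p ∸ k)) (trans (sym (f^-+ i k (l ∸ k))) (trans (cong (λ z → f^ z i) (m+[n∸m]≡n k≤l)) (sym eq))))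
               (back i k (≤-trans k≤l (<⇒≤ l<p)))))

    distinct : ∀ i {k l} → k < p → l < p → f^ k i ≡ f^ l i → k ≡ l
    distinct i {k} {l} k<p l<p eq with ≤-total k l
    ... | inj₁ k≤l = distinct≤ i k≤l l<p eq
    ... | inj₂ l≤k = sym (distinct≤ i l≤k k<p (sym eq))

    IsMin : Fin m → Set
    IsMin i = ∀ (k : Fin p) → toℕ i ≤ toℕ (f^ (toℕ k) i)

    isMin? : Decidable₁ IsMin
    isMin? i = Fin.all? (λ k → toℕ i ≤? toℕ (f^ (toℕ k) i))

    least : ∀ i → ∃[ k ] ∀ l → toℕ (f^ (toℕ {p} k) i) ≤ toℕ (f^ (toℕ {p} l) i)
    least i = go p (λ k → toℕ (f^ k i))
      where
      go : ∀ p .{{_ : NonZero p}} (g : ℕ → ℕ) → ∃[ k ] ∀ l → g (toℕ {p} k) ≤ g (toℕ {p} l)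
      go (suc q) g = argmin (g ∘ toℕ)

    least-ℕ : ∀ i l → toℕ (f^ (toℕ (proj₁ (least i))) i) ≤ toℕ (f^ l i)
    least-ℕ i l = subst (λ z → toℕ (f^ (toℕ k) i) ≤ toℕ z)
      (trans (cong (λ z → f^ z i) (Fin.toℕ-fromℕ< (m%n<n l p))) (f^-% i l)) (k≤ (fromℕ< (m%n<n l p)))
      where
      k = proj₁ (least i)
      k≤ = proj₂ (least i)

    isMin⇒ : ∀ i k → IsMin (f^ (toℕ k) i) → k ≡ proj₁ (least i)
    isMin⇒ i k min = Fin.toℕ-injective (distinct i (Fin.toℕ<n k) (Fin.toℕ<n k₀)
      (Fin.toℕ-injective (≤-antisym
        (subst (λ z → toℕ (f^ (toℕ k) i) ≤ toℕ z) reach (min j))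
        (least-ℕ i (toℕ k)))))
      where
      k₀ = proj₁ (least i)
      e = toℕ k₀ + (p ∸ toℕ k)
      j = fromℕ< (m%n<n e p)
      reach : f^ (toℕ j) (f^ (toℕ k) i) ≡ f^ (toℕ k₀) i
      reach = trans (cong (λ z → f^ z (f^ (toℕ k) i)) (Fin.toℕ-fromℕ< (m%n<n e p)))
        (trans (f^-% _ e) (trans (f^-+ _ (toℕ k₀) (p ∸ toℕ k))
          (cong (f^ (toℕ k₀)) (back i (toℕ k) (<⇒≤ (Fin.toℕ<n k))))))

    isMin⇐ : ∀ i k → k ≡ proj₁ (least i) → IsMin (f^ (toℕ k) i)
    isMin⇐ i k refl l = subst (λ z → toℕ (f^ (toℕ k) i) ≤ toℕ z) (f^-+ i (toℕ l) (toℕ k)) (least-ℕ i (toℕ l + toℕ k))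

    shift : Fin p → Perm.Permutation′ m
    shift k = mk↔ₛ′ (f^ (toℕ k)) (f^ (p ∸ toℕ k))
      (λ i → trans (fold-comm f i (toℕ k) (p ∸ toℕ k)) (back i (toℕ k) (<⇒≤ (Fin.toℕ<n k))))
      (λ i → back i (toℕ k) (<⇒≤ (Fin.toℕ<n k)))

  free⇒prime∣ : p ∣ m
  free⇒prime∣ = divides (sum (indicator ∘ isMin?)) (begin
    m                                                                ≡⟨ trans (sym (*-identityʳ m)) (sym (sum-const m 1)) ⟩
    -- For each `i` exactly one shift leads to the least element of its orbit. After exchanging the
    -- sums, each inner sum is reindexed by the permutation `shift k`, so all p of them are equal.
    sum {m} (λ _ → 1)                                                ≡⟨ sum-cong-≗ {m} (λ i → trans (sym (sum-indicator-≡ (proj₁ (least i))))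
                                                                          (sum-cong-≗ {p} (λ k → indicator-cong (k Fin.≟ _) (isMin? (f^ (toℕ k) i)) (isMin⇐ i k) (isMin⇒ i k)))) ⟩
    sum {m} (λ i → sum {p} (λ k → indicator (isMin? (f^ (toℕ k) i))))  ≡⟨ ∑-comm {m} {p} _ ⟩
    sum {p} (λ k → sum {m} (λ i → indicator (isMin? (f^ (toℕ k) i))))  ≡⟨ sum-cong-≗ {p} (λ k → sym (sum-permute (indicator ∘ isMin?) (shift k))) ⟩
    sum {p} (λ k → sum (indicator ∘ isMin?))                         ≡⟨ sum-const p _ ⟩
    p * sum (indicator ∘ isMin?)                                     ≡⟨ *-comm p _ ⟩
    sum (indicator ∘ isMin?) * p                                     ∎)
    where open ≡.≡-Reasoning

-- Sizes of setoids and fixed points modulo a prime.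

restrict : (S : Setoid 0ℓ 0ℓ) → Pred (Setoid.Carrier S) 0ℓ → Setoid 0ℓ 0ℓ
restrict S P = On.setoid S (proj₁ {B = P})

HasSize-resp : ∀ {S T : Setoid 0ℓ 0ℓ} {m} → Inverse S T → HasSize T m → HasSize S m
HasSize-resp = Comp.inverse

HasSize-unique : ∀ {S a b} → HasSize S a → HasSize S b → a ≡ b
HasSize-unique A B = Perm.↔⇒≡ (Comp.inverse (Symm.inverse A) B)

module _ {S : Setoid 0ℓ 0ℓ} {m} (size : HasSize S m) where
  open Setoid S using (Carrier; _≈_) renaming (refl to ≈-refl; sym to ≈-sym; trans to ≈-trans)
  open Inverse size

  HasSize⇒injective : ∀ {x y} → to x ≡ to y → x ≈ y
  HasSize⇒injective {x} {y} eq = ≈-trans (≈-sym (strictlyInverseʳ x)) (≈-trans (from-cong eq) (strictlyInverseʳ y))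

  HasSize⇒Enumerable : Enumerable S
  HasSize⇒Enumerable = record
    { _≟_      = λ x y → map′ HasSize⇒injective to-cong (to x Fin.≟ to y)
    ; elements = List.map from (allFin m)
    ; complete = λ x → Any.map (λ { refl → ≈-sym (strictlyInverseʳ x) }) (Memₚ.∈-map⁺ from (Memₚ.∈-allFin (to x)))
    }
  module _ {P : Pred Carrier 0ℓ} (P? : Decidable₁ P) (resp : P Respects _≈_) where

    abstract
     restrict-size : ∃[ a ] HasSize (restrict S P) a
     restrict-size = Enumerable⇒size (subsetoid-enumerable HasSize⇒Enumerable P? resp)

    HasSize-split : ∀ {a b} → HasSize (restrict S P) a → HasSize (restrict S (∁ P)) b → a + b ≡ m
    HasSize-split {a} {b} A B = Perm.↔⇒≡ (Comp.inverse (Fin.+↔⊎ {a} {b}) (mk↔ₛ′ f g fg gf))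
      where
      module A = Inverse A
      module B = Inverse B
      f : Fin a ⊎ Fin b → Fin m
      f (inj₁ i) = to (proj₁ (A.from i))
      f (inj₂ i) = to (proj₁ (B.from i))
      g′ : (x : Carrier) → Dec (P x) → Fin a ⊎ Fin b
      g′ x (yes px) = inj₁ (A.to (x , px))
      g′ x (no ¬px) = inj₂ (B.to (x , ¬px))
      g : Fin m → Fin a ⊎ Fin b
      g i = g′ (from i) (P? (from i))
      fg′ : ∀ i (d : Dec (P (from i))) → f (g′ (from i) d) ≡ i
      fg′ i (yes p) = trans (to-cong (A.strictlyInverseʳ (from i , p))) (strictlyInverseˡ i)
      fg′ i (no ¬p) = trans (to-cong (B.strictlyInverseʳ (from i , ¬p))) (strictlyInverseˡ i)
      fg : ∀ i → f (g i) ≡ i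
      fg i = fg′ i (P? (from i))
      gf : ∀ z → g (f z) ≡ z
      gf (inj₁ i) with P? (from (f (inj₁ i)))
      ... | yes p = cong inj₁ (trans (A.to-cong (strictlyInverseʳ _)) (A.strictlyInverseˡ i))
      ... | no ¬p = contradiction (resp (≈-sym (strictlyInverseʳ _)) (proj₂ (A.from i))) ¬p
      gf (inj₂ i) with P? (from (f (inj₂ i)))
      ... | yes p = contradiction (resp (strictlyInverseʳ _) p) (proj₂ (B.from i))
      ... | no ¬p = cong inj₂ (trans (B.to-cong (strictlyInverseʳ _)) (B.strictlyInverseˡ i))

  module _ {p} (pp : Prime p) (f : Carrier → Carrier) (f-cong : ∀ {x y} → x ≈ y → f x ≈ f y) where

    private
      transport : ∀ x k → fold (to x) (to ∘ f ∘ from) k ≡ to (fold x f k)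
      transport x zero    = refl
      transport x (suc k) = trans (cong (to ∘ f ∘ from) (transport x k)) (to-cong (f-cong (strictlyInverseʳ _)))

    free⇒prime∣size : (∀ x → fold x f p ≈ x) → (∀ x → ¬ f x ≈ x) → p ∣ m
    free⇒prime∣size f^p≈id free = free⇒prime∣ pp (to ∘ f ∘ from)
      (λ i → trans (cong (λ z → fold z (to ∘ f ∘ from) p) (sym (strictlyInverseˡ i)))
        (trans (transport (from i) p) (trans (to-cong (f^p≈id (from i))) (strictlyInverseˡ i))))
      (λ i eq → free (from i) (HasSize⇒injective (trans eq (sym (strictlyInverseˡ i)))))

module _ {S : Setoid 0ℓ 0ℓ} {p} (pp : Prime p) (f : Setoid.Carrier S → Setoid.Carrier S)
         (f-cong : ∀ {x y} → Setoid._≈_ S x y → Setoid._≈_ S (f x) (f y)) where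
  open Setoid S using (Carrier; _≈_) renaming (refl to ≈-refl; sym to ≈-sym; trans to ≈-trans)

  Fixed : ℕ → Pred Carrier 0ℓ
  Fixed k x = fold x f k ≈ x

  fold-cong : ∀ k {x y} → x ≈ y → fold x f k ≈ fold y f k
  fold-cong zero    x≈y = x≈y
  fold-cong (suc k) x≈y = f-cong (fold-cong k x≈y)

  fixed-resp : ∀ k → Fixed k Respects _≈_
  fixed-resp k x≈y fx = ≈-trans (fold-cong k (≈-sym x≈y)) (≈-trans fx x≈y)

  fixed-mult : ∀ k {x} → Fixed 1 x → Fixed k x
  fixed-mult zero    fx = ≈-refl
  fixed-mult (suc k) fx = ≈-trans (f-cong (fixed-mult k fx)) fx

  -- On the points of `Fixed p` outside `Fixed 1`, `f` has order p and no fixed point, so their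
  -- number `q` is a multiple of p.
  #fixed-mod-prime : ∀ {a b} → HasSize (restrict S (Fixed 1)) a → HasSize (restrict S (Fixed p)) b →
                     ∃[ q ] p ∣ q × a + q ≡ b
  #fixed-mod-prime {a} {b} A B = q , free⇒prime∣size (proj₂ unfixed) pp g (f-cong)
      (λ ((x , fx) , _) → ≈-trans (g^ _ p) fx) (λ (_ , ¬fx) → ¬fx)
    , HasSize-split B fixed? (fixed-resp 1) (HasSize-resp both A) (proj₂ unfixed)
    where
    X : Setoid 0ℓ 0ℓ
    X = restrict S (Fixed p)
    P : Pred (Setoid.Carrier X) 0ℓ
    P x = Fixed 1 (proj₁ x)
    fixed? : Decidable₁ P
    fixed? (x , fx) = Enumerable._≟_ (HasSize⇒Enumerable B) (f x , f-fixed) (x , fx)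
      where
      f-fixed : Fixed p (f x)
      f-fixed = ≈-trans (Setoid.reflexive S (fold-comm f x p 1)) (f-cong fx)
    unfixed : ∃[ q ] HasSize (restrict X (∁ P)) q
    unfixed = restrict-size B (λ x → ¬? (fixed? x)) (λ x≈y ¬fx fy → ¬fx (fixed-resp 1 (≈-sym x≈y) fy))
    q = proj₁ unfixed
    g : Setoid.Carrier (restrict X (∁ P)) → Setoid.Carrier (restrict X (∁ P))
    g ((x , fx) , ¬fx) = (f x , fp) , λ ffx → ¬fx (back ffx)
      where
      fp : Fixed p (f x)
      fp = ≈-trans (Setoid.reflexive S (fold-comm f x p 1)) (f-cong fx)
      -- With p = k + 1, the point x ≈ f^k (f x) equals f x as soon as f x is fixed.
      back : Fixed 1 (f x) → Fixed 1 x
      back ffx = go p (prime⇒nonZero pp) fx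
        where
        go : ∀ k → NonZero k → Fixed k x → Fixed 1 x
        go (suc k) _ fx = ≈-trans (≈-sym (fixed-mult k ffx)) (≈-trans (Setoid.reflexive S (fold-comm f x k 1)) fx)
    g^ : ∀ y k → Setoid._≈_ S (proj₁ (proj₁ (fold y g k))) (fold (proj₁ (proj₁ y)) f k)
    g^ y zero    = ≈-refl
    g^ y (suc k) = f-cong (g^ y k)
    both : Inverse (restrict X P) (restrict S (Fixed 1))
    both = record
      { to = λ ((x , _) , fx) → x , fx
      ; from = λ (x , fx) → (x , fixed-mult p fx) , fx
      ; to-cong = id ; from-cong = id
      ; inverse = id , id }

  -- The number of fixed points is divisible by p.
  another-fixed : ∀ {m} → HasSize S m → p ∣ m → (∀ x → Fixed p x) → ∀ x₀ → Fixed 1 x₀ →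
                  ∃[ x ] Fixed 1 x × ¬ x ≈ x₀
  another-fixed {m} M p∣m f^p≈id x₀ fx₀ = pick a A (x₀ , fx₀) p∣a
    where
    fixed? : Decidable₁ (Fixed 1)
    fixed? x = Enumerable._≟_ (HasSize⇒Enumerable M) (f x) x
    fixed = restrict-size M fixed? (fixed-resp 1)
    a = proj₁ fixed
    A = proj₂ fixed
    all : HasSize (restrict S (Fixed p)) m
    all = HasSize-resp (record { to = proj₁ ; from = λ x → x , f^p≈id x ; to-cong = id ; from-cong = id
                               ; inverse = id , id }) M
    p∣a : p ∣ a
    p∣a = let (q , p∣q , a+q≡m) = #fixed-mod-prime A all in
      ∣m+n∣m⇒∣n (subst (p ∣_) (trans (sym a+q≡m) (+-comm a q)) p∣m) p∣q
    pick : ∀ a → HasSize (restrict S (Fixed 1)) a → Σ Carrier (Fixed 1) → p ∣ a → ∃[ x ] Fixed 1 x × ¬ x ≈ x₀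
    pick zero A x _ = contradiction (Inverse.to A x) Fin.¬Fin0
    pick (suc zero) A x p∣1 = contradiction (∣1⇒≡1 p∣1) (nonTrivial⇒≢1 {{prime⇒nonTrivial pp}})
    pick (suc (suc a)) A x _ = choose (Inverse.to A (x₀ , fx₀) Fin.≟ zero)
      where
      choose : Dec (Inverse.to A (x₀ , fx₀) ≡ zero) → ∃[ x ] Fixed 1 x × ¬ x ≈ x₀
      choose (yes eq) = let (y , fy) = Inverse.from A (suc zero) in y , fy , λ y≈x₀ → Fin.0≢1+n
        (trans (sym eq) (trans (Inverse.to-cong A (≈-sym y≈x₀)) (Inverse.strictlyInverseˡ A (suc zero))))
      choose (no neq) = let (y , fy) = Inverse.from A zero in y , fy , λ y≈x₀ → neq
        (trans (Inverse.to-cong A (≈-sym y≈x₀)) (Inverse.strictlyInverseˡ A zero))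

-- Congruences, inverses and prime powers.

-- Multiples are added on both sides, which avoids truncated subtraction and any comparison of `a`
-- with `b`.
_≡_[mod_] : ℕ → ℕ → ℕ → Set
a ≡ b [mod p ] = ∃₂ λ u v → a + u * p ≡ b + v * p

module _ {p : ℕ} where

  ≡mod-refl : ∀ {a} → a ≡ a [mod p ]
  ≡mod-refl = 0 , 0 , refl

  ≡mod-sym : ∀ {a b} → a ≡ b [mod p ] → b ≡ a [mod p ]
  ≡mod-sym (u , v , eq) = v , u , sym eq

  ≡mod-trans : ∀ {a b c} → a ≡ b [mod p ] → b ≡ c [mod p ] → a ≡ c [mod p ]
  ≡mod-trans {a} {b} {c} (u , v , eq) (u′ , v′ , eq′) = u + u′ , v + v′ , (begin
    a + (u + u′) * p        ≡⟨ solve 4 (λ a u u′ p → a :+ (u :+ u′) :* p := (a :+ u :* p) :+ u′ :* p) refl a u u′ p ⟩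
    (a + u * p) + u′ * p    ≡⟨ cong (_+ u′ * p) eq ⟩
    (b + v * p) + u′ * p    ≡⟨ solve 4 (λ b v u′ p → (b :+ v :* p) :+ u′ :* p := (b :+ u′ :* p) :+ v :* p) refl b v u′ p ⟩
    (b + u′ * p) + v * p    ≡⟨ cong (_+ v * p) eq′ ⟩
    (c + v′ * p) + v * p    ≡⟨ solve 4 (λ c v v′ p → (c :+ v′ :* p) :+ v :* p := c :+ (v :+ v′) :* p) refl c v v′ p ⟩
    c + (v + v′) * p        ∎)
    where
    open ≡.≡-Reasoning
    open +-*-Solver

  ≡mod-∣ : ∀ {a b} → a ≡ b [mod p ] → p ∣ a → p ∣ b
  ≡mod-∣ {a} {b} (u , v , eq) p∣a = ∣m+n∣m⇒∣n
    (subst (p ∣_) (trans eq (+-comm b _)) (∣m∣n⇒∣m+n p∣a (n∣m*n u))) (n∣m*n v)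

  private
    ≤-≡mod : ∀ {a b} → a ≤ b → a ≡ b [mod p ] → p ∣ b ∸ a
    ≤-≡mod {a} {b} a≤b (u , v , eq) = ∣m+n∣m⇒∣n (subst (p ∣_) eq′ (n∣m*n u)) (n∣m*n v)
      where
      eq′ : u * p ≡ v * p + (b ∸ a)
      eq′ = +-cancelˡ-≡ a _ _ (trans eq (trans (cong (_+ v * p) (sym (m+[n∸m]≡n a≤b)))
        (trans (+-assoc a (b ∸ a) _) (cong (λ w → a + w) (+-comm (b ∸ a) _)))))

    ≤-∣ : ∀ {a b} → a ≤ b → p ∣ b ∸ a → a ≡ b [mod p ]
    ≤-∣ {a} {b} a≤b (divides q eq) = q , 0 , trans (cong (λ w → a + w) (sym eq)) (trans (m+[n∸m]≡n a≤b) (sym (+-identityʳ b)))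

  ≡mod⇒∣ : ∀ {a b} → a ≡ b [mod p ] → p ∣ ∣ a - b ∣
  ≡mod⇒∣ {a} {b} eq with ≤-total a b
  ... | inj₁ a≤b = subst (p ∣_) (sym (m≤n⇒∣m-n∣≡n∸m a≤b)) (≤-≡mod a≤b eq)
  ... | inj₂ b≤a = subst (p ∣_) (sym (m≤n⇒∣n-m∣≡n∸m b≤a)) (≤-≡mod b≤a (≡mod-sym eq))

  ∣⇒≡mod : ∀ {a b} → p ∣ ∣ a - b ∣ → a ≡ b [mod p ]
  ∣⇒≡mod {a} {b} d with ≤-total a b
  ... | inj₁ a≤b = ≤-∣ a≤b (subst (p ∣_) (m≤n⇒∣m-n∣≡n∸m a≤b) d)
  ... | inj₂ b≤a = ≡mod-sym (≤-∣ b≤a (subst (p ∣_) (m≤n⇒∣n-m∣≡n∸m b≤a) d))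

  ∣∣⇒≡mod : ∀ {a b} → p ∣ a → p ∣ b → a ≡ b [mod p ]
  ∣∣⇒≡mod {a} {b} (divides q eq) (divides r eq′) = r , q , trans (cong₂ _+_ eq (sym eq′)) (+-comm (q * p) b)

coprime-inverse : ∀ {m n} → Coprime m n → 0 < m → 0 < n → ∃₂ λ t s → m * t ≡ 1 + n * s
coprime-inverse {m} {n} c 0<m 0<n with coprime-Bézout c
... | Bézout.+- x y eq = x , y , trans (*-comm m x) (trans (sym eq) (cong suc (*-comm y n)))
... | Bézout.-+ x y eq = go (x * m) refl
  where
  go : ∀ z → x * m ≡ z → ∃₂ λ t s → m * t ≡ 1 + n * s
  -- The inverse below uses the predecessor of `x * m`. If `x * m` is 0, then y n = 1, hence n = 1
  -- and 1 is an inverse.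
  go zero    xm≡0 = 1 , pred m , trans (*-identityʳ m) (trans (sym (suc-pred m {{>-nonZero 0<m}}))
    (cong suc (sym (trans (cong (_* pred m) n≡1) (+-identityʳ _)))))
    where
    n≡1 : n ≡ 1
    n≡1 = m*n≡1⇒n≡1 y n (trans (sym eq) (cong suc xm≡0))
  -- Here m x is -1 modulo n, so the product of m with x (x m) is (-1)² = 1. With x m = z + 1 the
  -- excess is z (z + 2), and z + 2 = 1 + x m = y n.
  go (suc z) xm≡z = x * suc z , z * y , (begin
    m * (x * suc z)      ≡⟨ trans (sym (*-assoc m x _)) (cong (_* suc z) (trans (*-comm m x) xm≡z)) ⟩
    suc z * suc z        ≡⟨ solve 1 (λ z → (con 1 :+ z) :* (con 1 :+ z) := con 1 :+ z :* (con 1 :+ (con 1 :+ z))) refl z ⟩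
    1 + z * (1 + suc z)  ≡⟨ cong (λ w → 1 + z * w) (trans (cong suc (sym xm≡z)) eq) ⟩
    1 + z * (y * n)      ≡⟨ cong suc (trans (sym (*-assoc z y n)) (*-comm (z * y) n)) ⟩
    1 + n * (z * y)      ∎)
    where
    open ≡.≡-Reasoning
    open +-*-Solver

prime-power-part : ∀ {p} → Prime p → ∀ n → 0 < n → ∃₂ λ k m → n ≡ p ^ k * m × p ∤ m × 0 < m
prime-power-part {p} pp = <-rec _ step
  where
  instance _ = prime⇒nonZero pp
  Goal : ℕ → Set
  Goal n = 0 < n → ∃₂ λ k m → n ≡ p ^ k * m × p ∤ m × 0 < m
  step : ∀ n → (∀ {m} → m < n → Goal m) → Goal n
  step n rec 0<n with p ∣? n
  ... | no p∤n = 0 , n , sym (+-identityʳ n) , p∤n , 0<n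
  ... | yes (divides q eq) =
    let instance _ = >-nonZero 0<q in
    let (k , m , q≡ , p∤m , 0<m) = rec (subst (q <_) (sym eq) (m<m*n q p (nonTrivial⇒n>1 p {{prime⇒nonTrivial pp}}))) 0<q
    in suc k , m , trans eq (trans (cong (_* p) q≡) (trans (*-comm _ p) (sym (*-assoc p (p ^ k) m)))) , p∤m , 0<m
    where
    0<q : 0 < q
    0<q = n≢0⇒n>0 λ { refl → n≮n 0 (subst (0 <_) eq 0<n) }

∣prime-power : ∀ {p} → Prime p → ∀ a {d} → d ∣ p ^ a → ∃[ b ] d ≡ p ^ b
∣prime-power pp zero d∣1 = 0 , ∣1⇒≡1 d∣1
∣prime-power {p} pp (suc a) {d} d∣ with p ∣? d
... | no p∤d = ∣prime-power pp a (Coprime.coprime-divisor (Coprime.sym (prime∤⇒coprime pp p∤d)) d∣)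
... | yes (divides e refl) = let (b , e≡) = ∣prime-power pp a {e} (*-cancelʳ-∣ {e} p {{prime⇒nonZero pp}} (subst (e * p ∣_) (*-comm p (p ^ a)) d∣))
  in suc b , trans (cong (_* p) e≡) (*-comm _ p)

coprime-^ : ∀ {p} → Prime p → ∀ A {M} → Coprime p M → Coprime (p ^ A) M
coprime-^ pp A {M} c (d∣pᴬ , d∣M) with ∣prime-power pp A d∣pᴬ
... | zero  , refl = refl
... | suc b , refl = contradiction (c (∣-refl , ∣-trans (m∣m*n _) d∣M)) (nonTrivial⇒≢1 {{prime⇒nonTrivial pp}})

least-positive : ∀ {P : ℕ → Set} → Decidable₁ P → ∀ n → (∃[ k ] 0 < k × P k × (∀ m → 0 < m → P m → k ≤ m)) ⊎ (∀ m → 0 < m → m ≤ n → ¬ P m)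
least-positive P? zero = inj₂ λ m 0<m m≤0 _ → n≮n 0 (≤-trans 0<m m≤0)
least-positive P? (suc n) with least-positive P? n
... | inj₁ found = inj₁ found
... | inj₂ none with P? (suc n)
...   | yes p = inj₁ (suc n , z<s , p , λ m 0<m pm → ≮⇒≥ λ m<sn → none m 0<m (≤-pred m<sn) pm)
...   | no ¬p = inj₂ λ m 0<m m≤sn pm → case m≤n⇒m<n∨m≡n m≤sn of λ
        { (inj₁ m<sn) → none m 0<m (≤-pred m<sn) pm ; (inj₂ refl) → ¬p pm }

-- Deciding identities in the free group.

module GroupSolver (G : Group 0ℓ 0ℓ) where
  open Group G renaming (refl to ≈-refl; sym to ≈-sym; trans to ≈-trans)
  open GroupProperties G
  open SetoidReasoning setoid

  infixl 7 _⊕_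

  data Word (k : ℕ) : Set where
    var : Fin k → Word k
    ι   : Word k → Word k
    _⊕_ : Word k → Word k → Word k
    𝟙   : Word k

  module _ {k : ℕ} (ρ : Vec Carrier k) where

    ⟦_⟧ : Word k → Carrier
    ⟦ var i ⟧ = Vec.lookup ρ i
    ⟦ ι e ⟧   = ⟦ e ⟧ ⁻¹
    ⟦ e ⊕ f ⟧ = ⟦ e ⟧ ∙ ⟦ f ⟧
    ⟦ 𝟙 ⟧     = ε

    private
      signed-power : Bool → Carrier → Carrier
      signed-power true  x = x
      signed-power false x = x ⁻¹

      ⟦_⟧ₗ : List (Bool × Fin k) → Carrier
      ⟦ [] ⟧ₗ            = ε
      ⟦ (b , i) ∷ ls ⟧ₗ = signed-power b (Vec.lookup ρ i) ∙ ⟦ ls ⟧ₗ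

    cons : Bool × Fin k → List (Bool × Fin k) → List (Bool × Fin k)
    cons l [] = l ∷ []
    cons (b , i) ((c , j) ∷ ls) with ≡-dec Bool._≟_ Fin._≟_ (not b , i) (c , j)
    ... | yes _ = ls
    ... | no _  = (b , i) ∷ (c , j) ∷ ls

    -- Inverses are pushed down to the letters, `false` marking an inverted subword, and `cons`
    -- performs the free reduction.
    normal : Word k → Bool → List (Bool × Fin k) → List (Bool × Fin k)
    normal (var i) b acc = cons (b , i) acc
    normal (ι e)   b acc = normal e (not b) acc
    normal (e ⊕ f) true  acc = normal e true (normal f true acc)
    normal (e ⊕ f) false acc = normal f false (normal e false acc)
    normal 𝟙 b acc = acc

    private
      cons-correct : ∀ b i ls → ⟦ cons (b , i) ls ⟧ₗ ≈ signed-power b (Vec.lookup ρ i) ∙ ⟦ ls ⟧ₗ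
      cons-correct b i [] = ≈-refl
      cons-correct b i ((c , j) ∷ ls) with ≡-dec Bool._≟_ Fin._≟_ (not b , i) (c , j)
      ... | no _ = ≈-refl
      ... | yes refl = cancel b
        where
        x = Vec.lookup ρ i
        cancel : ∀ b → ⟦ ls ⟧ₗ ≈ signed-power b x ∙ (signed-power (not b) x ∙ ⟦ ls ⟧ₗ)
        cancel true = ≈-sym (\\-leftDividesˡ x _)
        cancel false = ≈-sym (\\-leftDividesʳ x _)

      normal-correct : ∀ e b acc → ⟦ normal e b acc ⟧ₗ ≈ signed-power b ⟦ e ⟧ ∙ ⟦ acc ⟧ₗ
      normal-correct (var i) b acc = cons-correct b i acc
      normal-correct (ι e) true acc = normal-correct e false acc
      normal-correct (ι e) false acc = ≈-trans (normal-correct e true acc) (∙-congʳ (≈-sym (⁻¹-involutive _)))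
      normal-correct (e ⊕ f) true acc = ≈-trans (normal-correct e true _)
        (≈-trans (∙-congˡ (normal-correct f true acc)) (≈-sym (assoc _ _ _)))
      normal-correct (e ⊕ f) false acc = ≈-trans (normal-correct f false _)
        (≈-trans (∙-congˡ (normal-correct e false acc)) (≈-trans (≈-sym (assoc _ _ _)) (∙-congʳ (≈-sym (⁻¹-anti-homo-∙ _ _)))))
      normal-correct 𝟙 true acc = ≈-sym (identityˡ _)
      normal-correct 𝟙 false acc = ≈-sym (≈-trans (∙-congʳ ε⁻¹≈ε) (identityˡ _))

    group-solve : ∀ e f → normal e true [] ≡ normal f true [] → ⟦ e ⟧ ≈ ⟦ f ⟧
    group-solve e f eq = begin
      ⟦ e ⟧                     ≈⟨ identityʳ _ ⟨
      ⟦ e ⟧ ∙ ε                 ≈⟨ normal-correct e true [] ⟨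
      ⟦ normal e true [] ⟧ₗ     ≡⟨ cong ⟦_⟧ₗ eq ⟩
      ⟦ normal f true [] ⟧ₗ     ≈⟨ normal-correct f true [] ⟩
      ⟦ f ⟧ ∙ ε                 ≈⟨ identityʳ _ ⟩
      ⟦ f ⟧                     ∎

  -- Four names suffice below; environments with fewer elements are padded by repetition.
  a b c d : ∀ {k} → Word (4 + k)
  a = var zero
  b = var (suc zero)
  c = var (suc (suc zero))
  d = var (suc (suc (suc zero)))

-- Powers, orders and p-regular parts.

module Powers (G : Group 0ℓ 0ℓ) where
  open Group G renaming (refl to ≈-refl; sym to ≈-sym; trans to ≈-trans)
  open GroupProperties G
  open Mult monoid using (×-congʳ; ×-congˡ; ×-homo-+; ×-assocˡ)
  open SetoidReasoning setoid
  open GroupSolver G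

  infixr 8 _^ᴳ_
  _^ᴳ_ : Carrier → ℕ → Carrier
  x ^ᴳ k = pow G x k

  pow-cong : ∀ k {x y} → x ≈ y → x ^ᴳ k ≈ y ^ᴳ k
  pow-cong = ×-congʳ

  pow-+ : ∀ x m n → x ^ᴳ (m + n) ≈ x ^ᴳ m ∙ x ^ᴳ n
  pow-+ = ×-homo-+

  pow-* : ∀ x m n → x ^ᴳ (m * n) ≈ (x ^ᴳ m) ^ᴳ n
  pow-* x m n = ≈-trans (×-congˡ (*-comm m n)) (≈-sym (×-assocˡ x n m))

  pow-ε : ∀ k → ε ^ᴳ k ≈ ε
  pow-ε zero    = ≈-refl
  pow-ε (suc k) = ≈-trans (identityˡ _) (pow-ε k)

  pow-mult : ∀ x m n → x ^ᴳ m ≈ ε → x ^ᴳ (m * n) ≈ ε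
  pow-mult x m n eq = ≈-trans (pow-* x m n) (≈-trans (pow-cong n eq) (pow-ε n))

  pow-∣ : ∀ x {m n} → x ^ᴳ m ≈ ε → m ∣ n → x ^ᴳ n ≈ ε
  pow-∣ x {m} eq (divides q refl) = ≈-trans (×-congˡ (*-comm q m)) (pow-mult x m q eq)

  commutes-pow : ∀ x y k → x ∙ y ≈ y ∙ x → x ^ᴳ k ∙ y ≈ y ∙ x ^ᴳ k
  commutes-pow x y zero xy = ≈-trans (identityˡ y) (≈-sym (identityʳ y))
  commutes-pow x y (suc k) xy = begin
    (x ∙ x ^ᴳ k) ∙ y   ≈⟨ assoc _ _ _ ⟩
    x ∙ (x ^ᴳ k ∙ y)   ≈⟨ ∙-congˡ (commutes-pow x y k xy) ⟩
    x ∙ (y ∙ x ^ᴳ k)   ≈⟨ assoc _ _ _ ⟨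
    (x ∙ y) ∙ x ^ᴳ k   ≈⟨ ∙-congʳ xy ⟩
    (y ∙ x) ∙ x ^ᴳ k   ≈⟨ assoc _ _ _ ⟩
    y ∙ (x ∙ x ^ᴳ k)   ∎

  pow-∙ : ∀ x y k → x ∙ y ≈ y ∙ x → (x ∙ y) ^ᴳ k ≈ x ^ᴳ k ∙ y ^ᴳ k
  pow-∙ x y zero xy = ≈-sym (identityˡ ε)
  pow-∙ x y (suc k) xy = begin
    (x ∙ y) ∙ (x ∙ y) ^ᴳ k       ≈⟨ ∙-congˡ (pow-∙ x y k xy) ⟩
    (x ∙ y) ∙ (x ^ᴳ k ∙ y ^ᴳ k)  ≈⟨ group-solve (x ∷ y ∷ x ^ᴳ k ∷ y ^ᴳ k ∷ []) ((a ⊕ b) ⊕ (c ⊕ d)) (a ⊕ (b ⊕ c) ⊕ d) refl ⟩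
    x ∙ (y ∙ x ^ᴳ k) ∙ y ^ᴳ k    ≈⟨ ∙-congʳ (∙-congˡ (commutes-pow x y k xy)) ⟨
    x ∙ (x ^ᴳ k ∙ y) ∙ y ^ᴳ k    ≈⟨ group-solve (x ∷ y ∷ x ^ᴳ k ∷ y ^ᴳ k ∷ []) (a ⊕ (c ⊕ b) ⊕ d) ((a ⊕ c) ⊕ (b ⊕ d)) refl ⟩
    (x ∙ x ^ᴳ k) ∙ (y ∙ y ^ᴳ k)  ∎

  pow-inv : ∀ x k → x ^ᴳ k ≈ ε → (x ⁻¹) ^ᴳ k ≈ ε
  pow-inv x k eq = begin
    (x ⁻¹) ^ᴳ k               ≈⟨ identityˡ _ ⟨
    ε ∙ (x ⁻¹) ^ᴳ k           ≈⟨ ∙-congʳ eq ⟨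
    x ^ᴳ k ∙ (x ⁻¹) ^ᴳ k      ≈⟨ pow-∙ x (x ⁻¹) k (≈-trans (inverseʳ x) (≈-sym (inverseˡ x))) ⟨
    (x ∙ x ⁻¹) ^ᴳ k           ≈⟨ pow-cong k (inverseʳ x) ⟩
    ε ^ᴳ k                    ≈⟨ pow-ε k ⟩
    ε                         ∎

  pow-conj : ∀ g x k → (g ∙ x ∙ g ⁻¹) ^ᴳ k ≈ g ∙ x ^ᴳ k ∙ g ⁻¹
  pow-conj g x zero = ≈-sym (≈-trans (∙-congʳ (identityʳ g)) (inverseʳ g))
  pow-conj g x (suc k) = ≈-trans (∙-congˡ (pow-conj g x k))
    (group-solve (g ∷ x ∷ x ^ᴳ k ∷ ε ∷ []) ((a ⊕ b ⊕ ι a) ⊕ (a ⊕ c ⊕ ι a)) (a ⊕ (b ⊕ c) ⊕ ι a) refl)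

  conj-refl : ∀ {x y} → x ≈ y → Conjugate G x y
  conj-refl {x} x≈y = ε , ≈-trans (group-solve (x ∷ x ∷ x ∷ x ∷ []) (𝟙 ⊕ a ⊕ ι 𝟙) a refl) x≈y

  conj-sym : ∀ {x y} → Conjugate G x y → Conjugate G y x
  conj-sym {x} {y} (g , eq) = g ⁻¹ , ≈-trans (∙-congʳ (∙-congˡ (≈-sym eq)))
    (group-solve (g ∷ x ∷ x ∷ x ∷ []) (ι a ⊕ (a ⊕ b ⊕ ι a) ⊕ ι (ι a)) b refl)

  conj-trans : ∀ {x y z} → Conjugate G x y → Conjugate G y z → Conjugate G x z
  conj-trans {x} {y} {z} (g , eq) (h , eq′) = h ∙ g , ≈-trans
    (group-solve (g ∷ h ∷ x ∷ x ∷ []) ((b ⊕ a) ⊕ c ⊕ ι (b ⊕ a)) (b ⊕ (a ⊕ c ⊕ ι a) ⊕ ι b) refl)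
    (≈-trans (∙-congʳ (∙-congˡ eq)) eq′)

  conj-pow : ∀ {x y} k → Conjugate G x y → Conjugate G (x ^ᴳ k) (y ^ᴳ k)
  conj-pow {x} k (g , eq) = g , ≈-trans (≈-sym (pow-conj g x k)) (pow-cong k eq)

  conj-∙ : ∀ x y → Conjugate G (x ∙ y) (y ∙ x)
  conj-∙ x y = x ⁻¹ , group-solve (x ∷ y ∷ x ∷ x ∷ []) (ι a ⊕ (a ⊕ b) ⊕ ι (ι a)) (b ⊕ a) refl

  module _ (p : ℕ) where

    -- Stands in for conjugacy of regular parts: no decomposition has to be chosen, and passing to a
    -- common exponent makes it transitive.
    PowerConjugate : Carrier → Carrier → Set
    PowerConjugate v w = ∃[ a ] Conjugate G (v ^ᴳ (p ^ a)) (w ^ᴳ (p ^ a))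

    raise : ∀ {v w} a b → Conjugate G (v ^ᴳ (p ^ a)) (w ^ᴳ (p ^ a)) → Conjugate G (v ^ᴳ (p ^ (a + b))) (w ^ᴳ (p ^ (a + b)))
    raise {v} {w} a b vw = conj-trans (conj-refl (split v)) (conj-trans (conj-pow (p ^ b) vw) (conj-refl (≈-sym (split w))))
      where
      split : ∀ x → x ^ᴳ (p ^ (a + b)) ≈ (x ^ᴳ (p ^ a)) ^ᴳ (p ^ b)
      split x = ≈-trans (×-congˡ (^-distribˡ-+-* p a b)) (pow-* x (p ^ a) (p ^ b))

    powerConj-conj : ∀ {v w} → Conjugate G v w → PowerConjugate v w
    powerConj-conj vw = 0 , conj-pow 1 vw

    powerConj-trans : ∀ {u v w} → PowerConjugate u v → PowerConjugate v w → PowerConjugate u w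
    powerConj-trans {u} {v} {w} (a , uv) (b , vw) = a + b , conj-trans (raise {u} {v} a b uv)
      (subst (λ k → Conjugate G (v ^ᴳ (p ^ k)) (w ^ᴳ (p ^ k))) (+-comm b a) (raise {v} {w} b a vw))

  module _ {m} (size : HasSize setoid m) where

    finite-order : ∀ x → ∃[ k ] 0 < k × x ^ᴳ k ≈ ε
    finite-order x =
      let (i , j , i<j , eq) = Fin.pigeonhole (n<1+n m) (λ i → Inverse.to size (x ^ᴳ toℕ i))
      in toℕ j ∸ toℕ i , m<n⇒0<n∸m i<j , cancel (toℕ i) (toℕ j ∸ toℕ i)
           (≈-trans (HasSize⇒injective size eq) (×-congˡ (sym (m+[n∸m]≡n (<⇒≤ i<j)))))
      where
      cancel : ∀ i d → x ^ᴳ i ≈ x ^ᴳ (i + d) → x ^ᴳ d ≈ ε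
      cancel i d eq = begin
        x ^ᴳ d                          ≈⟨ group-solve (x ^ᴳ i ∷ x ^ᴳ d ∷ x ∷ x ∷ []) b (ι a ⊕ (a ⊕ b)) refl ⟩
        (x ^ᴳ i) ⁻¹ ∙ (x ^ᴳ i ∙ x ^ᴳ d) ≈⟨ ∙-congˡ (≈-trans (≈-sym (pow-+ x i d)) (≈-sym eq)) ⟩
        (x ^ᴳ i) ⁻¹ ∙ x ^ᴳ i            ≈⟨ inverseˡ _ ⟩
        ε                               ∎

    order-∣ : ∀ {x n} → 0 < n → x ^ᴳ n ≈ ε → ∃[ k ] HasOrder G x k × k ∣ n
    order-∣ {x} {n} 0<n xⁿ with least-positive (λ k → Enumerable._≟_ (HasSize⇒Enumerable size) (x ^ᴳ k) ε) n
    ... | inj₂ none = contradiction xⁿ (none n 0<n ≤-refl)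
    ... | inj₁ (k , 0<k , xᵏ , min) = k , (0<k , xᵏ , min) , m%n≡0⇒n∣m n k (rem≡0 (n % k) refl)
      where
      instance _ = >-nonZero 0<k
      x^rem : x ^ᴳ (n % k) ≈ ε
      x^rem = begin
        x ^ᴳ (n % k)                            ≈⟨ identityʳ _ ⟨
        x ^ᴳ (n % k) ∙ ε                        ≈⟨ ∙-congˡ (pow-∣ x xᵏ (n∣m*n (n / k))) ⟨
        x ^ᴳ (n % k) ∙ x ^ᴳ (n / k * k)         ≈⟨ pow-+ x (n % k) _ ⟨
        x ^ᴳ (n % k + n / k * k)                ≈⟨ ×-congˡ (sym (m≡m%n+[m/n]*n n k)) ⟩
        x ^ᴳ n                                  ≈⟨ xⁿ ⟩
        ε                                       ∎
      rem≡0 : ∀ r → n % k ≡ r → n % k ≡ 0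
      rem≡0 zero    eq = eq
      rem≡0 (suc r) eq = contradiction (min (n % k) (subst (0 <_) (sym eq) z<s) x^rem) (<⇒≱ (m%n<n n k))

    module _ {p} (pp : Prime p) where
      private instance _ = prime⇒nonZero pp

      regular⇒powerConjugate : ∀ {v w} → ConjugateRegularParts G p v w → PowerConjugate p v w
      regular⇒powerConjugate {v} {w} (v′ , w′ , (v″ , v≈ , v≈′ , _ , A , _ , v″ᴬ , _) , (w″ , w≈ , w≈′ , _ , B , _ , w″ᴮ , _) , vw) =
        A + B , conj-trans (conj-refl (kill v≈ v≈′ v″ᴬ (p ^ (A + B)) (divides (p ^ B) (trans (^-distribˡ-+-* p A B) (*-comm (p ^ A) _)))))
          (conj-trans (conj-pow (p ^ (A + B)) vw) (conj-refl (≈-sym (kill w≈ w≈′ w″ᴮ (p ^ (A + B)) (divides (p ^ A) (^-distribˡ-+-* p A B))))))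
        where
        kill : ∀ {v v′ v″ n} → v ≈ v′ ∙ v″ → v ≈ v″ ∙ v′ → v″ ^ᴳ n ≈ ε → ∀ m → n ∣ m → v ^ᴳ m ≈ v′ ^ᴳ m
        kill {v} {v′} {v″} e e′ ord m n∣m = begin
          v ^ᴳ m               ≈⟨ pow-cong m e ⟩
          (v′ ∙ v″) ^ᴳ m       ≈⟨ pow-∙ v′ v″ m (≈-trans (≈-sym e) e′) ⟩
          v′ ^ᴳ m ∙ v″ ^ᴳ m    ≈⟨ ∙-congˡ (pow-∣ v″ ord n∣m) ⟩
          v′ ^ᴳ m ∙ ε          ≈⟨ identityʳ _ ⟩
          v′ ^ᴳ m              ∎

      -- The exponent `p ^ A * t` is 0 modulo pᴬ and 1 modulo M, so this power is the projection of
      -- `w` to the factor of order dividing M in the cyclic group of order dividing pᴬ M.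
      regular-part : ∀ w A M t s → p ∤ M → 0 < M → p ^ A * t ≡ 1 + M * s → w ^ᴳ (p ^ A * M) ≈ ε →
                     IsRegularPart G p w (w ^ᴳ (p ^ A * t))
      regular-part w A M t s p∤M 0<M eq ord = w″ , w≈ , w≈′ , regular , singular
        where
        y = w ^ᴳ (M * s)
        w″ = y ⁻¹
        e : w ^ᴳ (p ^ A * t) ≈ w ∙ y
        e = ×-congˡ eq
        w≈ : w ≈ w ^ᴳ (p ^ A * t) ∙ w″
        w≈ = ≈-sym (≈-trans (∙-congʳ e) (group-solve (w ∷ y ∷ w ∷ w ∷ []) ((a ⊕ b) ⊕ ι b) a refl))
        w≈′ : w ≈ w″ ∙ w ^ᴳ (p ^ A * t)
        w≈′ = ≈-sym (≈-trans (∙-congˡ (≈-trans e (≈-sym (commutes-pow w w (M * s) ≈-refl))))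
          (group-solve (w ∷ y ∷ w ∷ w ∷ []) (ι b ⊕ (b ⊕ a)) a refl))
        regular : ∃[ k ] HasOrder G (w ^ᴳ (p ^ A * t)) k × Coprime k p
        regular with order-∣ 0<M (≈-trans (≈-sym (pow-* w (p ^ A * t) M)) (pow-∣ w {p ^ A * M} ord (divides t
            (trans (*-assoc (p ^ A) t M) (trans (cong (p ^ A *_) (*-comm t M)) (trans (sym (*-assoc (p ^ A) M t)) (*-comm _ t)))))))
        ... | k , o , k∣M = k , o , Coprime.sym (prime∤⇒coprime pp (λ p∣k → p∤M (∣-trans p∣k k∣M)))
        singular : ∃[ b ] HasOrder G w″ (p ^ b)
        singular with order-∣ {y ⁻¹} (m^n>0 p A) (pow-inv y (p ^ A) (≈-trans (≈-sym (pow-* w (M * s) (p ^ A))) (pow-∣ w {p ^ A * M} ord (divides s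
            (trans (*-comm (M * s) (p ^ A)) (trans (sym (*-assoc (p ^ A) M s)) (*-comm _ s)))))))
        ... | k , o , k∣ with ∣prime-power pp A k∣
        ...   | b , refl = b , o

      powerConjugate⇒regular : ∀ {v w} → PowerConjugate p v w → ConjugateRegularParts G p v w
      powerConjugate⇒regular {v} {w} (r , vw) =
        let (m , 0<m , vᵐ) = finite-order v
            (n , 0<n , wⁿ) = finite-order w
            (k , M , mn≡ , p∤M , 0<M) = prime-power-part pp (m * n) (*-mono-< 0<m 0<n)
            -- One exponent serves both elements: `r` makes the powers conjugate and `k` absorbs the
            -- p-parts of both orders. With a common `t`, the two regular parts are then t-th powers
            -- of conjugate elements.
            A = r + k
            pᴬM≡ = trans (cong (_* M) (^-distribˡ-+-* p r k)) (trans (*-assoc (p ^ r) (p ^ k) M) (cong (p ^ r *_) (sym mn≡)))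
            (t , s , eq) = coprime-inverse (coprime-^ pp A (prime∤⇒coprime pp p∤M)) (m^n>0 p A) 0<M
            m∣ = subst (m ∣_) (sym pᴬM≡) (∣n⇒∣m*n (p ^ r) (m∣m*n n))
            n∣ = subst (n ∣_) (sym pᴬM≡) (∣n⇒∣m*n (p ^ r) (n∣m*n m))
        in v ^ᴳ (p ^ A * t) , w ^ᴳ (p ^ A * t)
           , regular-part v A M t s p∤M 0<M eq (pow-∣ v vᵐ m∣)
           , regular-part w A M t s p∤M 0<M eq (pow-∣ w wⁿ n∣)
           , conj-trans (conj-refl (pow-* v (p ^ A) t))
               (conj-trans (conj-pow t (raise p {v} {w} r k vw)) (conj-refl (≈-sym (pow-* w (p ^ A) t))))

-- Cauchy's theorem.

HasSize-× : ∀ {S T a b} → HasSize S a → HasSize T b → HasSize (×-setoid S T) (a * b)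
HasSize-× {S} {T} {a} {b} A B = record
  { to        = λ (x , y) → Fin.combine (A.to x) (B.to y)
  ; from      = λ i → let (j , k) = Fin.remQuot b i in A.from j , B.from k
  ; to-cong   = λ (e , f) → cong₂ Fin.combine (A.to-cong e) (B.to-cong f)
  ; from-cong = λ { refl → Setoid.refl S , Setoid.refl T }
  ; inverse   = (λ {i} (e , f) → trans (cong₂ Fin.combine (A.inverseˡ e) (B.inverseˡ f)) (Fin.combine-remQuot {a} b i))
              , (λ { {x , y} refl → A.inverseʳ (cong proj₁ (Fin.remQuot-combine (A.to x) (B.to y)))
                                  , B.inverseʳ (cong proj₂ (Fin.remQuot-combine (A.to x) (B.to y))) })
  }
  where
  module A = Inverse A
  module B = Inverse B

module _ {A : Set} where

  rotateˡ : List A → List A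
  rotateˡ []       = []
  rotateˡ (x ∷ xs) = xs ++ x ∷ []

  length-rotateˡ : ∀ xs → length (rotateˡ xs) ≡ length xs
  length-rotateˡ []       = refl
  length-rotateˡ (x ∷ xs) = trans (length-++ xs) (+-comm (length xs) 1)

  fold-rotateˡ : ∀ xs ys → fold (xs ++ ys) rotateˡ (length xs) ≡ ys ++ xs
  fold-rotateˡ []       ys = sym (++-identityʳ ys)
  fold-rotateˡ (x ∷ xs) ys = begin
    rotateˡ (fold (x ∷ xs ++ ys) rotateˡ (length xs))  ≡⟨ fold-comm rotateˡ (x ∷ xs ++ ys) (length xs) 1 ⟨
    fold ((xs ++ ys) ++ x ∷ []) rotateˡ (length xs)    ≡⟨ cong (λ zs → fold zs rotateˡ (length xs)) (++-assoc xs ys (x ∷ [])) ⟩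
    fold (xs ++ ys ++ x ∷ []) rotateˡ (length xs)      ≡⟨ fold-rotateˡ xs (ys ++ x ∷ []) ⟩
    (ys ++ x ∷ []) ++ xs                               ≡⟨ ++-assoc ys (x ∷ []) xs ⟩
    ys ++ x ∷ xs                                       ∎
    where open ≡.≡-Reasoning

-- McKay's argument: rotate the p-tuples with product 1.
module Cauchy (G : Group 0ℓ 0ℓ) where
  open Group G renaming (refl to ≈-refl; sym to ≈-sym; trans to ≈-trans)
  open Powers G
  open GroupSolver G

  private
    Lists : ℕ → Setoid 0ℓ 0ℓ
    Lists k = restrict (Pointwise.setoid setoid) (λ l → length l ≡ k)

    HasSize-Lists : ∀ {m} → HasSize setoid m → ∀ k → HasSize (Lists k) (m ^ k)
    HasSize-Lists size zero = record
      { to = λ _ → zero ; from = λ _ → [] , refl ; to-cong = λ _ → refl ; from-cong = λ _ → []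
      ; inverse = (λ { {zero} _ → refl }) , (λ { {[] , _} _ → [] }) }
    HasSize-Lists size (suc k) = HasSize-resp (record
      { to = λ { ([] , ()) ; (x ∷ l , e) → x , (l , suc-injective e) }
      ; from = λ (x , (l , e)) → x ∷ l , cong suc e
      ; to-cong = λ { {[] , ()} ; {x ∷ l , _} {y ∷ l′ , _} (p ∷ ps) → p , ps }
      ; from-cong = λ (p , ps) → p ∷ ps
      ; inverse = (λ { {y = [] , ()} ; {y = y ∷ l , _} (p ∷ ps) → p , ps }) , (λ { {[] , ()} ; {y ∷ l , _} (p , ps) → p ∷ ps }) })
      (HasSize-× size (HasSize-Lists size k))

    prod : List Carrier → Carrier
    prod = foldr _∙_ ε

    prod-snoc : ∀ xs x → prod (xs ++ x ∷ []) ≈ prod xs ∙ x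
    prod-snoc []       x = ≈-trans (identityʳ x) (≈-sym (identityˡ x))
    prod-snoc (y ∷ xs) x = ≈-trans (∙-congˡ (prod-snoc xs x)) (≈-sym (assoc y _ x))

    prod-cong : ∀ {xs ys} → Pointwise _≈_ xs ys → prod xs ≈ prod ys
    prod-cong []       = ≈-refl
    prod-cong (e ∷ es) = ∙-cong e (prod-cong es)

    prod-rotateˡ : ∀ xs → prod xs ≈ ε → prod (rotateˡ xs) ≈ ε
    prod-rotateˡ []       e = e
    prod-rotateˡ (x ∷ xs) e = ≈-trans (prod-snoc xs x) (≈-trans
      (group-solve (x ∷ prod xs ∷ x ∷ x ∷ []) (b ⊕ a) (ι a ⊕ (a ⊕ b) ⊕ a) refl)
      (≈-trans (∙-congʳ (∙-congˡ e)) (group-solve (x ∷ x ∷ x ∷ x ∷ []) (ι a ⊕ 𝟙 ⊕ a) 𝟙 refl)))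

    rotateˡ-cong : ∀ {xs ys} → Pointwise _≈_ xs ys → Pointwise _≈_ (rotateˡ xs) (rotateˡ ys)
    rotateˡ-cong []       = []
    rotateˡ-cong (e ∷ es) = Pointwise.++⁺ es (e ∷ [])

    constant : ∀ xs {x y} → Pointwise _≈_ (xs ++ y ∷ []) (x ∷ xs) → All (_≈ x) xs
    constant []       _        = []
    constant (z ∷ xs) (e ∷ es) = e ∷ All.map (λ e′ → ≈-trans e′ e) (constant xs es)

    prod-constant : ∀ {x} xs → All (_≈ x) xs → prod xs ≈ x ^ᴳ length xs
    prod-constant []       []       = ≈-refl
    prod-constant (z ∷ xs) (e ∷ es) = ∙-cong e (prod-constant xs es)

    Tuples : ℕ → Setoid 0ℓ 0ℓ
    Tuples k = restrict (Pointwise.setoid setoid) (λ l → length l ≡ k × prod l ≈ ε)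

    -- The first entry of a tuple with product `ε` is the inverse of the product of the others,
    -- which are arbitrary.
    HasSize-Tuples : ∀ {m} → HasSize setoid m → ∀ k → HasSize (Tuples (suc k)) (m ^ k)
    HasSize-Tuples size k = HasSize-resp (record
      { to = λ { ([] , () , _) ; (x ∷ l , e , _) → l , suc-injective e }
      ; from = λ (l , e) → prod l ⁻¹ ∷ l , cong suc e , inverseˡ _
      ; to-cong = λ { {[] , () , _} ; {x ∷ l , _} {y ∷ l′ , _} (p ∷ ps) → ps }
      ; from-cong = λ ps → ⁻¹-cong (prod-cong ps) ∷ ps
      ; inverse = (λ { {y = [] , () , _} ; {y = y ∷ l , _} (p ∷ ps) → ps })
                , (λ { {[] , () , _} ; {y ∷ l , _ , e} ps → ≈-trans (⁻¹-cong (prod-cong ps)) (≈-sym (GroupProperties.inverseˡ-unique G y (prod l) e)) ∷ ps }) })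
      (HasSize-Lists size k)

  module _ {m p} (size : HasSize setoid m) (pp : Prime p) (p∣m : p ∣ m) where
    private
      X : Setoid 0ℓ 0ℓ
      X = Tuples p

      size-X : ∃[ k ] HasSize X k × p ∣ k
      size-X = go p refl (nonTrivial⇒n>1 p {{prime⇒nonTrivial pp}})
        where
        go : ∀ q → q ≡ p → 1 < q → ∃[ k ] HasSize X k × p ∣ k
        -- As p is at least 2, the exponent p - 1 is positive and p divides m^(p-1).
        go (suc (suc q)) refl _ = m ^ suc q , HasSize-Tuples size (suc q) , ∣m⇒∣m*n (m ^ q) p∣m
        go (suc zero) _ 1<1 = contradiction 1<1 (n≮n 1)

      f : Setoid.Carrier X → Setoid.Carrier X
      f (l , e , e′) = rotateˡ l , trans (length-rotateˡ l) e , prod-rotateˡ l e′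

      fold-f : ∀ x k → proj₁ (fold x f k) ≡ fold (proj₁ x) rotateˡ k
      fold-f x zero    = refl
      fold-f x (suc k) = cong rotateˡ (fold-f x k)

      f^p≡id : ∀ x → Setoid._≈_ X (fold x f p) x
      f^p≡id x@(l , e , _) = Setoid.reflexive (Pointwise.setoid setoid) (trans (fold-f x p)
        (trans (cong₂ (λ ys k → fold ys rotateˡ k) (sym (++-identityʳ l)) (sym e)) (fold-rotateˡ l [])))

      x₀ : Setoid.Carrier X
      x₀ = replicate p ε , length-replicate p , prod-ε p
        where
        prod-ε : ∀ k → prod (replicate k ε) ≈ ε
        prod-ε zero    = ≈-refl
        prod-ε (suc k) = ≈-trans (identityˡ _) (prod-ε k)

      fx₀ : ∀ k → Pointwise _≈_ (rotateˡ (replicate k ε)) (replicate k ε)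
      fx₀ zero    = []
      fx₀ (suc k) = snoc k
        where
        snoc : ∀ k → Pointwise _≈_ (replicate k ε ++ ε ∷ []) (ε ∷ replicate k ε)
        snoc zero    = ≈-refl ∷ []
        snoc (suc k) = ≈-refl ∷ snoc k

      extract : ∀ l → Pointwise _≈_ (rotateˡ l) l → length l ≡ p → prod l ≈ ε → ¬ Pointwise _≈_ l (replicate p ε) →
                ∃[ y ] ¬ y ≈ ε × y ^ᴳ p ≈ ε
      extract [] _ e _ nontrivial = contradiction (subst (λ k → Pointwise _≈_ [] (replicate k ε)) e []) nontrivial
      extract (x ∷ xs) fixed refl e nontrivial = x , (λ x≈ε → nontrivial (trivial x≈ε (x ∷ xs) all)) , ≈-trans (≈-sym (prod-constant (x ∷ xs) all)) e
        where
        all : All (_≈ x) (x ∷ xs)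
        all = ≈-refl ∷ constant xs fixed
        trivial : x ≈ ε → ∀ ys → All (_≈ x) ys → Pointwise _≈_ ys (replicate (length ys) ε)
        trivial x≈ε []       []       = []
        trivial x≈ε (y ∷ ys) (a ∷ as) = ≈-trans a x≈ε ∷ trivial x≈ε ys as

    cauchy : ∃[ y ] ¬ y ≈ ε × y ^ᴳ p ≈ ε
    cauchy = let (_ , size , p∣k) = size-X
                 ((l , e , e′) , fixed , nontrivial) = another-fixed {X} pp f rotateˡ-cong size p∣k f^p≡id x₀ (fx₀ p)
             in extract l fixed e e′ nontrivial

-- Fixed points on cosets and normalizers.

module CosetAction (G : Group 0ℓ 0ℓ) where
  open Group G renaming (refl to ≈-refl; sym to ≈-sym; trans to ≈-trans)
  open Powers G
  open GroupSolver G

  -- A single inclusion is required; in a finite group it passes to the inverse, by `normalizes-⁻¹`.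
  Normalizes : Pred Carrier 0ℓ → Carrier → Set
  Normalizes P y = ∀ h → ⟨ G ⟩ P h → ⟨ G ⟩ P (y ⁻¹ ∙ h ∙ y)

  module _ {P Q : Pred Carrier 0ℓ} where

    fixed⇒conjugate : ∀ {x} → IsFixed G P Q x → ∀ g → ⟨ G ⟩ Q g → ⟨ G ⟩ P (x ⁻¹ ∙ g ∙ x)
    fixed⇒conjugate {x} fix g g∈ = resp (group-solve (x ∷ g ∷ x ∷ x ∷ []) (ι (ι b ⊕ a) ⊕ a) (ι a ⊕ b ⊕ a) refl)
      (fix (g ⁻¹) (inv g∈))

    conjugate⇒fixed : ∀ {x} → (∀ g → ⟨ G ⟩ Q g → ⟨ G ⟩ P (x ⁻¹ ∙ g ∙ x)) → IsFixed G P Q x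
    conjugate⇒fixed {x} con g g∈ = resp (group-solve (x ∷ g ∷ x ∷ x ∷ []) (ι a ⊕ ι b ⊕ a) (ι (b ⊕ a) ⊕ a) refl)
      (con (g ⁻¹) (inv g∈))

  module _ {P : Pred Carrier 0ℓ} where
    private
      module C = Setoid (cosets G P)

    normalizes-resp : ∀ {x y} → x ≈ y → Normalizes P x → Normalizes P y
    normalizes-resp x≈y norm h h∈ = resp (∙-cong (∙-congʳ (⁻¹-cong x≈y)) x≈y) (norm h h∈)

    normalizes-ε : Normalizes P ε
    normalizes-ε h h∈ = resp (group-solve (h ∷ h ∷ h ∷ h ∷ []) a (ι 𝟙 ⊕ a ⊕ 𝟙) refl) h∈

    normalizes-∙ : ∀ {x y} → Normalizes P x → Normalizes P y → Normalizes P (x ∙ y)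
    normalizes-∙ {x} {y} nx ny h h∈ = resp (group-solve (x ∷ y ∷ h ∷ h ∷ []) (ι b ⊕ (ι a ⊕ c ⊕ a) ⊕ b) (ι (a ⊕ b) ⊕ c ⊕ (a ⊕ b)) refl)
      (ny _ (nx h h∈))

    normalizes-pow : ∀ {x} k → Normalizes P x → Normalizes P (x ^ᴳ k)
    normalizes-pow zero    nx = normalizes-ε
    normalizes-pow (suc k) nx = normalizes-∙ nx (normalizes-pow k nx)

    -- Powers reach the inverse, since the group is finite.
    normalizes-⁻¹ : ∀ {m} → HasSize setoid m → ∀ {x} → Normalizes P x → Normalizes P (x ⁻¹)
    normalizes-⁻¹ size {x} nx with finite-order size x
    ... | suc k , _ , eq = normalizes-resp (GroupProperties.inverseʳ-unique G x _ eq) (normalizes-pow k nx)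

    coset-≈ : ∀ {x y} → x ≈ y → x C.≈ y
    coset-≈ {x} x≈y = resp (≈-trans (≈-sym (inverseˡ x)) (∙-congˡ x≈y)) unit

    coset-∙ : ∀ g {x y} → x C.≈ y → (g ∙ x) C.≈ (g ∙ y)
    coset-∙ g {x} {y} = resp (group-solve (x ∷ y ∷ g ∷ g ∷ []) (ι a ⊕ b) (ι (c ⊕ a) ⊕ (c ⊕ b)) refl)

    coset-∙ʳ : ∀ {x x′ y y′} → Normalizes P y → x C.≈ x′ → y C.≈ y′ → (x ∙ y) C.≈ (x′ ∙ y′)
    coset-∙ʳ {x} {x′} {y} {y′} ny e e′ = resp
      (group-solve (x ∷ x′ ∷ y ∷ y′ ∷ []) ((ι c ⊕ (ι a ⊕ b) ⊕ c) ⊕ (ι c ⊕ d)) (ι (a ⊕ c) ⊕ (b ⊕ d)) refl)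
      (mul (ny _ e) e′)

    -- Right multiplication by y is a free action of order p.
    module _ {p} (pp : Prime p) {y} (y-normalizes : Normalizes P y) (y∉ : ¬ ⟨ G ⟩ P y) (yᵖ∈ : ⟨ G ⟩ P (y ^ᴳ p)) where

      normalizer⇒∣ : ∀ {Q b} → HasSize (fixedPoints G P Q) b → p ∣ b
      normalizer⇒∣ {Q} size = free⇒prime∣size size pp f (λ e → coset-∙ʳ y-normalizes e C.refl)
        (λ x → C.trans (coset-≈ (fold-f x p)) (C.sym (resp (group-solve (proj₁ x ∷ y ^ᴳ p ∷ y ∷ y ∷ []) b (ι a ⊕ (a ⊕ b)) refl) yᵖ∈)))
        (λ x fx → y∉ (resp (group-solve (proj₁ x ∷ y ∷ y ∷ y ∷ []) (ι a ⊕ (a ⊕ b)) b refl) (C.sym fx)))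
        where
        f : Σ Carrier (IsFixed G P Q) → Σ Carrier (IsFixed G P Q)
        f (x , fix) = x ∙ y , λ g g∈ → C.trans (coset-≈ (≈-sym (assoc g x y))) (coset-∙ʳ y-normalizes (fix g g∈) C.refl)
        fold-f : ∀ x k → proj₁ (fold x f k) ≈ proj₁ x ∙ y ^ᴳ k
        fold-f x zero    = ≈-sym (identityʳ _)
        fold-f x (suc k) = ≈-trans (∙-congʳ (fold-f x k)) (≈-trans (assoc _ _ _) (∙-congˡ (commutes-pow y y k ≈-refl)))

    -- Left multiplication by z is a free action of order p.
    free-left⇒∣ : ∀ {p} → Prime p → ∀ {Q b z} → Normalizes Q z → z ^ᴳ p ≈ ε →
                  (∀ x → IsFixed G P Q x → ¬ (z ∙ x) C.≈ x) → HasSize (fixedPoints G P Q) b → p ∣ b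
    free-left⇒∣ {p} pp {Q} {z = z} z-normalizes zᵖ≈ε free size = free⇒prime∣size size pp f (coset-∙ z)
      (λ x → C.trans (coset-≈ (fold-f x p)) (coset-≈ (≈-trans (∙-congʳ zᵖ≈ε) (identityˡ _))))
      (λ (x , fix) → free x fix)
      where
      f : Σ Carrier (IsFixed G P Q) → Σ Carrier (IsFixed G P Q)
      f (x , fix) = z ∙ x , λ g g∈ → C.trans
        (coset-≈ (group-solve (g ∷ x ∷ z ∷ z ∷ []) (a ⊕ (c ⊕ b)) (c ⊕ ((ι c ⊕ a ⊕ c) ⊕ b)) refl))
        (coset-∙ z (fix (z ⁻¹ ∙ g ∙ z) (z-normalizes g g∈)))
      fold-f : ∀ x k → proj₁ (fold x f k) ≈ z ^ᴳ k ∙ proj₁ x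
      fold-f x zero    = ≈-sym (identityˡ _)
      fold-f x (suc k) = ≈-trans (∙-congˡ (fold-f x k)) (≈-sym (assoc _ _ _))

    module _ {m} (size : HasSize setoid m) where

      normalizerQuotient : Group 0ℓ 0ℓ
      normalizerQuotient = record
        { Carrier = Σ Carrier (Normalizes P)
        ; _≈_ = λ x y → proj₁ x C.≈ proj₁ y
        ; _∙_ = λ (x , nx) (y , ny) → x ∙ y , normalizes-∙ nx ny
        ; ε   = ε , normalizes-ε
        ; _⁻¹ = λ (x , nx) → x ⁻¹ , normalizes-⁻¹ size nx
        ; isGroup = record
          { isMonoid = record
            { isSemigroup = record
              { isMagma = record
                { isEquivalence = record { refl = C.refl ; sym = C.sym ; trans = C.trans }
                ; ∙-cong = λ {x} {x′} {y} {y′} e e′ → coset-∙ʳ (proj₂ y) e e′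
                }
              ; assoc = λ (x , _) (y , _) (z , _) → coset-≈ (assoc x y z)
              }
            ; identity = (λ (x , _) → coset-≈ (identityˡ x)) , (λ (x , _) → coset-≈ (identityʳ x))
            }
          ; inverse = (λ (x , _) → coset-≈ (inverseˡ x)) , (λ (x , _) → coset-≈ (inverseʳ x))
          ; ⁻¹-cong = λ {(x , nx)} {(y , ny)} e → resp
              (group-solve (x ∷ y ∷ x ∷ x ∷ []) (ι (ι a) ⊕ (ι b ⊕ a) ⊕ ι a) (ι (ι a) ⊕ ι b) refl)
              (normalizes-⁻¹ size nx _ (C.sym e))
          }
        }

      -- The cosets fixed by ⟨P⟩ are those of elements normalizing it, so `fixedPoints G P P`
      -- underlies the quotient of the normalizer by ⟨P⟩, and Cauchy's theorem applies to that
      -- group.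
      ∣⇒normalizer : ∀ {p b} → Prime p → HasSize (fixedPoints G P P) b → p ∣ b →
                     ∃[ y ] Normalizes P y × ¬ ⟨ G ⟩ P y × ⟨ G ⟩ P (y ^ᴳ p)
      ∣⇒normalizer {p} pp size-N p∣b =
        let ((y , ny) , y≉ε , yᵖ≈ε) = Cauchy.cauchy normalizerQuotient (HasSize-resp iso size-N) pp p∣b
        in y , ny , (λ y∈ → y≉ε (C.sym (resp (∙ε y) y∈))) , resp (≈-sym (∙ε _)) (C.sym (C.trans (coset-≈ (same (y , ny) p)) yᵖ≈ε))
        where
        ∙ε : ∀ y → y ≈ ε ⁻¹ ∙ y
        ∙ε y = group-solve (y ∷ y ∷ y ∷ y ∷ []) a (ι 𝟙 ⊕ a) refl
        same : ∀ y k → proj₁ y ^ᴳ k ≈ proj₁ (Powers._^ᴳ_ normalizerQuotient y k)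
        same y zero    = ≈-refl
        same y (suc k) = ∙-congˡ (same y k)
        iso : Inverse (Group.setoid normalizerQuotient) (fixedPoints G P P)
        iso = record
          { to = λ (x , nx) → x , conjugate⇒fixed nx
          ; from = λ (x , fix) → x , fixed⇒conjugate fix
          ; to-cong = id ; from-cong = id ; inverse = id , id }

    Fixes : Carrier → Setoid 0ℓ 0ℓ
    Fixes g = restrict (cosets G P) (λ x → (g ∙ x) C.≈ x)

    Fixes-conj : ∀ {v w} → Conjugate G v w → Inverse (Fixes v) (Fixes w)
    Fixes-conj {v} {w} (g , eq) = record
      { to = λ (x , fx) → g ∙ x , C.trans (coset-≈ (≈-trans (∙-congʳ (≈-sym eq))
          (group-solve (g ∷ v ∷ x ∷ x ∷ []) ((a ⊕ b ⊕ ι a) ⊕ (a ⊕ c)) (a ⊕ (b ⊕ c)) refl))) (coset-∙ g fx)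
      ; from = λ (x , fx) → g ⁻¹ ∙ x , C.trans (coset-≈ (≈-trans
          (group-solve (g ∷ v ∷ x ∷ x ∷ []) (b ⊕ (ι a ⊕ c)) (ι a ⊕ ((a ⊕ b ⊕ ι a) ⊕ c)) refl) (∙-congˡ (∙-congʳ eq)))) (coset-∙ (g ⁻¹) fx)
      ; to-cong = coset-∙ g
      ; from-cong = coset-∙ (g ⁻¹)
      ; inverse = (λ {x} {y} e → C.trans (coset-∙ g e) (coset-≈ (group-solve (g ∷ proj₁ x ∷ g ∷ g ∷ []) (a ⊕ (ι a ⊕ b)) b refl)))
                , (λ {x} {y} e → C.trans (coset-∙ (g ⁻¹) e) (coset-≈ (group-solve (g ∷ proj₁ x ∷ g ∷ g ∷ []) (ι a ⊕ (a ⊕ b)) b refl)))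
      }

    module _ (enum : Enumerable setoid) (∈? : Decidable₁ (⟨ G ⟩ P)) where

      abstract
        size-Fixes : ∀ g → ∃[ k ] HasSize (Fixes g) k
        size-Fixes g = restrict-size (proj₂ (Enumerable⇒size enum-C)) (λ x → ∈? ((g ∙ x) ⁻¹ ∙ x))
          (λ {x} {y} x∼y fx → C.trans (coset-∙ g (C.sym x∼y)) (C.trans fx x∼y))
          where
          enum-C : Enumerable (cosets G P)
          enum-C = record
            { _≟_ = λ x y → ∈? (x ⁻¹ ∙ y)
            ; elements = Enumerable.elements enum
            ; complete = λ x → Any.map coset-≈ (Enumerable.complete enum x)
            }

      module _ {p} (pp : Prime p) where

        -- One step of the induction: with v = w^(p^k), left multiplication by v permutes the fixed
        -- points of v^p in orbits of length 1 and p, and the orbits of length 1 are the fixed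
        -- points of v.
        Fixes-pow : ∀ {w a b} k → HasSize (Fixes w) a → HasSize (Fixes (w ^ᴳ (p ^ k))) b → a ≡ b [mod p ]
        Fixes-pow {w} {a} zero A B = subst (λ b → a ≡ b [mod p ]) (HasSize-unique A (HasSize-resp (Fixes-conj (conj-refl (≈-sym (identityʳ w)))) B)) ≡mod-refl
        Fixes-pow {w} {a} (suc k) A B =
          let (c , C) = size-Fixes (w ^ᴳ (p ^ k))
              v = w ^ᴳ (p ^ k)
              (q , p∣q , eq) = #fixed-mod-prime {cosets G P} pp (v ∙_) (coset-∙ v) C
                                 (HasSize-resp (iso v) (HasSize-resp (Fixes-conj (conj-refl
                                   (≈-trans (≈-sym (pow-* w (p ^ k) p)) (Setoid.reflexive setoid (cong (w ^ᴳ_) (*-comm (p ^ k) p)))))) B))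
          in ≡mod-trans (Fixes-pow k A C) (∣-step c q p∣q eq)
          where
          ∣-step : ∀ c q {b} → p ∣ q → c + q ≡ b → c ≡ b [mod p ]
          ∣-step c q (divides r refl) refl = r , 0 , sym (+-identityʳ _)
          fold-∙ : ∀ v x k → fold x (v ∙_) k ≈ v ^ᴳ k ∙ x
          fold-∙ v x zero    = ≈-sym (identityˡ x)
          fold-∙ v x (suc k) = ≈-trans (∙-congˡ (fold-∙ v x k)) (≈-sym (assoc _ _ _))
          iso : ∀ v → Inverse (restrict (cosets G P) (Fixed {cosets G P} pp (v ∙_) (coset-∙ v) p)) (Fixes (v ^ᴳ p))
          iso v = record
            { to = λ (x , fx) → x , C.trans (coset-≈ (≈-sym (fold-∙ v x p))) fx
            ; from = λ (x , fx) → x , C.trans (coset-≈ (fold-∙ v x p)) fx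
            ; to-cong = id ; from-cong = id ; inverse = id , id }

        Fixes-powerConjugate : ∀ {v w a b} → PowerConjugate p v w → HasSize (Fixes v) a → HasSize (Fixes w) b → a ≡ b [mod p ]
        Fixes-powerConjugate {v} {w} (k , vw) A B =
          let (_ , C) = size-Fixes (v ^ᴳ (p ^ k))
          in ≡mod-trans (Fixes-pow k A C) (≡mod-sym (Fixes-pow k B (HasSize-resp (Fixes-conj (conj-sym vw)) C)))

-- Signed permutations acting on integer vectors.

open SignedPerm

module ℤΣ = Sum ℤ.+-0-commutativeMonoid
module SignΣ = Sum Sign.*-commutativeMonoid

Vector : ℕ → Set
Vector n = Fin n → ℤ

module _ {n : ℕ} where

  -- A vector is regarded as an odd function on the letters, given by its values on the positive
  -- ones; signed permutations then act on the right by composition.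
  ext : Vector n → Letter n → ℤ
  ext v (Sign.+ , i) = v i
  ext v (Sign.- , i) = ℤ.- v i

  ext-neg : ∀ v x → ext v (neg x) ≡ ℤ.- ext v x
  ext-neg v (Sign.+ , i) = refl
  ext-neg v (Sign.- , i) = sym (ℤ.neg-involutive (v i))

  ext-cong : ∀ {u v} → u ≗ v → ∀ x → ext u x ≡ ext v x
  ext-cong e (Sign.+ , i) = e i
  ext-cong e (Sign.- , i) = cong ℤ.-_ (e i)

  infixl 8 _◃_
  _◃_ : Vector n → SignedPerm n → Vector n
  (v ◃ w) i = ext v (to w (Sign.+ , i))

  ext-◃ : ∀ v w x → ext (v ◃ w) x ≡ ext v (to w x)
  ext-◃ v w (Sign.+ , i) = refl
  ext-◃ v w (Sign.- , i) = trans (sym (ext-neg v (to w (Sign.+ , i)))) (cong (ext v) (sym (commutes w (Sign.+ , i))))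

  ◃-∘ : ∀ v w₁ w₂ → v ◃ (w₁ ∘ₛ w₂) ≗ v ◃ w₁ ◃ w₂
  ◃-∘ v w₁ w₂ i = sym (ext-◃ v w₁ (to w₂ (Sign.+ , i)))

  ◃-cong : ∀ {u v} → u ≗ v → ∀ w → u ◃ w ≗ v ◃ w
  ◃-cong e w i = ext-cong e (to w (Sign.+ , i))

  ◃-inv : ∀ v w → v ◃ w ◃ invₛ w ≗ v
  ◃-inv v w i = trans (ext-◃ v w (from w (Sign.+ , i))) (cong (ext v) (strictlyInverseˡ w _))

  ◃-inv′ : ∀ v w → v ◃ invₛ w ◃ w ≗ v
  ◃-inv′ v w i = trans (ext-◃ v (invₛ w) (to w (Sign.+ , i))) (cong (ext v) (strictlyInverseʳ w _))

  Stab : Vector n → SignedPerm n → Set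
  Stab v w = v ◃ w ≗ v

  stab-ext : ∀ {v w} → Stab v w → ∀ x → ext v (to w x) ≡ ext v x
  stab-ext {v} {w} s x = trans (sym (ext-◃ v w x)) (ext-cong s x)

  stab-∘ : ∀ {v w₁ w₂} → Stab v w₁ → Stab v w₂ → Stab v (w₁ ∘ₛ w₂)
  stab-∘ {v} {w₁} {w₂} s₁ s₂ i = trans (◃-∘ v w₁ w₂ i) (trans (◃-cong s₁ w₂ i) (s₂ i))

  stab-inv : ∀ {v w} → Stab v w → Stab v (invₛ w)
  stab-inv {v} {w} s i = trans (sym (◃-cong s (invₛ w) i)) (◃-inv v w i)

  to-abs : ∀ (w : SignedPerm n) x → proj₂ (to w x) ≡ proj₂ (to w (Sign.+ , proj₂ x))
  to-abs w (Sign.+ , i) = refl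
  to-abs w (Sign.- , i) = cong proj₂ (commutes w (Sign.+ , i))

  absolute : SignedPerm n → Perm.Permutation′ n
  absolute w = mk↔ₛ′ (f w) (f (invₛ w)) (cancel w) (cancel (invₛ w))
    where
    f : SignedPerm n → Fin n → Fin n
    f w i = proj₂ (to w (Sign.+ , i))
    cancel : ∀ w i → f w (f (invₛ w) i) ≡ i
    cancel w i = trans (sym (to-abs w (from w (Sign.+ , i)))) (cong proj₂ (strictlyInverseˡ w _))

  abs-injective : ∀ (w : SignedPerm n) {x y} → proj₂ (to w x) ≡ proj₂ (to w y) → proj₂ x ≡ proj₂ y
  abs-injective w {x} {y} e = trans (sym (Perm.inverseˡ (absolute w)))
    (trans (cong (absolute w Perm.⟨$⟩ˡ_) (trans (sym (to-abs w x)) (trans e (to-abs w y)))) (Perm.inverseˡ (absolute w)))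

  dot : Vector n → Vector n → ℤ
  dot u v = ℤΣ.sum (λ i → u i ℤ.* v i)

  dot-cong : ∀ {u u′ v v′} → u ≗ u′ → v ≗ v′ → dot u v ≡ dot u′ v′
  dot-cong e f = ℤΣ.sum-cong-≗ {n} (λ i → cong₂ ℤ._*_ (e i) (f i))

  dot-◃ : ∀ u v w → dot (u ◃ w) (v ◃ w) ≡ dot u v
  dot-◃ u v w = trans (ℤΣ.sum-cong-≗ {n} (λ i → square (to w (Sign.+ , i))))
    (sym (ℤΣ.sum-permute (λ i → u i ℤ.* v i) (absolute w)))
    where
    square : ∀ x → ext u x ℤ.* ext v x ≡ u (proj₂ x) ℤ.* v (proj₂ x)
    square (Sign.+ , i) = refl
    square (Sign.- , i) = solve 2 (λ a b → (:- a) :* (:- b) := a :* b) refl (u i) (v i)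
      where open ℤ-Solver

  dot-◃-inv : ∀ u v w → dot (u ◃ w) v ≡ dot u (v ◃ invₛ w)
  dot-◃-inv u v w = trans (dot-cong {u = u ◃ w} (λ _ → refl) (λ i → sym (◃-inv′ v w i))) (dot-◃ u (v ◃ invₛ w) w)

  -- The linear character of the hyperoctahedral group whose kernel is W; see `even⇒∈W` and
  -- `∈W⇒even`.
  sgn : SignedPerm n → Sign
  sgn w = SignΣ.sum (λ i → proj₁ (to w (Sign.+ , i)))

  sgn-cong : ∀ {v w} → (∀ x → to v x ≡ to w x) → sgn v ≡ sgn w
  sgn-cong e = SignΣ.sum-cong-≗ {n} (λ i → cong proj₁ (e (Sign.+ , i)))

  sgn-∘ : ∀ v w → sgn (v ∘ₛ w) ≡ sgn v Sign.* sgn w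
  sgn-∘ v w = begin
    sgn (v ∘ₛ w)                                                     ≡⟨ SignΣ.sum-cong-≗ {n} (λ i → sign (to w (Sign.+ , i))) ⟩
    SignΣ.sum (λ i → f (absolute w Perm.⟨$⟩ʳ i) Sign.* g i)              ≡⟨ SignΣ.∑-distrib-+ {n} (λ i → f (absolute w Perm.⟨$⟩ʳ i)) g ⟩
    SignΣ.sum (λ i → f (absolute w Perm.⟨$⟩ʳ i)) Sign.* SignΣ.sum g      ≡⟨ cong (Sign._* sgn w) (sym (SignΣ.sum-permute f (absolute w))) ⟩
    sgn v Sign.* sgn w                                            ∎
    where
    open ≡.≡-Reasoning
    f g : Fin n → Sign
    f i = proj₁ (to v (Sign.+ , i))
    g i = proj₁ (to w (Sign.+ , i))
    sign : ∀ x → proj₁ (to v x) ≡ proj₁ (to v (Sign.+ , proj₂ x)) Sign.* proj₁ x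
    sign (Sign.+ , i) = sym (Sign.*-identityʳ _)
    sign (Sign.- , i) = trans (cong proj₁ (commutes v (Sign.+ , i))) (opposite-* (proj₁ (to v (Sign.+ , i))))
      where
      opposite-* : ∀ s → opposite s ≡ s Sign.* Sign.-
      opposite-* Sign.+ = refl
      opposite-* Sign.- = refl

  sgn-id : sgn idₛ ≡ Sign.+
  sgn-id = SignΣ.sum-replicate-zero n

  sgn-inv : ∀ w → sgn (invₛ w) ≡ sgn w
  sgn-inv w = cancel (sgn (invₛ w)) (sgn w) (trans (sym (sgn-∘ (invₛ w) w))
    (trans (sgn-cong {invₛ w ∘ₛ w} {idₛ} (strictlyInverseʳ w)) sgn-id))
    where
    cancel : ∀ s t → s Sign.* t ≡ Sign.+ → s ≡ t
    cancel Sign.+ Sign.+ _ = refl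
    cancel Sign.- Sign.- _ = refl

  Even : SignedPerm n → Set
  Even w = sgn w ≡ Sign.+

  even-∘ : ∀ {v w} → Even v → Even w → Even (v ∘ₛ w)
  even-∘ {v} {w} ev ew = trans (sgn-∘ v w) (cong₂ Sign._*_ ev ew)

-- Simple reflections and simple roots of type D.

transpose-matchˡ : ∀ {n} (i j : Fin n) → PC.transpose i j i ≡ j
transpose-matchˡ i j rewrite dec-true (i Fin.≟ i) refl = refl

transpose-matchʳ : ∀ {n} (i j : Fin n) → PC.transpose i j j ≡ i
transpose-matchʳ i j with j Fin.≟ i
... | yes eq = eq
... | no _ rewrite dec-true (j Fin.≟ j) refl = refl

transpose-mismatch : ∀ {n} (i j k : Fin n) → k ≢ i → k ≢ j → PC.transpose i j k ≡ k
transpose-mismatch i j k k≢i k≢j rewrite dec-false (k Fin.≟ i) k≢i | dec-false (k Fin.≟ j) k≢j = refl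

sum-* : ∀ {n} c (f : Fin n → ℤ) → ℤΣ.sum (λ i → c ℤ.* f i) ≡ c ℤ.* ℤΣ.sum f
sum-* {zero}  c f = sym (ℤ.*-zeroʳ c)
sum-* {suc n} c f = trans (cong (λ z → c ℤ.* f zero ℤ.+ z) (sum-* c (f ∘ suc))) (sym (ℤ.*-distribˡ-+ c (f zero) _))

module _ {n : ℕ} where

  unitᵥ : Letter n → Vector n
  unitᵥ (σ , j) i = if does (i Fin.≟ j) then σ ℤ.◃ 1 else 0ℤ

  unitᵥ-self : ∀ x → ext (unitᵥ x) x ≡ 1ℤ
  unitᵥ-self (Sign.+ , i) rewrite dec-true (i Fin.≟ i) refl = refl
  unitᵥ-self (Sign.- , i) rewrite dec-true (i Fin.≟ i) refl = refl

  unitᵥ-other : ∀ x y → proj₂ x ≢ proj₂ y → ext (unitᵥ y) x ≡ 0ℤ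
  unitᵥ-other (Sign.+ , i) (_ , j) i≢j rewrite dec-false (i Fin.≟ j) i≢j = refl
  unitᵥ-other (Sign.- , i) (_ , j) i≢j rewrite dec-false (i Fin.≟ j) i≢j = refl

sum-δ : ∀ {n} (j : Fin n) c (f : Fin n → ℤ) → ℤΣ.sum (λ i → (if does (i Fin.≟ j) then c else 0ℤ) ℤ.* f i) ≡ c ℤ.* f j
sum-δ {suc n} zero c f = trans (cong (λ z → c ℤ.* f zero ℤ.+ z) (trans (sum-* {n} 0ℤ (f ∘ suc)) refl)) (ℤ.+-identityʳ _)
sum-δ {suc n} (suc j) c f = trans (ℤ.+-identityˡ _) (sum-δ j c (f ∘ suc))

dot-unitᵥ : ∀ {n} (x : Letter n) u → dot (unitᵥ x) u ≡ ext u x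
dot-unitᵥ (Sign.+ , j) u = trans (sum-δ j 1ℤ u) (ℤ.*-identityˡ (u j))
dot-unitᵥ (Sign.- , j) u = trans (sum-δ j -1ℤ u) (ℤ.-1*i≡-i (u j))

-- The simple root of index k sends a vector v to ext v (hi k) - ext v (lo k).
module Simple (m : ℕ) where

  n : ℕ
  n = suc (suc m)

  s : Fin n → SignedPerm n
  s zero    = u-perm
  s (suc i) = s-perm i

  hi lo : Fin n → Letter n
  hi zero    = Sign.+ , suc zero
  hi (suc i) = Sign.+ , suc i
  lo zero    = Sign.- , zero
  lo (suc i) = Sign.+ , inject₁ i

  hi≢lo : ∀ k → proj₂ (hi k) ≢ proj₂ (lo k)
  hi≢lo zero    ()
  hi≢lo (suc i) eq = 1+n≢n (trans (cong toℕ eq) (Fin.toℕ-inject₁ i))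

  s-hi : ∀ k → to (s k) (hi k) ≡ lo k
  s-hi zero    = refl
  s-hi (suc i) = cong (Sign.+ ,_) (transpose-matchʳ (inject₁ i) (suc i))

  s-lo : ∀ k → to (s k) (lo k) ≡ hi k
  s-lo zero    = refl
  s-lo (suc i) = cong (Sign.+ ,_) (transpose-matchˡ (inject₁ i) (suc i))

  s-other : ∀ k x → proj₂ x ≢ proj₂ (hi k) → proj₂ x ≢ proj₂ (lo k) → to (s k) x ≡ x
  s-other zero (_ , zero)          _ x≢lo = contradiction refl x≢lo
  s-other zero (_ , suc zero)      x≢hi _ = contradiction refl x≢hi
  s-other zero (_ , suc (suc i))   _ _    = refl
  s-other (suc i) (τ , j) x≢hi x≢lo = cong (τ ,_) (transpose-mismatch (inject₁ i) (suc i) j x≢lo x≢hi)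

  -- Allows `u` and the sᵢ to be treated alike: each exchanges `hi k` with `lo k`, exchanges their
  -- negatives, and fixes all other letters.
  data View (k : Fin n) : Letter n → Set where
    is-hi    : View k (hi k)
    is-lo    : View k (lo k)
    is-neghi : View k (neg (hi k))
    is-neglo : View k (neg (lo k))
    other    : ∀ {x} → proj₂ x ≢ proj₂ (hi k) → proj₂ x ≢ proj₂ (lo k) → View k x

  same-abs : ∀ {n} (x y : Letter n) → proj₂ x ≡ proj₂ y → x ≡ y ⊎ x ≡ neg y
  same-abs (Sign.+ , _) (Sign.+ , _) refl = inj₁ refl
  same-abs (Sign.+ , _) (Sign.- , _) refl = inj₂ refl
  same-abs (Sign.- , _) (Sign.+ , _) refl = inj₂ refl
  same-abs (Sign.- , _) (Sign.- , _) refl = inj₁ refl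

  view : ∀ k x → View k x
  view k x with proj₂ x Fin.≟ proj₂ (hi k) | proj₂ x Fin.≟ proj₂ (lo k)
  ... | no ≢hi | no ≢lo = other ≢hi ≢lo
  ... | yes eq | _ with same-abs x (hi k) eq
  ...   | inj₁ refl = is-hi
  ...   | inj₂ refl = is-neghi
  view k x | no _ | yes eq with same-abs x (lo k) eq
  ...   | inj₁ refl = is-lo
  ...   | inj₂ refl = is-neglo

  s-neghi : ∀ k → to (s k) (neg (hi k)) ≡ neg (lo k)
  s-neghi k = trans (commutes (s k) (hi k)) (cong neg (s-hi k))

  s-neglo : ∀ k → to (s k) (neg (lo k)) ≡ neg (hi k)
  s-neglo k = trans (commutes (s k) (lo k)) (cong neg (s-lo k))

  s-involutive : ∀ k x → to (s k) (to (s k) x) ≡ x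
  s-involutive k x with view k x
  ... | is-hi    = trans (cong (to (s k)) (s-hi k)) (s-lo k)
  ... | is-lo    = trans (cong (to (s k)) (s-lo k)) (s-hi k)
  ... | is-neghi = trans (cong (to (s k)) (s-neghi k)) (s-neglo k)
  ... | is-neglo = trans (cong (to (s k)) (s-neglo k)) (s-neghi k)
  ... | other a b = trans (cong (to (s k)) (s-other k x a b)) (s-other k x a b)

  pair : Fin n → Vector n → ℤ
  pair k v = ext v (hi k) ℤ.- ext v (lo k)

  pair-cong : ∀ k {u v} → u ≗ v → pair k u ≡ pair k v
  pair-cong k e = cong₂ ℤ._-_ (ext-cong e (hi k)) (ext-cong e (lo k))

  pair-◃ : ∀ k v w → pair k (v ◃ w) ≡ ext v (to w (hi k)) ℤ.- ext v (to w (lo k))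
  pair-◃ k v w = cong₂ ℤ._-_ (ext-◃ v w (hi k)) (ext-◃ v w (lo k))

  pair≡0⇒stab : ∀ k {v} → pair k v ≡ 0ℤ → Stab v (s k)
  pair≡0⇒stab k {v} eq i = fix (view k (Sign.+ , i))
    where
    h≡l : ext v (hi k) ≡ ext v (lo k)
    h≡l = ℤ.i-j≡0⇒i≡j _ _ eq
    fix : ∀ {x} → View k x → ext v (to (s k) x) ≡ ext v x
    fix is-hi       = trans (cong (ext v) (s-hi k)) (sym h≡l)
    fix is-lo       = trans (cong (ext v) (s-lo k)) h≡l
    fix is-neghi    = trans (cong (ext v) (s-neghi k)) (trans (ext-neg v (lo k)) (trans (cong ℤ.-_ (sym h≡l)) (sym (ext-neg v (hi k)))))
    fix is-neglo    = trans (cong (ext v) (s-neglo k)) (trans (ext-neg v (hi k)) (trans (cong ℤ.-_ h≡l) (sym (ext-neg v (lo k)))))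
    fix (other a b) = cong (ext v) (s-other k _ a b)

  stab⇒pair≡0 : ∀ k {v} → Stab v (s k) → pair k v ≡ 0ℤ
  stab⇒pair≡0 k {v} st = ℤ.i≡j⇒i-j≡0 (trans (sym (stab-ext {v = v} {s k} st (hi k))) (cong (ext v) (s-hi k)))

  even-s : ∀ k → Even (s k)
  even-s zero    = trans (Sign.opposite-selfInverse refl) (SignΣ.sum-replicate-zero m)
  even-s (suc i) = SignΣ.sum-replicate-zero n

  root : Fin n → Vector n
  root k i = unitᵥ (hi k) i ℤ.- unitᵥ (lo k) i

  ext-root : ∀ k x → ext (root k) x ≡ ext (unitᵥ (hi k)) x ℤ.- ext (unitᵥ (lo k)) x
  ext-root k (Sign.+ , i) = refl
  ext-root k (Sign.- , i) = solve 2 (λ a b → :- (a :- b) := (:- a) :- (:- b)) refl (unitᵥ (hi k) i) (unitᵥ (lo k) i)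
    where open ℤ-Solver

  root-hi : ∀ k → ext (root k) (hi k) ≡ 1ℤ
  root-hi k = trans (ext-root k (hi k)) (cong₂ ℤ._-_ (unitᵥ-self (hi k)) (unitᵥ-other (hi k) (lo k) (hi≢lo k)))

  root-lo : ∀ k → ext (root k) (lo k) ≡ -1ℤ
  root-lo k = trans (ext-root k (lo k)) (cong₂ ℤ._-_ (unitᵥ-other (lo k) (hi k) (hi≢lo k ∘ sym)) (unitᵥ-self (lo k)))

  root-other : ∀ k x → proj₂ x ≢ proj₂ (hi k) → proj₂ x ≢ proj₂ (lo k) → ext (root k) x ≡ 0ℤ
  root-other k x a b = trans (ext-root k x) (cong₂ ℤ._-_ (unitᵥ-other x (hi k) a) (unitᵥ-other x (lo k) b))

  dot-root : ∀ k u → dot (root k) u ≡ pair k u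
  dot-root k u = begin
    dot (root k) u                                          ≡⟨ ℤΣ.sum-cong-≗ {n} (λ i → solve 3 (λ a b c → (a :- b) :* c := a :* c :+ (:- con 1ℤ) :* (b :* c)) refl (unitᵥ (hi k) i) (unitᵥ (lo k) i) (u i)) ⟩
    ℤΣ.sum (λ i → unitᵥ (hi k) i ℤ.* u i ℤ.+ -1ℤ ℤ.* (unitᵥ (lo k) i ℤ.* u i))
                                                            ≡⟨ ℤΣ.∑-distrib-+ {n} (λ i → unitᵥ (hi k) i ℤ.* u i) (λ i → -1ℤ ℤ.* (unitᵥ (lo k) i ℤ.* u i)) ⟩
    dot (unitᵥ (hi k)) u ℤ.+ ℤΣ.sum (λ i → -1ℤ ℤ.* (unitᵥ (lo k) i ℤ.* u i))
                                                            ≡⟨ cong₂ ℤ._+_ (dot-unitᵥ (hi k) u) (trans (sum-* -1ℤ (λ i → unitᵥ (lo k) i ℤ.* u i))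
                                                                 (trans (cong (-1ℤ ℤ.*_) (dot-unitᵥ (lo k) u)) (ℤ.-1*i≡-i _))) ⟩
    pair k u                                                ∎
    where
    open ≡.≡-Reasoning
    open ℤ-Solver

  -- The roots of type D have squared length 2, so each root is its own coroot and `pair k` is the
  -- coefficient in the usual reflection formula.
  reflection : ∀ k v x → ext v (to (s k) x) ≡ ext v x ℤ.- pair k v ℤ.* ext (root k) x
  reflection k v x = go (view k x)
    where
    open ℤ-Solver
    h = ext v (hi k)
    l = ext v (lo k)
    go : ∀ {x} → View k x → ext v (to (s k) x) ≡ ext v x ℤ.- pair k v ℤ.* ext (root k) x
    go is-hi = trans (cong (ext v) (s-hi k)) (trans (solve 2 (λ h l → l := h :- (h :- l) :* con 1ℤ) refl h l)
      (cong (λ z → h ℤ.- pair k v ℤ.* z) (sym (root-hi k))))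
    go is-lo = trans (cong (ext v) (s-lo k)) (trans (solve 2 (λ h l → h := l :- (h :- l) :* con -1ℤ) refl h l)
      (cong (λ z → l ℤ.- pair k v ℤ.* z) (sym (root-lo k))))
    go is-neghi = trans (cong (ext v) (s-neghi k)) (trans (ext-neg v (lo k)) (trans (solve 2 (λ h l → :- l := :- h :- (h :- l) :* con -1ℤ) refl h l)
      (cong₂ (λ y z → y ℤ.- pair k v ℤ.* z) (sym (ext-neg v (hi k))) (sym (trans (ext-neg (root k) (hi k)) (cong ℤ.-_ (root-hi k)))))))
    go is-neglo = trans (cong (ext v) (s-neglo k)) (trans (ext-neg v (hi k)) (trans (solve 2 (λ h l → :- h := :- l :- (h :- l) :* con 1ℤ) refl h l)
      (cong₂ (λ y z → y ℤ.- pair k v ℤ.* z) (sym (ext-neg v (lo k))) (sym (trans (ext-neg (root k) (lo k)) (cong ℤ.-_ (root-lo k)))))))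
    go (other {x} a b) = trans (cong (ext v) (s-other k x a b)) (trans (solve 2 (λ y p → y := y :- p :* con 0ℤ) refl (ext v x) (pair k v))
      (cong (λ z → ext v x ℤ.- pair k v ℤ.* z) (sym (root-other k x a b))))

  dot-s : ∀ k u v → dot (u ◃ s k) v ≡ dot u v ℤ.- pair k u ℤ.* pair k v
  dot-s k u v = begin
    dot (u ◃ s k) v                                                 ≡⟨ ℤΣ.sum-cong-≗ {n} (λ i → trans (cong (ℤ._* v i) (reflection k u (Sign.+ , i)))
                                                                         (solve 4 (λ a b c d → (a :- b :* c) :* d := a :* d :+ (:- b) :* (c :* d)) refl (u i) (pair k u) (root k i) (v i))) ⟩
    ℤΣ.sum (λ i → u i ℤ.* v i ℤ.+ (ℤ.- pair k u) ℤ.* (root k i ℤ.* v i))   ≡⟨ ℤΣ.∑-distrib-+ {n} (λ i → u i ℤ.* v i) (λ i → (ℤ.- pair k u) ℤ.* (root k i ℤ.* v i)) ⟩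
    dot u v ℤ.+ ℤΣ.sum (λ i → (ℤ.- pair k u) ℤ.* (root k i ℤ.* v i)) ≡⟨ cong (λ z → dot u v ℤ.+ z) (trans (sum-* (ℤ.- pair k u) (λ i → root k i ℤ.* v i))
                                                                         (cong ((ℤ.- pair k u) ℤ.*_) (dot-root k v))) ⟩
    dot u v ℤ.+ (ℤ.- pair k u) ℤ.* pair k v                         ≡⟨ cong (λ z → dot u v ℤ.+ z) (sym (ℤ.neg-distribˡ-* (pair k u) (pair k v))) ⟩
    dot u v ℤ.- pair k u ℤ.* pair k v                               ∎
    where
    open ≡.≡-Reasoning
    open ℤ-Solver

-- Dominant vectors, the defect and generation of stabilizers.

square-nonneg : ∀ i → 0ℤ ℤ.≤ i ℤ.* i
square-nonneg (+ zero)  = +≤+ z≤n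
square-nonneg (+ suc a) = +≤+ z≤n
square-nonneg -[1+ a ]  = +≤+ z≤n

sum-nonneg : ∀ {n} {f : Fin n → ℤ} → (∀ i → 0ℤ ℤ.≤ f i) → 0ℤ ℤ.≤ ℤΣ.sum f
sum-nonneg {zero}  pos = ℤ.≤-refl
sum-nonneg {suc n} pos = ℤ.+-mono-≤ (pos zero) (sum-nonneg (pos ∘ suc))

sum-nonneg≤0 : ∀ {n} {f : Fin n → ℤ} → (∀ i → 0ℤ ℤ.≤ f i) → ℤΣ.sum f ℤ.≤ 0ℤ → ∀ i → f i ≡ 0ℤ
sum-nonneg≤0 {suc n} {f} pos sum≤0 zero = ℤ.≤-antisym
  (ℤ.≤-trans (subst (ℤ._≤ f zero ℤ.+ ℤΣ.sum (f ∘ suc)) (ℤ.+-identityʳ (f zero)) (ℤ.+-monoʳ-≤ (f zero) (sum-nonneg (pos ∘ suc)))) sum≤0)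
  (pos zero)
sum-nonneg≤0 {suc n} {f} pos sum≤0 (suc i) = sum-nonneg≤0 (pos ∘ suc)
  (ℤ.≤-trans (subst (ℤ._≤ f zero ℤ.+ ℤΣ.sum (f ∘ suc)) (ℤ.+-identityˡ (ℤΣ.sum (f ∘ suc))) (ℤ.+-monoˡ-≤ (ℤΣ.sum (f ∘ suc)) (pos zero))) sum≤0)
  i

increasing : ∀ {m} (v : Vector (suc m)) → (∀ i → v (inject₁ i) ℤ.≤ v (suc i)) → ∀ i j → toℕ i ≤ toℕ j → v i ℤ.≤ v j
increasing v inc zero zero _ = ℤ.≤-refl
increasing {suc m} v inc zero (suc j) _ = ℤ.≤-trans (inc zero) (increasing (v ∘ suc) (inc ∘ suc) zero j z≤n)
increasing {suc m} v inc (suc i) (suc j) (s≤s i≤j) = increasing (v ∘ suc) (inc ∘ suc) i j i≤j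

strictly-increasing : ∀ {m} (v : Vector (suc m)) → (∀ i → v (inject₁ i) ℤ.< v (suc i)) → ∀ i → v zero ℤ.+ + toℕ i ℤ.≤ v i
strictly-increasing v inc zero = ℤ.≤-reflexive (ℤ.+-identityʳ (v zero))
strictly-increasing {suc m} v inc (suc i) = ℤ.≤-trans
  (subst (ℤ._≤ v (suc zero) ℤ.+ + toℕ i) (solve 2 (λ a b → (con 1ℤ :+ a) :+ b := a :+ (con 1ℤ :+ b)) refl (v zero) (+ toℕ i))
    (ℤ.+-monoˡ-≤ (+ toℕ i) (ℤ.i<j⇒suc[i]≤j (inc zero))))
  (strictly-increasing (v ∘ suc) (inc ∘ suc) i)
  where open ℤ-Solver

∣∣-mono-< : ∀ {i j} → 0ℤ ℤ.≤ i → i ℤ.< j → ℤ.∣ i ∣ < ℤ.∣ j ∣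
∣∣-mono-< {+ a} {+ b} _ (+<+ a<b) = a<b

0≤j-i⇒i≤j : ∀ {i j} → 0ℤ ℤ.≤ j ℤ.- i → i ℤ.≤ j
0≤j-i⇒i≤j = ℤ.0≤i-j⇒j≤i

0<j-i⇒i<j : ∀ {i j} → 0ℤ ℤ.< j ℤ.- i → i ℤ.< j
0<j-i⇒i<j {i} {j} p = ℤ.≰⇒> λ j≤i → ℤ.<⇒≱ p (ℤ.i≤j⇒i-j≤0 j≤i)

module Chamber (m : ℕ) where
  open SignedPerm
  open Simple m

  -- The half-sum (0, 1, ..., n - 1) of the positive roots. Its coordinates have distinct absolute
  -- values, and it pairs to 1 with every simple root.
  ρ : Vector n
  ρ i = + toℕ i

  ∣ext-ρ∣ : ∀ x → ℤ.∣ ext ρ x ∣ ≡ toℕ (proj₂ x)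
  ∣ext-ρ∣ (Sign.+ , i) = refl
  ∣ext-ρ∣ (Sign.- , i) = ℤ.∣-i∣≡∣i∣ (+ toℕ i)

  ext-ρ-injective : ∀ {x y} → ext ρ x ≡ ext ρ y → proj₂ x ≡ proj₂ y
  ext-ρ-injective {x} {y} eq = Fin.toℕ-injective (trans (sym (∣ext-ρ∣ x)) (trans (cong ℤ.∣_∣ eq) (∣ext-ρ∣ y)))

  pair-ρ : ∀ k → pair k ρ ≡ 1ℤ
  pair-ρ zero    = refl
  pair-ρ (suc i) rewrite Fin.toℕ-inject₁ i = solve 1 (λ a → (con 1ℤ :+ a) :- a := con 1ℤ) refl (+ toℕ i)
    where open ℤ-Solver

  pair-ρ-◃≢0 : ∀ k w → pair k (ρ ◃ w) ≢ 0ℤ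
  pair-ρ-◃≢0 k w eq = hi≢lo k (abs-injective w (ext-ρ-injective {to w (hi k)} {to w (lo k)}
    (ℤ.i-j≡0⇒i≡j _ _ (trans (sym (pair-◃ k ρ w)) eq))))

  Dominant : Vector n → Set
  Dominant v = ∀ k → 0ℤ ℤ.≤ pair k v

  module _ {v} (dom : Dominant v) where
    private
      mono : ∀ i j → toℕ i ≤ toℕ j → v i ℤ.≤ v j
      mono = increasing v (λ i → 0≤j-i⇒i≤j (dom (suc i)))

      -v₀≤v₁ : ℤ.- v zero ℤ.≤ v (suc zero)
      -v₀≤v₁ = 0≤j-i⇒i≤j (dom zero)

      -v≤v : ∀ i j → 0 < toℕ i ⊎ 0 < toℕ j → ℤ.- v i ℤ.≤ v j
      -v≤v zero zero (inj₁ ())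
      -v≤v zero zero (inj₂ ())
      -v≤v zero (suc j) _ = ℤ.≤-trans -v₀≤v₁ (mono (suc zero) (suc j) (s≤s z≤n))
      -v≤v (suc i) j _ = ℤ.≤-trans (ℤ.neg-mono-≤ (mono (suc zero) (suc i) (s≤s z≤n)))
        (ℤ.≤-trans (subst (ℤ.- v (suc zero) ℤ.≤_) (ℤ.neg-involutive (v zero)) (ℤ.neg-mono-≤ -v₀≤v₁)) (mono zero j z≤n))

      nonneg : ∀ i → 0ℤ ℤ.≤ ρ i
      nonneg i = +≤+ z≤n

    -- Dominance makes `ext v` weakly increasing in the order of the letters by their ρ-values, in
    -- which the two letters of value 0 are not comparable.
    ext-mono : ∀ x y → ext ρ x ℤ.< ext ρ y → ext v x ℤ.≤ ext v y
    ext-mono (Sign.+ , i) (Sign.+ , j) (+<+ i<j) = mono i j (<⇒≤ i<j)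
    ext-mono (Sign.+ , i) (Sign.- , j) i<-j = contradiction (ℤ.≤-trans (ℤ.neg-mono-≤ (nonneg j)) (nonneg i)) (ℤ.<⇒≱ i<-j)
    ext-mono (Sign.- , zero) (Sign.+ , zero) 0<0 = contradiction 0<0 (ℤ.<-irrefl refl)
    ext-mono (Sign.- , zero) (Sign.+ , suc j) _ = -v≤v zero (suc j) (inj₂ z<s)
    ext-mono (Sign.- , suc i) (Sign.+ , j) _ = -v≤v (suc i) j (inj₁ z<s)
    ext-mono (Sign.- , i) (Sign.- , j) -i<-j = ℤ.neg-mono-≤ (mono j i (<⇒≤ (drop (ℤ.neg-cancel-< -i<-j))))
      where
      drop : ∀ {a b} → + a ℤ.< + b → a < b
      drop (+<+ a<b) = a<b

  private
    deviation : Vector n → ℤ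
    deviation a = ℤΣ.sum (λ i → (a i ℤ.- ρ i) ℤ.* (a i ℤ.- ρ i))

    deviation-nonneg : ∀ a → 0ℤ ℤ.≤ deviation a
    deviation-nonneg a = sum-nonneg (λ i → square-nonneg (a i ℤ.- ρ i))

    deviation-dot : ∀ a → dot a a ≡ dot ρ ρ → deviation a ≡ + 2 ℤ.* (dot ρ ρ ℤ.- dot a ρ)
    deviation-dot a eq = begin
      deviation a
        ≡⟨ ℤΣ.sum-cong-≗ {n} (λ i → solve 2 (λ x y → (x :- y) :* (x :- y) := (x :* x :+ con (ℤ.- + 2) :* (x :* y)) :+ y :* y) refl (a i) (ρ i)) ⟩
      ℤΣ.sum (λ i → (a i ℤ.* a i ℤ.+ (ℤ.- + 2) ℤ.* (a i ℤ.* ρ i)) ℤ.+ ρ i ℤ.* ρ i)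
        ≡⟨ ℤΣ.∑-distrib-+ {n} (λ i → a i ℤ.* a i ℤ.+ (ℤ.- + 2) ℤ.* (a i ℤ.* ρ i)) (λ i → ρ i ℤ.* ρ i) ⟩
      ℤΣ.sum (λ i → a i ℤ.* a i ℤ.+ (ℤ.- + 2) ℤ.* (a i ℤ.* ρ i)) ℤ.+ dot ρ ρ
        ≡⟨ cong (ℤ._+ dot ρ ρ) (ℤΣ.∑-distrib-+ {n} (λ i → a i ℤ.* a i) (λ i → (ℤ.- + 2) ℤ.* (a i ℤ.* ρ i))) ⟩
      (dot a a ℤ.+ ℤΣ.sum (λ i → (ℤ.- + 2) ℤ.* (a i ℤ.* ρ i))) ℤ.+ dot ρ ρ
        ≡⟨ cong (ℤ._+ dot ρ ρ) (cong₂ ℤ._+_ eq (sum-* (ℤ.- + 2) (λ i → a i ℤ.* ρ i))) ⟩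
      (dot ρ ρ ℤ.+ (ℤ.- + 2) ℤ.* dot a ρ) ℤ.+ dot ρ ρ
        ≡⟨ solve 2 (λ x y → (x :+ con (ℤ.- + 2) :* y) :+ x := con (+ 2) :* (x :- y)) refl (dot ρ ρ) (dot a ρ) ⟩
      + 2 ℤ.* (dot ρ ρ ℤ.- dot a ρ) ∎
      where
      open ≡.≡-Reasoning
      open ℤ-Solver

  -- A substitute for the length: half the squared distance from ρ to ρ ◃ w. It is nonnegative, and
  -- among even `w` it vanishes only at the identity.
  defect : SignedPerm n → ℤ
  defect w = dot ρ ρ ℤ.- dot (ρ ◃ w) ρ

  defect-nonneg : ∀ w → 0ℤ ℤ.≤ defect w
  defect-nonneg w = ℤ.*-cancelˡ-≤-pos 0ℤ (defect w) (+ 2)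
    (subst (0ℤ ℤ.≤_) (deviation-dot (ρ ◃ w) (dot-◃ ρ ρ w)) (deviation-nonneg (ρ ◃ w)))

  defect≤0⇒stab : ∀ w → defect w ℤ.≤ 0ℤ → Stab ρ w
  defect≤0⇒stab w le i = ℤ.i-j≡0⇒i≡j _ _ (square≡0 _ (sum-nonneg≤0 (λ i → square-nonneg ((ρ ◃ w) i ℤ.- ρ i))
    (subst (ℤ._≤ 0ℤ) (sym (deviation-dot (ρ ◃ w) (dot-◃ ρ ρ w))) (ℤ.*-monoˡ-≤-nonNeg (+ 2) le)) i))
    where
    square≡0 : ∀ i → i ℤ.* i ≡ 0ℤ → i ≡ 0ℤ
    square≡0 i eq = [ id , id ]′ (ℤ.i*j≡0⇒i≡0∨j≡0 i eq)

  defect-cong : ∀ {v w} → (∀ x → to v x ≡ to w x) → defect v ≡ defect w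
  defect-cong {v} {w} e = cong (λ z → dot ρ ρ ℤ.- z) (dot-cong {u = ρ ◃ v} {u′ = ρ ◃ w} {v = ρ} (λ i → cong (ext ρ) (e (Sign.+ , i))) (λ _ → refl))

  -- The reflection y s_k y⁻¹ in the image of a simple root under y.
  conj-s : SignedPerm n → Fin n → SignedPerm n
  conj-s y k = y ∘ₛ (s k ∘ₛ invₛ y)

  -- The two factors are the pairings of ρ with the root yα_k after and before applying `x`. The
  -- defect grows exactly when `x` preserves the sign of this root.
  defect-reflect : ∀ x y k → defect (x ∘ₛ conj-s y k) ≡ defect x ℤ.+ pair k (ρ ◃ x ◃ y) ℤ.* pair k (ρ ◃ y)
  defect-reflect x y k = trans (cong (λ z → dot ρ ρ ℤ.- z) eq)
    (solve 3 (λ a b c → a :- (b :- c) := (a :- b) :+ c) refl (dot ρ ρ) (dot (ρ ◃ x) ρ) (pair k (ρ ◃ x ◃ y) ℤ.* pair k (ρ ◃ y)))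
    where
    open ℤ-Solver
    a = ρ ◃ x
    eq : dot (ρ ◃ (x ∘ₛ conj-s y k)) ρ ≡ dot a ρ ℤ.- pair k (a ◃ y) ℤ.* pair k (ρ ◃ y)
    eq = begin
      dot (ρ ◃ (x ∘ₛ conj-s y k)) ρ                 ≡⟨ dot-cong {v = ρ} (λ i → trans (◃-∘ ρ x (conj-s y k) i) (trans (◃-∘ a y (s k ∘ₛ invₛ y) i) (◃-∘ (a ◃ y) (s k) (invₛ y) i))) (λ _ → refl) ⟩
      dot (a ◃ y ◃ s k ◃ invₛ y) ρ                  ≡⟨ dot-◃-inv (a ◃ y ◃ s k) ρ (invₛ y) ⟩
      dot (a ◃ y ◃ s k) (ρ ◃ y)                     ≡⟨ dot-s k (a ◃ y) (ρ ◃ y) ⟩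
      dot (a ◃ y) (ρ ◃ y) ℤ.- pair k (a ◃ y) ℤ.* pair k (ρ ◃ y)   ≡⟨ cong (λ z → z ℤ.- pair k (a ◃ y) ℤ.* pair k (ρ ◃ y)) (dot-◃ a ρ y) ⟩
      dot a ρ ℤ.- pair k (a ◃ y) ℤ.* pair k (ρ ◃ y) ∎
      where open ≡.≡-Reasoning

  defect-s : ∀ w k → defect (w ∘ₛ s k) ≡ defect w ℤ.+ pair k (ρ ◃ w)
  defect-s w k = trans (defect-cong {w ∘ₛ s k} {w ∘ₛ conj-s idₛ k} (λ _ → refl))
    (trans (defect-reflect w idₛ k) (cong (λ z → defect w ℤ.+ z)
      (trans (cong₂ ℤ._*_ (pair-◃ k (ρ ◃ w) idₛ) (trans (pair-◃ k ρ idₛ) (pair-ρ k))) (ℤ.*-identityʳ _))))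

  -- Being integral and strictly dominant, ρ ◃ w is at least ρ in every coordinate but the first,
  -- and the first is weighted by `ρ zero`, which is 0. Hence its product with ρ is at least that of
  -- ρ with itself.
  regular⇒defect≤0 : ∀ w → (∀ k → 0ℤ ℤ.< pair k (ρ ◃ w)) → defect w ℤ.≤ 0ℤ
  regular⇒defect≤0 w pos = ℤ.i≤j⇒i-j≤0 (0≤j-i⇒i≤j {dot ρ ρ} {dot (ρ ◃ w) ρ} (subst (0ℤ ℤ.≤_) sum-difference (sum-nonneg term-nonneg)))
    where
    open ℤ-Solver
    a = ρ ◃ w
    sum-difference : ℤΣ.sum (λ i → (a i ℤ.- ρ i) ℤ.* ρ i) ≡ dot a ρ ℤ.- dot ρ ρ
    sum-difference = trans (ℤΣ.sum-cong-≗ {n} (λ i → solve 2 (λ x y → (x :- y) :* y := x :* y :+ con -1ℤ :* (y :* y)) refl (a i) (ρ i)))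
      (trans (ℤΣ.∑-distrib-+ {n} (λ i → a i ℤ.* ρ i) (λ i → -1ℤ ℤ.* (ρ i ℤ.* ρ i)))
        (cong (λ z → dot a ρ ℤ.+ z) (trans (sum-* -1ℤ (λ i → ρ i ℤ.* ρ i)) (ℤ.-1*i≡-i (dot ρ ρ)))))
    a₁>0 : 0ℤ ℤ.< a (suc zero)
    a₁>0 = ℤ.≰⇒> λ a₁≤0 → ℤ.<-irrefl refl (ℤ.<-trans (ℤ.<-≤-trans (0<j-i⇒i<j (pos zero)) a₁≤0)
      (ℤ.neg-mono-< (ℤ.<-≤-trans (0<j-i⇒i<j (pos (suc zero))) a₁≤0)))
    a≥ρ : ∀ i → ρ (suc i) ℤ.≤ a (suc i)
    a≥ρ i = ℤ.≤-trans (ℤ.+-monoˡ-≤ (+ toℕ i) (ℤ.i<j⇒suc[i]≤j a₁>0))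
      (strictly-increasing (a ∘ suc) (λ i → 0<j-i⇒i<j (pos (suc (suc i)))) i)
    term-nonneg : ∀ i → 0ℤ ℤ.≤ (a i ℤ.- ρ i) ℤ.* ρ i
    term-nonneg zero    = ℤ.≤-reflexive (sym (ℤ.*-zeroʳ (a zero ℤ.- ρ zero)))
    term-nonneg (suc i) = ℤ.*-monoʳ-≤-nonNeg (ρ (suc i)) (ℤ.i≤j⇒0≤j-i (a≥ρ i))

  -- Fixing ρ determines the image of every letter except for the sign of the image of the first,
  -- where ρ vanishes. Evenness supplies that sign.
  stab-ρ⇒id : ∀ w → Even w → Stab ρ w → ∀ x → to w x ≡ x
  stab-ρ⇒id w even st = all
    where
    same : ∀ i → proj₂ (to w (Sign.+ , i)) ≡ i
    same i = ext-ρ-injective {to w (Sign.+ , i)} {Sign.+ , i} (st i)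
    positive : ∀ x j → ext ρ x ≡ + suc j → proj₁ x ≡ Sign.+
    positive (Sign.+ , i) j eq = refl
    positive (Sign.- , zero) j ()
    positive (Sign.- , suc i) j ()
    sign-suc : ∀ i → proj₁ (to w (Sign.+ , suc i)) ≡ Sign.+
    sign-suc i = positive (to w (Sign.+ , suc i)) (toℕ i) (st (suc i))
    sign : ∀ i → proj₁ (to w (Sign.+ , i)) ≡ Sign.+
    sign (suc i) = sign-suc i
    sign zero = trans (sym (Sign.*-identityʳ _)) (trans (cong (proj₁ (to w (Sign.+ , zero)) Sign.*_)
      (sym (trans (SignΣ.sum-cong-≗ {suc m} sign-suc) (SignΣ.sum-replicate-zero (suc m))))) even)
    all : ∀ x → to w x ≡ x
    all (Sign.+ , i) = cong₂ _,_ (sign i) (same i)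
    all (Sign.- , i) = trans (commutes w (Sign.+ , i)) (cong neg (all (Sign.+ , i)))

  descent : ∀ w → (∃[ k ] pair k (ρ ◃ w) ℤ.< 0ℤ) ⊎ defect w ℤ.≤ 0ℤ
  descent w with Fin.all? (λ k → 0ℤ ℤ.<? pair k (ρ ◃ w))
  ... | yes pos = inj₂ (regular⇒defect≤0 w pos)
  ... | no ¬pos with Fin.¬∀⟶∃¬ n _ (λ k → 0ℤ ℤ.<? pair k (ρ ◃ w)) ¬pos
  ...   | k , ¬pos-k = inj₁ (k , ℤ.≤∧≢⇒< (ℤ.≮⇒≥ ¬pos-k) (pair-ρ-◃≢0 k w))

  -- `w` sends the k-th simple root to a negative root, with which the dominant `v` pairs
  -- nonpositively. As `w` fixes `v`, so does the simple root itself, while dominance gives the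
  -- opposite inequality.
  descent⇒wall : ∀ {v} → Dominant v → ∀ w → Stab v w → ∀ k → pair k (ρ ◃ w) ℤ.< 0ℤ → pair k v ≡ 0ℤ
  descent⇒wall {v} dom w st k lt = ℤ.≤-antisym (ℤ.i≤j⇒i-j≤0 h≤l) (dom k)
    where
    wh<wl : ext ρ (to w (hi k)) ℤ.< ext ρ (to w (lo k))
    wh<wl = ℤ.≰⇒> λ ge → ℤ.<⇒≱ lt (subst (0ℤ ℤ.≤_) (sym (pair-◃ k ρ w)) (ℤ.i≤j⇒0≤j-i ge))
    h≤l : ext v (hi k) ℤ.≤ ext v (lo k)
    h≤l = ≡.subst₂ ℤ._≤_ (stab-ext {v = v} {w} st (hi k)) (stab-ext {v = v} {w} st (lo k)) (ext-mono dom (to w (hi k)) (to w (lo k)) wh<wl)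

  Walls : Vector n → Pred (SignedPerm n) 0ℓ
  Walls v w = ∃[ k ] pair k v ≡ 0ℤ × (∀ x → to w x ≡ to (s k) x)

  -- Induction on the defect. A descent `k` of `w` is a wall of `v`, so `w ∘ₛ s k` still fixes `v`
  -- and has smaller defect; without a descent `w` is the identity.
  stabilizer-generated : ∀ {v} → Dominant v → ∀ w → Even w → Stab v w → ⟨ hyperoctahedral n ⟩ (Walls v) w
  stabilizer-generated {v} dom w = go (ℤ.∣ defect w ∣) w refl
    where
    Goal : ℕ → Set
    Goal d = ∀ w → ℤ.∣ defect w ∣ ≡ d → Even w → Stab v w → ⟨ hyperoctahedral n ⟩ (Walls v) w
    go : ∀ d → Goal d
    go = <-rec Goal step
      where
      step : ∀ d → (∀ {e} → e < d → Goal e) → Goal d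
      step d rec w refl even st with descent w
      ... | inj₂ le = resp {x = idₛ} (λ x → sym (stab-ρ⇒id w even (defect≤0⇒stab w le) x)) unit
      ... | inj₁ (k , lt) = resp {x = (w ∘ₛ s k) ∘ₛ s k} {y = w} (λ x → cong (to w) (s-involutive k x))
            (mul {x = w ∘ₛ s k} {y = s k} (rec smaller (w ∘ₛ s k) refl (even-∘ {v = w} {s k} even (even-s k)) (stab-∘ {v = v} {w} {s k} st (pair≡0⇒stab k wall)))
                 (gen {x = s k} (k , wall , λ _ → refl)))
        where
        wall : pair k v ≡ 0ℤ
        wall = descent⇒wall dom w st k lt
        smaller : ℤ.∣ defect (w ∘ₛ s k) ∣ < ℤ.∣ defect w ∣
        smaller = ∣∣-mono-< (defect-nonneg (w ∘ₛ s k)) (subst (ℤ._< defect w) (sym (defect-s w k))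
          (subst (defect w ℤ.+ pair k (ρ ◃ w) ℤ.<_) (ℤ.+-identityʳ (defect w)) (ℤ.+-monoʳ-< (defect w) lt)))

i≤i+j⇒0≤j : ∀ {i j} → i ℤ.≤ i ℤ.+ j → 0ℤ ℤ.≤ j
i≤i+j⇒0≤j {i} {j} le = subst (0ℤ ℤ.≤_) (solve 2 (λ i j → (i :+ j) :- i := j) refl i j) (ℤ.i≤j⇒0≤j-i le)
  where open ℤ-Solver

⟨⟩-mono : ∀ (G : Group 0ℓ 0ℓ) {P Q : Pred (Group.Carrier G) 0ℓ} → (∀ {x} → P x → Q x) → ∀ {x} → ⟨ G ⟩ P x → ⟨ G ⟩ Q x
⟨⟩-mono G f (gen p)    = gen (f p)
⟨⟩-mono G f unit       = unit
⟨⟩-mono G f (mul p q)  = mul (⟨⟩-mono G f p) (⟨⟩-mono G f q)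
⟨⟩-mono G f (inv p)    = inv (⟨⟩-mono G f p)
⟨⟩-mono G f (resp e p) = resp e (⟨⟩-mono G f p)

minimal : ∀ {S m} → HasSize S m → {P : Pred (Setoid.Carrier S) 0ℓ} → Decidable₁ P → P Respects Setoid._≈_ S →
          (f : Setoid.Carrier S → ℕ) → (∀ {x y} → Setoid._≈_ S x y → f x ≡ f y) →
          ∃ P → ∃[ x ] P x × ∀ y → P y → f x ≤ f y
minimal {S} size {P} P? P-resp f f-cong (x , Px) = <-rec Goal step (f x) x refl Px
  where
  module I = Inverse size
  Goal : ℕ → Set
  Goal d = ∀ x → f x ≡ d → P x → ∃[ x ] P x × ∀ y → P y → f x ≤ f y
  step : ∀ d → (∀ {e} → e < d → Goal e) → Goal d
  step d rec x refl Px with Fin.any? (λ i → P? (I.from i) ×-dec f (I.from i) <? f x)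
  ... | yes (i , Pi , lt) = rec lt (I.from i) refl Pi
  ... | no none = x , Px , λ y Py → ≮⇒≥ λ lt → none (I.to y , P-resp (Setoid.sym S (I.strictlyInverseʳ y)) Py
          , subst (_< f x) (f-cong (Setoid.sym S (I.strictlyInverseʳ y))) lt)

-- Fundamental weights, faces and products of distinct simple reflections.

module Faces (m : ℕ) where
  open SignedPerm
  open Simple m public
  open Chamber m public

  step : ℕ → ℕ → ℤ
  step a b = if does (a ≤? b) then 1ℤ else 0ℤ

  step-≤ : ∀ {a b} → a ≤ b → step a b ≡ 1ℤ
  step-≤ {a} {b} a≤b rewrite dec-true (a ≤? b) a≤b = refl

  step-> : ∀ {a b} → b < a → step a b ≡ 0ℤ
  step-> {a} {b} b<a rewrite dec-false (a ≤? b) (<⇒≱ b<a) = refl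

  -- Up to scaling, the fundamental weights.
  ω : Fin n → Vector n
  ω zero          i       = 1ℤ
  ω (suc zero)    zero    = -1ℤ
  ω (suc zero)    (suc i) = 1ℤ
  ω (suc (suc j)) i       = step (suc (suc (toℕ j))) (toℕ i)

  pair-ω-≢ : ∀ k j → k ≢ j → pair k (ω j) ≡ 0ℤ
  pair-ω-≢ zero          zero          k≢j = contradiction refl k≢j
  pair-ω-≢ zero          (suc zero)    k≢j = refl
  pair-ω-≢ zero          (suc (suc j)) k≢j = refl
  pair-ω-≢ (suc i)       zero          k≢j = refl
  pair-ω-≢ (suc zero)    (suc zero)    k≢j = contradiction refl k≢j
  pair-ω-≢ (suc (suc i)) (suc zero)    k≢j = refl
  pair-ω-≢ (suc i)       (suc (suc j)) k≢j rewrite Fin.toℕ-inject₁ i with <-cmp (suc (suc (toℕ j))) (suc (toℕ i))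
  ... | tri< lt _ _ = cong₂ ℤ._-_ (step-≤ {b = suc (toℕ i)} (<⇒≤ lt)) (step-≤ {b = toℕ i} (≤-pred lt))
  ... | tri≈ _ eq _ = contradiction (sym (Fin.toℕ-injective eq)) k≢j
  ... | tri> _ _ gt = cong₂ ℤ._-_ (step-> {b = suc (toℕ i)} gt) (step-> {b = toℕ i} (<-trans (n<1+n (toℕ i)) gt))

  pair-ω-≡ : ∀ k → 0ℤ ℤ.< pair k (ω k)
  pair-ω-≡ zero          = +<+ z<s
  pair-ω-≡ (suc zero)    = +<+ z<s
  pair-ω-≡ (suc (suc i)) rewrite Fin.toℕ-inject₁ i = subst (0ℤ ℤ.<_)
    (sym (cong₂ ℤ._-_ (step-≤ {suc (suc (toℕ i))} ≤-refl) (step-> {suc (suc (toℕ i))} ≤-refl))) (+<+ z<s)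

  stab-ω : ∀ k j → k ≢ j → Stab (ω j) (s k)
  stab-ω k j k≢j = pair≡0⇒stab k (pair-ω-≢ k j k≢j)

  Facet : Vector n → Subset n → Set
  Facet v J = Dominant v × (∀ k → k ∈ₛ J → pair k v ≡ 0ℤ) × (∀ k → pair k v ≡ 0ℤ → k ∈ₛ J)

  off : ∀ {k} {J : Subset n} → Dec (k ∈ₛ J) → ℤ → ℤ
  off (yes _) c = 0ℤ
  off (no _)  c = c

  generic : Subset n → Vector n
  generic J i = ℤΣ.sum (λ j → off (j ∈? J) (ω j i))

  pair-generic : ∀ J k → pair k (generic J) ≡ ℤΣ.sum (λ j → off (j ∈? J) (pair k (ω j)))
  pair-generic J k = begin
    pair k (generic J)                        ≡⟨ ℤ.+-comm (ext (generic J) (hi k)) _ ⟩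
    ℤ.- ext (generic J) (lo k) ℤ.+ ext (generic J) (hi k)
                                              ≡⟨ cong₂ ℤ._+_ (trans (sym (ext-neg (generic J) (lo k))) (ext-generic (neg (lo k)))) (ext-generic (hi k)) ⟩
    ℤΣ.sum (term (neg (lo k))) ℤ.+ ℤΣ.sum (term (hi k))
                                              ≡⟨ ℤΣ.∑-distrib-+ {n} (term (neg (lo k))) (term (hi k)) ⟨
    ℤΣ.sum (λ j → term (neg (lo k)) j ℤ.+ term (hi k) j)
                                              ≡⟨ ℤΣ.sum-cong-≗ {n} (λ j → combine (j ∈? J) j) ⟩
    ℤΣ.sum (λ j → off (j ∈? J) (pair k (ω j))) ∎
    where
    open ≡.≡-Reasoning
    term : Letter n → Fin n → ℤ
    term x j = off (j ∈? J) (ext (ω j) x)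
    ext-generic : ∀ x → ext (generic J) x ≡ ℤΣ.sum (term x)
    ext-generic (Sign.+ , i) = refl
    ext-generic (Sign.- , i) = trans (sym (ℤ.-1*i≡-i (generic J i))) (trans (sym (sum-* -1ℤ (λ j → off (j ∈? J) (ω j i))))
      (ℤΣ.sum-cong-≗ {n} (λ j → negate (j ∈? J) (ω j i))))
      where
      negate : ∀ {j} (d : Dec (j ∈ₛ J)) c → -1ℤ ℤ.* off d c ≡ off d (ℤ.- c)
      negate (yes _) c = refl
      negate (no _)  c = ℤ.-1*i≡-i c
    combine : ∀ {j} (d : Dec (j ∈ₛ J)) i → off d (ext (ω i) (neg (lo k))) ℤ.+ off d (ext (ω i) (hi k)) ≡ off d (pair k (ω i))
    combine (yes _) i = refl
    combine (no _)  i = trans (ℤ.+-comm _ (ext (ω i) (hi k))) (cong (λ z → ext (ω i) (hi k) ℤ.+ z) (ext-neg (ω i) (lo k)))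

  generic-facet : ∀ J → Facet (generic J) J
  generic-facet J = (λ k → subst (0ℤ ℤ.≤_) (sym (pair-generic J k)) (sum-nonneg (nonneg k)))
                  , (λ k k∈J → trans (pair-generic J k) (trans (ℤΣ.sum-cong-≗ {n} (vanish k k∈J)) (ℤΣ.sum-replicate-zero n)))
                  , (λ k eq → member k (ℤ.≤-reflexive (trans (sym (pair-generic J k)) eq)))
    where
    pair-nonneg : ∀ k j → 0ℤ ℤ.≤ pair k (ω j)
    pair-nonneg k j with k Fin.≟ j
    ... | yes refl = ℤ.<⇒≤ (pair-ω-≡ k)
    ... | no k≢j   = ℤ.≤-reflexive (sym (pair-ω-≢ k j k≢j))
    nonneg : ∀ k j → 0ℤ ℤ.≤ off (j ∈? J) (pair k (ω j))
    nonneg k j with j ∈? J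
    ... | yes _ = ℤ.≤-refl
    ... | no _  = pair-nonneg k j
    vanish : ∀ k → k ∈ₛ J → ∀ j → off (j ∈? J) (pair k (ω j)) ≡ 0ℤ
    vanish k k∈J j with j ∈? J
    ... | yes _  = refl
    ... | no j∉J = pair-ω-≢ k j (λ { refl → j∉J k∈J })
    member : ∀ k → ℤΣ.sum (λ j → off (j ∈? J) (pair k (ω j))) ℤ.≤ 0ℤ → k ∈ₛ J
    member k le with k ∈? J | sum-nonneg≤0 (nonneg k) le k
    ... | yes k∈J | _ = k∈J
    ... | no k∉J  | eq = contradiction (pair-ω-≡ k) (ℤ.<-irrefl (sym eq))

  private
    ext-zero : ∀ x → ext {n} (λ _ → 0ℤ) x ≡ 0ℤ
    ext-zero (Sign.+ , i) = refl
    ext-zero (Sign.- , i) = refl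

  stab-zero : ∀ w → Stab {n} (λ _ → 0ℤ) w
  stab-zero w i = ext-zero (to w (Sign.+ , i))

  zero-facet : Facet (λ _ → 0ℤ) ⊤
  zero-facet = (λ k → ℤ.≤-reflexive (sym (pair-zero k))) , (λ k _ → pair-zero k) , (λ _ _ → ∈⊤)
    where
    pair-zero : ∀ k → pair k (λ _ → 0ℤ) ≡ 0ℤ
    pair-zero k = cong₂ ℤ._-_ (ext-zero (hi k)) (ext-zero (lo k))

  generic-⊤ : ∀ i → generic ⊤ i ≡ 0ℤ
  generic-⊤ i = trans (ℤΣ.sum-cong-≗ {n} (λ j → vanish j (j ∈? ⊤))) (ℤΣ.sum-replicate-zero n)
    where
    vanish : ∀ j (d : Dec (j ∈ₛ ⊤)) → off d (ω j i) ≡ 0ℤ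
    vanish j (yes _) = refl
    vanish j (no j∉) = contradiction ∈⊤ j∉

  product : List (Fin n) → SignedPerm n
  product []       = idₛ
  product (k ∷ ks) = s k ∘ₛ product ks

  stab-product : ∀ {v} js → (∀ j → j ∈ js → Stab v (s j)) → Stab v (product js)
  stab-product []       st = λ _ → refl
  stab-product {v} (j ∷ js) st = stab-∘ {v = v} {s j} {product js} (st j (here refl)) (stab-product js (λ k k∈ → st k (there k∈)))

  -- Pairing with ω k isolates the contribution of s k to the product.
  product-stab : ∀ {v} js → Unique js → Stab v (product js) → ∀ j → j ∈ js → Stab v (s j)
  product-stab {v} (k ∷ js) (k∉js ∷ js!) st = λ { j (here refl) → k-stab ; j (there j∈) → product-stab {v} js js! rest j j∈ }
    where
    c = product js
    ω-stab : Stab (ω k) c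
    ω-stab = stab-product js (λ j j∈ → stab-ω j k (λ { refl → All.lookup k∉js j∈ refl }))
    dot-eq : dot v (ω k) ℤ.- pair k v ℤ.* pair k (ω k) ≡ dot v (ω k)
    dot-eq = begin
      dot v (ω k) ℤ.- pair k v ℤ.* pair k (ω k)   ≡⟨ dot-s k v (ω k) ⟨
      dot (v ◃ s k) (ω k)                          ≡⟨ dot-cong {u = v ◃ s k} (λ _ → refl) (λ i → sym (stab-inv {v = ω k} {c} ω-stab i)) ⟩
      dot (v ◃ s k) (ω k ◃ invₛ c)                 ≡⟨ dot-◃-inv (v ◃ s k) (ω k) c ⟨
      dot (v ◃ s k ◃ c) (ω k)                      ≡⟨ dot-cong {v = ω k} (λ i → trans (sym (◃-∘ v (s k) c i)) (st i)) (λ _ → refl) ⟩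
      dot v (ω k)                                  ∎
      where open ≡.≡-Reasoning
    prod≡0 : pair k v ℤ.* pair k (ω k) ≡ 0ℤ
    prod≡0 = trans (solve 2 (λ d x → x := d :- (d :- x)) refl (dot v (ω k)) _) (ℤ.i≡j⇒i-j≡0 (sym dot-eq))
      where open ℤ-Solver
    k-stab : Stab v (s k)
    k-stab = pair≡0⇒stab k ([ id , (λ eq → contradiction (pair-ω-≡ k) (ℤ.<-irrefl (sym eq))) ]′ (ℤ.i*j≡0⇒i≡0∨j≡0 (pair k v) prod≡0))
    rest : Stab v c
    rest i = trans (sym (◃-cong k-stab c i)) (trans (sym (◃-∘ v (s k) c i)) (st i))

  private
    root≤0⊎hi : ∀ k {x} → View k x → ext (root k) x ℤ.≤ 0ℤ ⊎ (x ≡ hi k ⊎ x ≡ neg (lo k))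
    root≤0⊎hi k is-hi       = inj₂ (inj₁ refl)
    root≤0⊎hi k is-neglo    = inj₂ (inj₂ refl)
    root≤0⊎hi k is-lo       = inj₁ (subst (ℤ._≤ 0ℤ) (sym (root-lo k)) ℤ.-≤+)
    root≤0⊎hi k is-neghi    = inj₁ (subst (ℤ._≤ 0ℤ) (sym (trans (ext-neg (root k) (hi k)) (cong ℤ.-_ (root-hi k)))) ℤ.-≤+)
    root≤0⊎hi k (other {x} a b) = inj₁ (ℤ.≤-reflexive (root-other k x a b))

    root≤1 : ∀ k x → ext (root k) x ℤ.≤ 1ℤ
    root≤1 k x with root≤0⊎hi k (view k x)
    ... | inj₁ le = ℤ.≤-trans le (+≤+ z≤n)
    ... | inj₂ (inj₁ refl) = ℤ.≤-reflexive (root-hi k)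
    ... | inj₂ (inj₂ refl) = ℤ.≤-reflexive (trans (ext-neg (root k) (lo k)) (cong ℤ.-_ (root-lo k)))

    root≥-1 : ∀ k x → -1ℤ ℤ.≤ ext (root k) x
    root≥-1 k x = subst (-1ℤ ℤ.≤_) (trans (cong ℤ.-_ (ext-neg (root k) x)) (ℤ.neg-involutive _)) (ℤ.neg-mono-≤ (root≤1 k (neg x)))

    neg-flip : ∀ {x y : Letter n} → neg x ≡ y → x ≡ neg y
    neg-flip {x} eq = trans (sym (neg-involutive x)) (cong neg eq)

  -- A simple reflection makes a single positive root negative.
  flipped-root : ∀ k x y → proj₂ x ≢ proj₂ y → ext ρ y ℤ.< ext ρ x → ext ρ (to (s k) x) ℤ.< ext ρ (to (s k) y) →
                 (x ≡ hi k × y ≡ lo k) ⊎ (x ≡ neg (lo k) × y ≡ neg (hi k))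
  flipped-root k x y x≢y y<x sx<sy = go (root≤0⊎hi k (view k x)) (root≤0⊎hi k (view k (neg y)))
    where
    a = ext (root k) x
    b = ext (root k) y
    s-ρ : ∀ z → ext ρ (to (s k) z) ≡ ext ρ z ℤ.- ext (root k) z
    s-ρ z = trans (reflection k ρ z) (cong (λ w → ext ρ z ℤ.- w) (trans (cong (ℤ._* ext (root k) z) (pair-ρ k)) (ℤ.*-identityˡ _)))
    -- The two inequalities give a - b > 1, and the entries of a root lie between -1 and 1, so a = 1
    -- and b = -1. This leaves two choices for each of `x` and `y`; `x≢y` removes the pairs with y =
    -- neg x, which do not belong to roots of type D.
    gap : 1ℤ ℤ.+ b ℤ.< a
    gap = ≡.subst₂ ℤ._<_
      (solve 4 (λ x y a b → (a :+ b :- x :- y) :+ ((con 1ℤ :+ y) :+ (x :- a)) := con 1ℤ :+ b) refl (ext ρ x) (ext ρ y) a b)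
      (solve 4 (λ x y a b → (a :+ b :- x :- y) :+ (x :+ (y :- b)) := a) refl (ext ρ x) (ext ρ y) a b)
      (ℤ.+-monoʳ-< (a ℤ.+ b ℤ.- ext ρ x ℤ.- ext ρ y) (ℤ.+-mono-≤-< (ℤ.i<j⇒suc[i]≤j y<x) (≡.subst₂ ℤ._<_ (s-ρ x) (s-ρ y) sx<sy)))
      where open ℤ-Solver
    go : a ℤ.≤ 0ℤ ⊎ (x ≡ hi k ⊎ x ≡ neg (lo k)) → ext (root k) (neg y) ℤ.≤ 0ℤ ⊎ (neg y ≡ hi k ⊎ neg y ≡ neg (lo k)) →
         (x ≡ hi k × y ≡ lo k) ⊎ (x ≡ neg (lo k) × y ≡ neg (hi k))
    go (inj₁ a≤0) _ = contradiction (ℤ.<-≤-trans (ℤ.≤-<-trans (ℤ.+-monoʳ-≤ 1ℤ (root≥-1 k y)) gap) a≤0) (ℤ.<-irrefl refl)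
    go (inj₂ _) (inj₁ -b≤0) = contradiction (ℤ.≤-<-trans (ℤ.+-monoʳ-≤ 1ℤ 0≤b) (ℤ.<-≤-trans gap a≤1)) (ℤ.<-irrefl refl)
      where
      0≤b : 0ℤ ℤ.≤ b
      0≤b = subst (0ℤ ℤ.≤_) (trans (cong ℤ.-_ (ext-neg (root k) y)) (ℤ.neg-involutive b)) (ℤ.neg-mono-≤ -b≤0)
      a≤1 : a ℤ.≤ 1ℤ
      a≤1 = root≤1 k x
    go (inj₂ (inj₁ refl)) (inj₂ (inj₁ y≡)) = contradiction (cong proj₂ (sym y≡)) x≢y
    go (inj₂ (inj₁ refl)) (inj₂ (inj₂ y≡)) = inj₁ (refl , trans (neg-flip y≡) (neg-involutive (lo k)))
    go (inj₂ (inj₂ refl)) (inj₂ (inj₁ y≡)) = inj₂ (refl , neg-flip y≡)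
    go (inj₂ (inj₂ refl)) (inj₂ (inj₂ y≡)) = contradiction (cong proj₂ (sym y≡)) x≢y

  -- A root joining two letters can also be read off from their negatives in the reverse order, so
  -- these are the two ways in which `x` can carry the simple root j to the simple root k.
  conjugate-simple : ∀ x j k → (to x (hi j) ≡ hi k × to x (lo j) ≡ lo k) ⊎ (to x (hi j) ≡ neg (lo k) × to x (lo j) ≡ neg (hi k)) →
                     ∀ z → to x (to (s j) z) ≡ to (s k) (to x z)
  conjugate-simple x j k ends z = go (view j z)
    where
    swap : to x (lo j) ≡ to (s k) (to x (hi j)) × to x (hi j) ≡ to (s k) (to x (lo j))
    swap = [ (λ (h , l) → trans l (sym (trans (cong (to (s k)) h) (s-hi k))) , trans h (sym (trans (cong (to (s k)) l) (s-lo k))))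
           , (λ (h , l) → trans l (sym (trans (cong (to (s k)) h) (s-neglo k))) , trans h (sym (trans (cong (to (s k)) l) (s-neghi k)))) ]′ ends
    neg-swap : ∀ {a b} → to x a ≡ to (s k) (to x b) → to x (neg a) ≡ to (s k) (to x (neg b))
    neg-swap {a} {b} eq = trans (commutes x a) (trans (cong neg eq) (trans (sym (commutes (s k) (to x b))) (cong (to (s k)) (sym (commutes x b)))))
    avoid : ∀ z → proj₂ z ≢ proj₂ (hi j) → proj₂ z ≢ proj₂ (lo j) → to (s k) (to x z) ≡ to x z
    avoid z z≢h z≢l = [ (λ (h , l) → s-other k _ (away z≢h h) (away z≢l l)) , (λ (h , l) → s-other k _ (away z≢l l) (away z≢h h)) ]′ ends
      where
      away : ∀ {a b} → proj₂ z ≢ proj₂ a → to x a ≡ b → proj₂ (to x z) ≢ proj₂ b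
      away z≢a eq eq′ = z≢a (abs-injective x (trans eq′ (cong proj₂ (sym eq))))
    go : ∀ {z} → View j z → to x (to (s j) z) ≡ to (s k) (to x z)
    go is-hi = trans (cong (to x) (s-hi j)) (proj₁ swap)
    go is-lo = trans (cong (to x) (s-lo j)) (proj₂ swap)
    go is-neghi = trans (cong (to x) (s-neghi j)) (neg-swap (proj₁ swap))
    go is-neglo = trans (cong (to x) (s-neglo j)) (neg-swap (proj₂ swap))
    go (other a b) = trans (cong (to x) (s-other j _ a b)) (sym (avoid _ a b))

-- Parabolic subgroups, their marks and their conjugacy.

module Parabolic {m : ℕ} (2≤m : 2 ≤ m) where
  open SignedPerm
  open Faces m public
  open TypeD (s≤s (s≤s 2≤m)) public
  open Group W using (Carrier; _≈_; _∙_; ε; _⁻¹; setoid)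
  open Powers W public
  open CosetAction W public
  open GroupSolver W

  B : Group 0ℓ 0ℓ
  B = hyperoctahedral n

  generator≡s : ∀ k → generator k ≡ s k
  generator≡s zero    = refl
  generator≡s (suc k) = refl

  generator≈s : ∀ k x → to (generator k) x ≡ to (s k) x
  generator≈s k x = cong (λ w → to w x) (generator≡s k)

  stab-cong : ∀ {v : Vector n} {w w′ : SignedPerm n} → (∀ x → to w x ≡ to w′ x) → Stab v w → Stab v w′
  stab-cong {v} e st i = trans (cong (ext v) (sym (e (Sign.+ , i)))) (st i)

  ∈W⇒even : ∀ {w} → ⟨ B ⟩ IsGenerator w → Even w
  ∈W⇒even {w} (gen (k , e)) = trans (sgn-cong {v = w} {s k} (λ x → trans (e x) (generator≈s k x))) (even-s k)
  ∈W⇒even unit = sgn-id {n}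
  ∈W⇒even (mul {v} {w} p q) = even-∘ {v = v} {w} (∈W⇒even p) (∈W⇒even q)
  ∈W⇒even (inv {w} p) = trans (sgn-inv w) (∈W⇒even p)
  ∈W⇒even (resp {v} {w} e p) = trans (sgn-cong {v = w} {v} (λ x → sym (e x))) (∈W⇒even p)

  -- The zero vector is dominant and fixed by everything, so this is a case of
  -- `stabilizer-generated`.
  even⇒∈W : ∀ w → Even w → ⟨ B ⟩ IsGenerator w
  even⇒∈W w even = ⟨⟩-mono B (λ (k , _ , e) → k , λ x → trans (e x) (sym (generator≈s k x)))
    (stabilizer-generated {v = λ _ → 0ℤ} (proj₁ zero-facet) w even (stab-zero w))

  ⟪_⟫ : Subset n → Pred Carrier 0ℓ
  ⟪ J ⟫ = ⟨ W ⟩ (Among J)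

  simple∈ : ∀ {J} k → k ∈ₛ J → ⟪ J ⟫ (generatorW k)
  simple∈ k k∈J = gen (k , k∈J , λ _ → refl)

  ⟪⟫-stab : ∀ {J v} → (∀ k → k ∈ₛ J → Stab v (s k)) → ∀ {w} → ⟪ J ⟫ w → Stab v (proj₁ w)
  ⟪⟫-stab {v = v} st {w} (gen (k , k∈J , e)) = stab-cong {v = v} {s k} {proj₁ w} (λ x → sym (trans (e x) (generator≈s k x))) (st k k∈J)
  ⟪⟫-stab st unit i = refl
  ⟪⟫-stab {v = v} st (mul {x} {y} p q) = stab-∘ {v = v} {proj₁ x} {proj₁ y} (⟪⟫-stab {v = v} st p) (⟪⟫-stab {v = v} st q)
  ⟪⟫-stab {v = v} st (inv {x} p) = stab-inv {v = v} {proj₁ x} (⟪⟫-stab {v = v} st p)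
  ⟪⟫-stab {v = v} st (resp {x} {y} e p) = stab-cong {v = v} {proj₁ x} {proj₁ y} e (⟪⟫-stab {v = v} st p)

  module _ {J v} (facet : Facet v J) where

    ∈⇒stab : ∀ {w} → ⟪ J ⟫ w → Stab v (proj₁ w)
    ∈⇒stab = ⟪⟫-stab {v = v} (λ k k∈J → pair≡0⇒stab k (proj₁ (proj₂ facet) k k∈J))

    stab⇒∈ : ∀ w → Stab v (proj₁ w) → ⟪ J ⟫ w
    stab⇒∈ (w , w∈) st = let (u , e , u∈) = lift (stabilizer-generated (proj₁ facet) w (∈W⇒even w∈) st)
                         in resp {x = u} {y = w , w∈} (λ x → sym (e x)) u∈
      where
      lift : ∀ {w} → ⟨ B ⟩ (Walls v) w → ∃[ u ] (∀ x → to w x ≡ to (proj₁ u) x) × ⟪ J ⟫ u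
      lift (gen (k , eq , e)) = generatorW k , (λ x → trans (e x) (sym (generator≈s k x))) , simple∈ k (proj₂ (proj₂ facet) k eq)
      lift unit = ε , (λ _ → refl) , unit
      lift (mul {x} {y} p q) = let (u , e , u∈) = lift p ; (u′ , e′ , u′∈) = lift q
        in u ∙ u′ , (λ z → trans (cong (to x) (e′ z)) (e (to (proj₁ u′) z))) , mul u∈ u′∈
      lift (inv {x} p) = let (u , e , u∈) = lift p in u ⁻¹ , Group.⁻¹-cong B {x} {proj₁ u} e , inv u∈
      lift (resp e p) = let (u , e′ , u∈) = lift p in u , (λ z → trans (sym (e z)) (e′ z)) , u∈

  everything∈ : ∀ w → ⟪ S ⟫ w
  everything∈ w = stab⇒∈ zero-facet w (stab-zero (proj₁ w))

  private
    ◃-conj : ∀ v x g → v ◃ proj₁ (x ⁻¹ ∙ g ∙ x) ≗ v ◃ proj₁ (x ⁻¹) ◃ proj₁ g ◃ proj₁ x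
    ◃-conj v (x , _) (g , _) i = trans (◃-∘ v (invₛ x ∘ₛ g) x i) (◃-cong (◃-∘ v (invₛ x) g) x i)

  stab-conj⇒ : ∀ {v} x g → Stab v (proj₁ (x ⁻¹ ∙ g ∙ x)) → Stab (v ◃ proj₁ (x ⁻¹)) (proj₁ g)
  stab-conj⇒ {v} x g st i = trans (sym (◃-inv (v ◃ proj₁ (x ⁻¹) ◃ proj₁ g) (proj₁ x) i))
    (◃-cong {u = v ◃ proj₁ (x ⁻¹) ◃ proj₁ g ◃ proj₁ x} {v = v} (λ j → trans (sym (◃-conj v x g j)) (st j)) (invₛ (proj₁ x)) i)

  stab-conj⇐ : ∀ {v} x g → Stab (v ◃ proj₁ (x ⁻¹)) (proj₁ g) → Stab v (proj₁ (x ⁻¹ ∙ g ∙ x))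
  stab-conj⇐ {v} x g st i = trans (◃-conj v x g i)
    (trans (◃-cong {u = v ◃ proj₁ (x ⁻¹) ◃ proj₁ g} {v = v ◃ proj₁ (x ⁻¹)} st (proj₁ x) i) (◃-inv′ v (proj₁ x) i))

  abstract
    size-W : ∃[ k ] HasSize setoid k
    size-W = Enumerable⇒size W-enumerable

  ∈⟪_⟫? : ∀ J → Decidable₁ ⟪ J ⟫
  ∈⟪ J ⟫? w = map′ (stab⇒∈ (generic-facet J) w) (∈⇒stab (generic-facet J))
    (Fin.all? (λ i → (generic J ◃ proj₁ w) i ℤ.≟ generic J i))

  size-β : ∀ J K → HasSize (FixedPoints J K) (β J K)
  size-β J K = proj₂ (fixedPoints-finite J K)

  product≈ : ∀ js x → to (proj₁ (foldr _∙_ ε (map generatorW js))) x ≡ to (product js) x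
  product≈ []       x = refl
  product≈ (j ∷ js) x = trans (generator≈s j _) (cong (to (s j)) (product≈ js x))

  coxeter∈ : ∀ {K c} → IsCoxeterElement K c → ⟪ K ⟫ c
  coxeter∈ {K} {c} (js , _ , mem , e) = resp {x = foldr _∙_ ε (map generatorW js)} {y = c} (λ x → sym (e x))
    (go js (λ j j∈ → Equivalence.to (mem j) j∈))
    where
    go : ∀ js → (∀ j → j ∈ js → j ∈ₛ K) → ⟪ K ⟫ (foldr _∙_ ε (map generatorW js))
    go []       _   = unit
    go (j ∷ js) mem = mul (simple∈ j (mem j (here refl))) (go js (λ k k∈ → mem k (there k∈)))

  coxeter-stab : ∀ {K c} → IsCoxeterElement K c → ∀ {v} → Stab v (proj₁ c) → ∀ {g} → ⟪ K ⟫ g → Stab v (proj₁ g)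
  coxeter-stab {K} {c} (js , js! , mem , e) {v} st = ⟪⟫-stab {v = v} (λ k k∈K →
    product-stab {v} js js! (stab-cong {v = v} {proj₁ c} {product js} (λ x → trans (e x) (product≈ js x)) st) k (Equivalence.from (mem k) k∈K))

  -- The parabolic closure of a Coxeter element of W_K is W_K.
  fixedPoints≅Fixes : ∀ {K c} → IsCoxeterElement K c → ∀ J → Inverse (Fixes {Among J} c) (FixedPoints J K)
  fixedPoints≅Fixes {K} {c} cox J = record
    { to = λ (x , fx) → x , conjugate⇒fixed {P = Among J} {Q = Among K} {x = x} (λ g g∈ → stab⇒∈ facet (x ⁻¹ ∙ g ∙ x) (stab-conj⇐ {generic J} x g
        (coxeter-stab {K} {c} cox {generic J ◃ proj₁ (x ⁻¹)} (stab-conj⇒ {generic J} x c (c-stab x fx)) g∈)))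
    ; from = λ (x , fix) → x , fix c (coxeter∈ {K} {c} cox)
    ; to-cong = id ; from-cong = id ; inverse = id , id }
    where
    facet = generic-facet J
    c-stab : ∀ x → ⟪ J ⟫ ((c ∙ x) ⁻¹ ∙ x) → Stab (generic J) (proj₁ (x ⁻¹ ∙ c ∙ x))
    c-stab x fx = ∈⇒stab facet {x ⁻¹ ∙ c ∙ x} (resp {x = ((c ∙ x) ⁻¹ ∙ x) ⁻¹} {y = x ⁻¹ ∙ c ∙ x}
      (group-solve (x ∷ c ∷ x ∷ x ∷ []) (ι (ι (b ⊕ a) ⊕ a)) (ι a ⊕ b ⊕ a) refl) (inv fx))

  β-powerConjugate : ∀ {p} → Prime p → ∀ {K L cK cL} → IsCoxeterElement K cK → IsCoxeterElement L cL →
                     PowerConjugate p cK cL → ∀ J → β J K ≡ β J L [mod p ]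
  β-powerConjugate pp coxK coxL conj J = Fixes-powerConjugate {Among J} W-enumerable ∈⟪ J ⟫? pp conj
    (HasSize-resp (fixedPoints≅Fixes coxK J) (size-β J _)) (HasSize-resp (fixedPoints≅Fixes coxL J) (size-β J _))

  -- A condition on the coset of `x` modulo ⟪ L ⟫ only, which permits replacing `x` by an element of
  -- least defect.
  Coset-normalizes : Subset n → Subset n → Carrier → Set
  Coset-normalizes L K x = (∀ h → ⟪ L ⟫ h → ⟪ K ⟫ (x ∙ h ∙ x ⁻¹)) × (∀ h → ⟪ K ⟫ h → ⟪ L ⟫ (x ⁻¹ ∙ h ∙ x))

  module _ {L K : Subset n} where

    Shortest : Carrier → Set
    Shortest x = Coset-normalizes L K x × (∀ h → ⟪ L ⟫ h → defect (proj₁ x) ℤ.≤ defect (proj₁ (x ∙ h)))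

    -- An element of least defect in its coset preserves positivity of the roots of W_L.
    shortest-conjugates : ∀ {x} → Shortest x → ∀ k → k ∈ₛ K → ∃[ j ] j ∈ₛ L × x ∙ generatorW j ∙ x ⁻¹ ≈ generatorW k
    shortest-conjugates {x} ((_ , K→L) , short) k k∈K with descent (proj₁ (x ⁻¹ ∙ generatorW k ∙ x))
    ... | inj₂ le = contradiction (trans (sym (s-hi k)) (trans (sym (generator≈s k (hi k))) id-k)) (λ eq → hi≢lo k (cong proj₂ (sym eq)))
      where
      X = proj₁ x
      w = proj₁ (x ⁻¹ ∙ generatorW k ∙ x)
      id-k : to (generator k) (hi k) ≡ hi k
      id-k = trans (sym (trans (strictlyInverseˡ X _) (cong (to (generator k)) (strictlyInverseˡ X (hi k)))))
        (trans (cong (to X) (stab-ρ⇒id w (∈W⇒even (proj₂ (x ⁻¹ ∙ generatorW k ∙ x))) (defect≤0⇒stab w le) (from X (hi k)))) (strictlyInverseˡ X (hi k)))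
    -- The product x w = s_k x makes the simple root j negative: `w` sends it to a negative root of
    -- W_L, and `x` preserves signs on these. As `x` keeps the simple root j positive, s_k reverses
    -- the sign of its image under `x`, which must then be the simple root k.
    ... | inj₁ (j , neg-j) = j , j∈L , λ z → trans (cong (to X) (generator≈s j (from X z)))
        (trans (conjugate-simple X j k ends (from X z)) (trans (cong (to (s k)) (strictlyInverseˡ X z)) (sym (generator≈s k z))))
      where
      X = proj₁ x
      wᴸ = x ⁻¹ ∙ generatorW k ∙ x
      w = proj₁ wᴸ
      w∈L : ⟪ L ⟫ wᴸ
      w∈L = K→L (generatorW k) (simple∈ k k∈K)
      facet = generic-facet L
      j∈L : j ∈ₛ L
      j∈L = proj₂ (proj₂ facet) j (descent⇒wall (proj₁ facet) w (∈⇒stab facet {wᴸ} w∈L) j neg-j)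

      -- Minimality of `x` is tested against its product with the reflection of W_L in the image of
      -- the simple root j under y.
      product-nonneg : ∀ yᴸ → ⟪ L ⟫ yᴸ → 0ℤ ℤ.≤ pair j (ρ ◃ X ◃ proj₁ yᴸ) ℤ.* pair j (ρ ◃ proj₁ yᴸ)
      product-nonneg yᴸ y∈L = i≤i+j⇒0≤j (ℤ.≤-trans
        (short (yᴸ ∙ (generatorW j ∙ yᴸ ⁻¹)) (mul {x = yᴸ} y∈L (mul {x = generatorW j} {y = yᴸ ⁻¹} (simple∈ j j∈L) (inv {x = yᴸ} y∈L))))
        (ℤ.≤-reflexive (trans (defect-cong {X ∘ₛ (Y ∘ₛ (generator j ∘ₛ invₛ Y))} {X ∘ₛ conj-s Y j} (λ z → cong (to X ∘ to Y) (generator≈s j (from Y z))))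
          (defect-reflect X Y j))))
        where Y = proj₁ yᴸ

      positive : 0ℤ ℤ.< pair j (ρ ◃ X)
      positive = ℤ.≤∧≢⇒< (subst (0ℤ ℤ.≤_) (trans (cong₂ ℤ._*_ (pair-◃ j (ρ ◃ X) idₛ) (trans (pair-◃ j ρ idₛ) (pair-ρ j))) (ℤ.*-identityʳ _)) (product-nonneg ε unit))
        (λ eq → pair-ρ-◃≢0 j X (sym eq))

      negative : pair j (ρ ◃ X ◃ w) ℤ.< 0ℤ
      negative = ℤ.≰⇒> λ ge → contradiction (ℤ.≤-antisym (nonpos ge) (product-nonneg wᴸ w∈L)) (λ eq →
        [ (λ eq′ → pair-ρ-◃≢0 j (X ∘ₛ w) (trans (pair-cong j (◃-∘ ρ X w)) eq′)) , pair-ρ-◃≢0 j w ]′ (ℤ.i*j≡0⇒i≡0∨j≡0 (pair j (ρ ◃ X ◃ w)) eq))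
        where
        nonpos : 0ℤ ℤ.≤ pair j (ρ ◃ X ◃ w) → pair j (ρ ◃ X ◃ w) ℤ.* pair j (ρ ◃ w) ℤ.≤ 0ℤ
        nonpos ge = subst (pair j (ρ ◃ X ◃ w) ℤ.* pair j (ρ ◃ w) ℤ.≤_) (ℤ.*-zeroʳ (pair j (ρ ◃ X ◃ w)))
          (ℤ.*-monoˡ-≤-nonNeg (pair j (ρ ◃ X ◃ w)) {{ℤ.nonNegative ge}} (ℤ.<⇒≤ neg-j))

      ext-negative : ∀ y → ext (ρ ◃ X) (to w y) ≡ ext ρ (to (s k) (to X y))
      ext-negative y = trans (ext-◃ ρ X (to w y)) (cong (ext ρ) (trans (strictlyInverseˡ X _) (generator≈s k (to X y))))

      ends : (to X (hi j) ≡ hi k × to X (lo j) ≡ lo k) ⊎ (to X (hi j) ≡ neg (lo k) × to X (lo j) ≡ neg (hi k))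
      ends = flipped-root k (to X (hi j)) (to X (lo j)) (λ eq → hi≢lo j (abs-injective X eq))
        (0<j-i⇒i<j (subst (0ℤ ℤ.<_) (pair-◃ j ρ X) positive))
        (≡.subst₂ ℤ._<_ (ext-negative (hi j)) (ext-negative (lo j)) (ℤ.≰⇒> λ ge → ℤ.<⇒≱ negative
          (subst (0ℤ ℤ.≤_) (sym (pair-◃ j (ρ ◃ X) w)) (ℤ.i≤j⇒0≤j-i ge))))

  defect-inv : ∀ w → defect (invₛ w) ≡ defect w
  defect-inv w = cong (λ z → dot ρ ρ ℤ.- z) (trans (dot-◃-inv ρ ρ (invₛ w)) (trans (dot-cong {u = ρ} {v = ρ ◃ invₛ (invₛ w)} {v′ = ρ ◃ w} (λ _ → refl) (λ _ → refl))
    (ℤΣ.sum-cong-≗ {n} (λ i → ℤ.*-comm (ρ i) ((ρ ◃ w) i)))))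

  -- The cosets x ⟪ L ⟫ and ⟪ K ⟫ x coincide, and inversion preserves the defect.
  shortest-⁻¹ : ∀ {L K x} → Shortest {L} {K} x → Shortest {K} {L} (x ⁻¹)
  shortest-⁻¹ {L} {K} {x} ((L→K , K→L) , short) =
    ((λ h h∈ → resp {x = x ⁻¹ ∙ h ∙ x} {y = x ⁻¹ ∙ h ∙ (x ⁻¹) ⁻¹} (λ _ → refl) (K→L h h∈))
    , (λ h h∈ → resp {x = x ∙ h ∙ x ⁻¹} {y = (x ⁻¹) ⁻¹ ∙ h ∙ x ⁻¹} (λ _ → refl) (L→K h h∈)))
    , λ h h∈ → ≡.subst₂ ℤ._≤_ (sym (defect-inv (proj₁ x)))
        (trans (defect-cong {proj₁ (x ∙ (x ⁻¹ ∙ h ⁻¹ ∙ x))} {proj₁ ((x ⁻¹ ∙ h) ⁻¹)}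
            (group-solve (x ∷ h ∷ x ∷ x ∷ []) (a ⊕ (ι a ⊕ ι b ⊕ a)) (ι (ι a ⊕ b)) refl))
          (defect-inv (proj₁ (x ⁻¹ ∙ h))))
        (short (x ⁻¹ ∙ h ⁻¹ ∙ x) (K→L (h ⁻¹) (inv h∈)))

  module _ {L K : Subset n} (x₀ : Carrier) where
    private
      InCoset : Pred Carrier 0ℓ
      InCoset x = ⟪ L ⟫ (x₀ ⁻¹ ∙ x)

      size : Carrier → ℕ
      size x = ℤ.∣ defect (proj₁ x) ∣

    coset-minimum : ∃[ x ] InCoset x × ∀ y → InCoset y → size x ≤ size y
    coset-minimum = minimal {setoid} (proj₂ size-W) {InCoset} (λ x → ∈⟪ L ⟫? (x₀ ⁻¹ ∙ x))
      (λ {x} {y} x≈y → resp {x = x₀ ⁻¹ ∙ x} {y = x₀ ⁻¹ ∙ y} (λ z → cong (from (proj₁ x₀)) (x≈y z)))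
      size (λ {x} {y} x≈y → cong ℤ.∣_∣ (defect-cong {proj₁ x} {proj₁ y} x≈y))
      (x₀ , resp {x = ε} {y = x₀ ⁻¹ ∙ x₀} (λ z → sym (strictlyInverseʳ (proj₁ x₀) z)) unit)

    minimum-shortest : Coset-normalizes L K x₀ → ∀ x → InCoset x → (∀ y → InCoset y → size x ≤ size y) → Shortest {L} {K} x
    minimum-shortest (L→K , K→L) x x∈ min = (L→K′ , K→L′) , short
      where
      h₀ = x₀ ⁻¹ ∙ x
      L→K′ : ∀ h → ⟪ L ⟫ h → ⟪ K ⟫ (x ∙ h ∙ x ⁻¹)
      L→K′ h h∈ = resp {x = x₀ ∙ (h₀ ∙ h ∙ h₀ ⁻¹) ∙ x₀ ⁻¹} {y = x ∙ h ∙ x ⁻¹}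
        (group-solve (x₀ ∷ x ∷ h ∷ x ∷ []) (a ⊕ ((ι a ⊕ b) ⊕ c ⊕ ι (ι a ⊕ b)) ⊕ ι a) (b ⊕ c ⊕ ι b) refl)
        (L→K (h₀ ∙ h ∙ h₀ ⁻¹) (mul {x = h₀ ∙ h} {y = h₀ ⁻¹} (mul {x = h₀} {y = h} x∈ h∈) (inv {x = h₀} x∈)))
      K→L′ : ∀ h → ⟪ K ⟫ h → ⟪ L ⟫ (x ⁻¹ ∙ h ∙ x)
      K→L′ h h∈ = resp {x = h₀ ⁻¹ ∙ (x₀ ⁻¹ ∙ h ∙ x₀) ∙ h₀} {y = x ⁻¹ ∙ h ∙ x}
        (group-solve (x₀ ∷ x ∷ h ∷ x ∷ []) (ι (ι a ⊕ b) ⊕ (ι a ⊕ c ⊕ a) ⊕ (ι a ⊕ b)) (ι b ⊕ c ⊕ b) refl)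
        (mul {x = h₀ ⁻¹ ∙ (x₀ ⁻¹ ∙ h ∙ x₀)} {y = h₀} (mul {x = h₀ ⁻¹} {y = x₀ ⁻¹ ∙ h ∙ x₀} (inv {x = h₀} x∈) (K→L h h∈)) x∈)
      short : ∀ h → ⟪ L ⟫ h → defect (proj₁ x) ℤ.≤ defect (proj₁ (x ∙ h))
      short h h∈ = ≡.subst₂ ℤ._≤_ (ℤ.0≤i⇒+∣i∣≡i (defect-nonneg (proj₁ x))) (ℤ.0≤i⇒+∣i∣≡i (defect-nonneg (proj₁ (x ∙ h))))
        (+≤+ (min (x ∙ h) (resp {x = h₀ ∙ h} {y = x₀ ⁻¹ ∙ (x ∙ h)} (λ _ → refl) (mul {x = h₀} {y = h} x∈ h∈))))

  shortest⇒∼ : ∀ {L K} x → Shortest {L} {K} x → L ∼ K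
  shortest⇒∼ {L} {K} x short = x , forth , shortest-conjugates {L} {K} {x} short
    where
    flip-conj : ∀ j k → x ⁻¹ ∙ generatorW k ∙ (x ⁻¹) ⁻¹ ≈ generatorW j → x ∙ generatorW j ∙ x ⁻¹ ≈ generatorW k
    flip-conj j k e z = trans (cong (to (proj₁ x)) (sym (e (from (proj₁ x) z))))
      (trans (strictlyInverseˡ (proj₁ x) _) (cong (to (generator k)) (strictlyInverseˡ (proj₁ x) z)))
    found : ∀ j → ∃[ k ] k ∈ₛ K × x ⁻¹ ∙ generatorW k ∙ (x ⁻¹) ⁻¹ ≈ generatorW j → Among K (x ∙ generatorW j ∙ x ⁻¹)
    found j (k , k∈ , e) = k , k∈ , flip-conj j k e
    forth : ∀ j → j ∈ₛ L → Among K (x ∙ generatorW j ∙ x ⁻¹)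
    forth j j∈ = found j (shortest-conjugates {K} {L} {x ⁻¹} (shortest-⁻¹ {L} {K} {x} short) j j∈)

  -- The element of least defect in the coset carries the simple roots of L onto those of K, so
  -- conjugacy of the subgroups is realized on the generators.
  conjugate⇒∼ : ∀ {L K x} → Coset-normalizes L K x → L ∼ K
  conjugate⇒∼ {L} {K} {x₀} norm = go (coset-minimum {L} {K} x₀)
    where
    go : (∃[ x ] ⟪ L ⟫ (x₀ ⁻¹ ∙ x) × ∀ y → ⟪ L ⟫ (x₀ ⁻¹ ∙ y) → ℤ.∣ defect (proj₁ x) ∣ ≤ ℤ.∣ defect (proj₁ y) ∣) → L ∼ K
    go (x , x∈ , min) = shortest⇒∼ x (minimum-shortest x₀ norm x x∈ min)

  -- Composing the two inclusions embeds ⟪ K ⟫ into itself by a conjugation; W being finite, this is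
  -- onto, and so are both inclusions.
  mutual-containment : ∀ {L K x y} → IsFixed W (Among L) (Among K) x → IsFixed W (Among K) (Among L) y → L ∼ K
  mutual-containment {L} {K} {x} {y} fx fy = conjugate⇒∼ {L} {K} {x} (L→K , K→L)
    where
    K→L : ∀ h → ⟪ K ⟫ h → ⟪ L ⟫ (x ⁻¹ ∙ h ∙ x)
    K→L = fixed⇒conjugate {P = Among L} {Q = Among K} {x = x} fx
    L→K′ : ∀ h → ⟪ L ⟫ h → ⟪ K ⟫ (y ⁻¹ ∙ h ∙ y)
    L→K′ = fixed⇒conjugate {P = Among K} {Q = Among L} {x = y} fy
    xy-normalizes : Normalizes (Among K) (x ∙ y)
    xy-normalizes g g∈ = resp {x = y ⁻¹ ∙ (x ⁻¹ ∙ g ∙ x) ∙ y} {y = (x ∙ y) ⁻¹ ∙ g ∙ (x ∙ y)}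
      (group-solve (x ∷ y ∷ g ∷ g ∷ []) (ι b ⊕ (ι a ⊕ c ⊕ a) ⊕ b) (ι (a ⊕ b) ⊕ c ⊕ (a ⊕ b)) refl)
      (L→K′ (x ⁻¹ ∙ g ∙ x) (K→L g g∈))
    L→K : ∀ h → ⟪ L ⟫ h → ⟪ K ⟫ (x ∙ h ∙ x ⁻¹)
    L→K h h∈ = resp {x = ((x ∙ y) ⁻¹) ⁻¹ ∙ (y ⁻¹ ∙ h ∙ y) ∙ (x ∙ y) ⁻¹} {y = x ∙ h ∙ x ⁻¹}
      (group-solve (x ∷ y ∷ h ∷ h ∷ []) (ι (ι (a ⊕ b)) ⊕ (ι b ⊕ c ⊕ b) ⊕ ι (a ⊕ b)) (a ⊕ c ⊕ ι a) refl)
      (normalizes-⁻¹ {Among K} (proj₂ size-W) {x ∙ y} xy-normalizes (y ⁻¹ ∙ h ∙ y) (L→K′ h h∈))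

-- Sign changes and the parity of the marks.

private
  ∏ : ∀ {n} → (Fin n → Sign) → Sign
  ∏ = SignΣ.sum

sign-power : ℕ → Sign
sign-power zero    = Sign.+
sign-power (suc k) = opposite (sign-power k)

sign-power-even : ∀ {k} → 2 ∣ k → sign-power k ≡ Sign.+
sign-power-even (divides q refl) = go q
  where
  go : ∀ q → sign-power (q * 2) ≡ Sign.+
  go zero    = refl
  go (suc q) = trans (Sign.opposite-selfInverse refl) (go q)

sign-power-odd : ∀ {k} → ¬ 2 ∣ k → sign-power k ≡ Sign.-
sign-power-odd {zero} odd = contradiction (2 ∣0) odd
sign-power-odd {suc zero} odd = refl
sign-power-odd {suc (suc k)} odd = trans (Sign.opposite-selfInverse refl) (sign-power-odd {k} (λ 2∣k → odd (∣m∣n⇒∣m+n ∣-refl 2∣k)))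

prod-minus : ∀ n → ∏ {n} (λ _ → Sign.-) ≡ sign-power n
prod-minus zero    = refl
prod-minus (suc n) = cong opposite (prod-minus n)

prod-opposite : ∀ {n} (σ : Fin n → Sign) → ∏ (opposite ∘ σ) ≡ sign-power n Sign.* ∏ σ
prod-opposite {zero}  σ = refl
prod-opposite {suc n} σ = trans (cong (opposite (σ zero) Sign.*_) (prod-opposite (σ ∘ suc))) (rearrange (σ zero) (sign-power n) (∏ (σ ∘ suc)))
  where
  rearrange : ∀ a b c → opposite a Sign.* (b Sign.* c) ≡ opposite b Sign.* (a Sign.* c)
  rearrange Sign.+ Sign.+ c = refl
  rearrange Sign.+ Sign.- c = Sign.opposite-selfInverse refl
  rearrange Sign.- Sign.+ c = sym (Sign.opposite-selfInverse refl)
  rearrange Sign.- Sign.- c = refl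

topSign : ℕ → ∀ {n} → Fin n → Sign
topSign zero    _       = Sign.-
topSign (suc c) zero    = Sign.+
topSign (suc c) (suc j) = topSign c j

topSign-≥ : ∀ c {n} (j : Fin n) → c ≤ toℕ j → topSign c j ≡ Sign.-
topSign-≥ zero    j       _         = refl
topSign-≥ (suc c) (suc j) (s≤s c≤j) = topSign-≥ c j c≤j

topSign-< : ∀ c {n} (j : Fin n) → toℕ j < c → topSign c j ≡ Sign.+
topSign-< (suc c) zero    _         = refl
topSign-< (suc c) (suc j) (s≤s j<c) = topSign-< c j j<c

prod-topSign : ∀ c n → ∏ {n} (topSign c) ≡ sign-power (n ∸ c)
prod-topSign zero    n       = prod-minus n
prod-topSign (suc c) zero    = refl
prod-topSign (suc c) (suc n) = prod-topSign c n

topSign-adjacent : ∀ c {n} (i : Fin n) → suc (toℕ i) ≢ c → topSign c (suc i) ≡ topSign c (inject₁ i)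
topSign-adjacent c i i≢c with <-cmp (suc (toℕ i)) c
... | tri< lt _ _ = trans (topSign-< c (suc i) lt) (sym (topSign-< c (inject₁ i) (subst (_< c) (sym (Fin.toℕ-inject₁ i)) (<-trans (n<1+n (toℕ i)) lt))))
... | tri≈ _ eq _ = contradiction eq i≢c
... | tri> _ _ gt = trans (topSign-≥ c (suc i) (<⇒≤ gt)) (sym (topSign-≥ c (inject₁ i) (subst (c ≤_) (sym (Fin.toℕ-inject₁ i)) (≤-pred gt))))

¬≡neg : ∀ {i} → ℤ.∣ i ∣ ≡ 1 → ℤ.- i ≢ i
¬≡neg { + suc zero } refl ()
¬≡neg { -[1+ zero ] } refl ()

module SignChanges {m : ℕ} (2≤m : 2 ≤ m) where
  open SignedPerm
  open Parabolic 2≤m public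
  open Group W using (Carrier; _≈_; _∙_; ε; _⁻¹; setoid)
  open GroupSolver W

  signChange : (Fin n → Sign) → SignedPerm n
  signChange σ = signed σ Perm.id

  signChange-+ : ∀ {σ} x → σ (proj₂ x) ≡ Sign.+ → from (signChange σ) x ≡ x
  signChange-+ (τ , i) eq = cong (λ s → s Sign.* τ , i) eq

  signChange-- : ∀ {σ} x → σ (proj₂ x) ≡ Sign.- → from (signChange σ) x ≡ neg x
  signChange-- (τ , i) eq = cong (λ s → s Sign.* τ , i) eq

  even-signChange : ∀ {σ} → ∏ σ ≡ Sign.+ → Even (signChange σ)
  even-signChange {σ} eq = trans (SignΣ.sum-cong-≗ {n} (λ i → Sign.*-identityʳ (σ i))) eq

  -- Signs have to be constant on the blocks of J, but are free on a block of type D, where the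
  -- generic vector vanishes.
  Compatible : (Fin n → Sign) → Subset n → Set
  Compatible σ J = ∀ k → k ∈ₛ J → σ (proj₂ (hi k)) ≡ σ (proj₂ (lo k)) ⊎ (generic J (proj₂ (hi k)) ≡ 0ℤ × generic J (proj₂ (lo k)) ≡ 0ℤ)

  ∣ω-zero∣ : ∀ x → ℤ.∣ ext (ω zero) x ∣ ≡ 1
  ∣ω-zero∣ (Sign.+ , i) = refl
  ∣ω-zero∣ (Sign.- , i) = refl

  ω-zero-facet : Facet (ω zero) S′
  ω-zero-facet = (λ { zero → ℤ.<⇒≤ (pair-ω-≡ zero) ; (suc k) → ℤ.≤-refl }) , (λ { zero () ; (suc k) _ → refl })
               , (λ { zero eq → contradiction (pair-ω-≡ zero) (ℤ.<-irrefl (sym eq)) ; (suc k) _ → there ∈⊤ })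

  module _ {σ : Fin n → Sign} (even : ∏ σ ≡ Sign.+) where
    z : Carrier
    z = signChange σ , even⇒∈W (signChange σ) (even-signChange {σ} even)

    z-square : Powers._^ᴳ_ W z 2 ≈ ε
    z-square (τ , i) = cong (_, i) (twice (σ i))
      where
      twice : ∀ s → s Sign.* (s Sign.* τ) ≡ τ
      twice Sign.+ = refl
      twice Sign.- = Sign.opposite-selfInverse refl

    normalizes : ∀ {J} → Compatible σ J → Normalizes (Among J) z
    normalizes {J} compatible h h∈ = stab⇒∈ (generic-facet J) (z ⁻¹ ∙ h ∙ z)
      (stab-conj⇐ {generic J} z h (⟪⟫-stab {v = generic J ◃ proj₁ (z ⁻¹)} (λ k k∈J → pair≡0⇒stab k (vanish k k∈J)) h∈))
      where
      g = generic J
      flip = from (signChange σ)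
      ext-0 : ∀ x → g (proj₂ x) ≡ 0ℤ → ext g x ≡ 0ℤ
      ext-0 (Sign.+ , i) eq = eq
      ext-0 (Sign.- , i) eq = cong ℤ.-_ eq
      same : ∀ k → pair k g ≡ 0ℤ → ∀ s → σ (proj₂ (hi k)) ≡ s → σ (proj₂ (lo k)) ≡ s → ext g (flip (hi k)) ≡ ext g (flip (lo k))
      same k eq Sign.+ h l = trans (cong (ext g) (signChange-+ {σ} (hi k) h)) (trans (ℤ.i-j≡0⇒i≡j _ _ eq) (cong (ext g) (sym (signChange-+ {σ} (lo k) l))))
      same k eq Sign.- h l = trans (cong (ext g) (signChange-- {σ} (hi k) h)) (trans (ext-neg g (hi k)) (trans (cong ℤ.-_ (ℤ.i-j≡0⇒i≡j _ _ eq))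
        (trans (sym (ext-neg g (lo k))) (cong (ext g) (sym (signChange-- {σ} (lo k) l))))))
      vanish : ∀ k → k ∈ₛ J → pair k (g ◃ proj₁ (z ⁻¹)) ≡ 0ℤ
      vanish k k∈J = trans (pair-◃ k g (proj₁ (z ⁻¹))) (ℤ.i≡j⇒i-j≡0 ([
          (λ eq → same k (proj₁ (proj₂ (generic-facet J)) k k∈J) _ refl (sym eq))
        , (λ (h , l) → trans (ext-0 (flip (hi k)) h) (sym (ext-0 (flip (lo k)) l))) ]′ (compatible k k∈J)))

    -- For `k` outside J the group W_J fixes `ω k`, whereas `z` negates its nonzero coordinate `i`.
    -- So `z` normalizes W_J, lies outside it and has square `ε`.
    row-even : ∀ {J} → Compatible σ J → ∀ {k i} → ¬ k ∈ₛ J → σ i ≡ Sign.- → ℤ.∣ ω k i ∣ ≡ 1 → ∀ K → 2 ∣ β J K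
    row-even {J} compatible {k} {i} k∉J σi ωi K = normalizer⇒∣ {Among J} prime[2] {z} (normalizes {J} compatible) z∉
      (resp {x = ε} {y = Powers._^ᴳ_ W z 2} (λ x → sym (z-square x)) unit) {Among K} (size-β J K)
      where
      z∉ : ¬ ⟪ J ⟫ z
      z∉ z∈ = ¬≡neg {ω k i} ωi (trans (cong (λ s → ext (ω k) (s Sign.* Sign.+ , i)) (sym σi))
        (⟪⟫-stab {J} {ω k} (λ j j∈J → stab-ω j k (λ { refl → k∉J j∈J })) z∈ i))

    -- The cosets of W_{S′} correspond to the vectors in the orbit of `ω zero`. All their entries
    -- are 1 or -1, so a sign change that negates some letter fixes none of them.
    column-even : ∀ {K} → Compatible σ K → ∀ {i} → σ i ≡ Sign.- → 2 ∣ β S′ K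
    column-even {K} compatible {i} σi = free-left⇒∣ {Among S′} prime[2] {Among K} {z = z} (normalizes {K} compatible) z-square
      (λ x _ → moves x) (size-β S′ K)
      where
      moves : ∀ x → ¬ ⟪ S′ ⟫ ((z ∙ x) ⁻¹ ∙ x)
      moves x zx∼x = ¬≡neg {(ω zero ◃ proj₁ (x ⁻¹)) i} (∣ω-zero∣ (from (proj₁ x) (Sign.+ , i)))
        (trans (cong (λ s → ext (ω zero ◃ proj₁ (x ⁻¹)) (s Sign.* Sign.+ , i)) (sym σi))
          (stab-conj⇒ {ω zero} x z (∈⇒stab ω-zero-facet {x ⁻¹ ∙ z ∙ x}
            (resp {x = ((z ∙ x) ⁻¹ ∙ x) ⁻¹} {y = x ⁻¹ ∙ z ∙ x} (group-solve (x ∷ z ∷ x ∷ x ∷ []) (ι (ι (b ⊕ a) ⊕ a)) (ι a ⊕ b ⊕ a) refl) (inv zx∼x))) i))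

  -- Data for an involution that acts freely on the fixed points counted by row J and by the entry (S′, J).
  record Flip (J : Subset n) : Set where
    field
      σ          : Fin n → Sign
      even       : ∏ σ ≡ Sign.+
      compatible : Compatible σ J
      k          : Fin n
      i          : Fin n
      k∉J        : ¬ k ∈ₛ J
      σi         : σ i ≡ Sign.-
      ωi         : ℤ.∣ ω k i ∣ ≡ 1

  flip-row : ∀ {J} → Flip J → ∀ K → 2 ∣ β J K
  flip-row {J} f = row-even {σ} even {J} compatible k∉J σi ωi
    where open Flip f

  flip-column : ∀ {J} → Flip J → 2 ∣ β S′ J
  flip-column {J} f = column-even {σ} even {J} compatible σi
    where open Flip f

  last : Fin n
  last = Fin.fromℕ (suc m)

  ∣ω-last∣ : ∀ k → ℤ.∣ ω k last ∣ ≡ 1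
  ∣ω-last∣ zero          = refl
  ∣ω-last∣ (suc zero)    = refl
  ∣ω-last∣ (suc (suc j)) = cong ℤ.∣_∣ (step-≤ (subst (suc (suc (toℕ j)) ≤_) (sym (Fin.toℕ-fromℕ (suc m))) (s≤s (Fin.toℕ<n j))))

  ∣ω-diagonal∣ : ∀ i → ℤ.∣ ω (suc i) (suc i) ∣ ≡ 1
  ∣ω-diagonal∣ zero    = refl
  ∣ω-diagonal∣ (suc j) = cong ℤ.∣_∣ (step-≤ {b = suc (suc (toℕ j))} ≤-refl)

  -- For even n, -1 lies in W and normalizes every W_J. The last coordinate of every `ω k` is
  -- nonzero, so -1 is outside W_J whenever some `k` is outside J.
  flip-even : 2 ∣ n → ∀ {J} → (∃[ k ] ¬ k ∈ₛ J) → Flip J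
  flip-even 2∣n (k , k∉J) = record
    { σ = λ _ → Sign.- ; even = trans (prod-minus n) (sign-power-even 2∣n) ; compatible = λ _ _ → inj₁ refl
    ; k = k ; i = last ; k∉J = k∉J ; σi = refl ; ωi = ∣ω-last∣ k }

  module _ (n-odd : ¬ 2 ∣ n) where
    private
      odd : sign-power n ≡ Sign.-
      odd = sign-power-odd n-odd

      S″ : Subset n
      S″ = inside ∷ outside ∷ ⊤

      top-compatible : ∀ {J} c → (∀ {k} → k ∈ₛ J → toℕ k ≢ c) → (zero ∈ₛ J → c ≢ 1) → ∀ k → k ∈ₛ J → topSign c (proj₂ (hi k)) ≡ topSign c (proj₂ (lo k))
      top-compatible c avoid avoid₀ zero    k∈J = topSign-adjacent c zero (λ eq → avoid₀ k∈J (sym eq))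
      top-compatible c avoid avoid₀ (suc k) k∈J = topSign-adjacent c k (avoid k∈J)

      -- The letters above the break at `k` are negated if their number is even. Otherwise the
      -- number of those below is even, n being odd, and these are negated instead, unless J
      -- contains both u and s₁: then the resulting sign change might lie in W_J. In that case the
      -- first letter is negated together with the upper ones, which corrects the parity and is
      -- compatible as its block is of type D.
      flip-inner : ∀ {J} (i : Fin m) → ¬ suc (suc i) ∈ₛ J → Flip J
      flip-inner {J} i k∉J = go (sign-power (n ∸ ht)) refl
        where
        k : Fin n
        k = suc (suc i)
        ht = toℕ k
        agree : ∀ j → j ∈ₛ J → topSign ht (proj₂ (hi j)) ≡ topSign ht (proj₂ (lo j))
        agree = top-compatible {J} ht (λ j∈J eq → k∉J (subst (_∈ₛ J) (Fin.toℕ-injective eq) j∈J)) (λ _ ())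
        bottom : sign-power (n ∸ ht) ≡ Sign.- → ∏ {n} (opposite ∘ topSign ht) ≡ Sign.+
        bottom eq = trans (prod-opposite (topSign ht {n})) (cong₂ Sign._*_ odd (trans (prod-topSign ht n) eq))
        σ₀ : Fin n → Sign
        σ₀ zero    = Sign.-
        σ₀ (suc j) = topSign ht (suc j)
        vanish : zero ∈ₛ J → suc zero ∈ₛ J → generic J zero ≡ 0ℤ × generic J (suc zero) ≡ 0ℤ
        vanish z∈ o∈ = g₀≡0 , trans g₁≡g₀ g₀≡0
          where
          g = generic J
          g₁≡g₀ : g (suc zero) ≡ g zero
          g₁≡g₀ = ℤ.i-j≡0⇒i≡j _ _ (proj₁ (proj₂ (generic-facet J)) (suc zero) o∈)
          g₁≡-g₀ : g (suc zero) ≡ ℤ.- g zero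
          g₁≡-g₀ = ℤ.i-j≡0⇒i≡j _ _ (proj₁ (proj₂ (generic-facet J)) zero z∈)
          self-neg : ∀ i → i ≡ ℤ.- i → i ≡ 0ℤ
          self-neg (+ zero) _ = refl
          g₀≡0 : g zero ≡ 0ℤ
          g₀≡0 = self-neg (g zero) (trans (sym g₁≡g₀) g₁≡-g₀)
        go : ∀ s → sign-power (n ∸ ht) ≡ s → Flip J
        go Sign.+ eq = record { σ = topSign ht ; even = trans (prod-topSign ht n) eq ; compatible = λ j j∈ → inj₁ (agree j j∈)
                              ; k = k ; i = k ; k∉J = k∉J ; σi = topSign-≥ ht k ≤-refl ; ωi = ∣ω-diagonal∣ (suc i) }
        go Sign.- eq with zero ∈? J | suc zero ∈? J
        ... | no u∉J | _ = record { σ = opposite ∘ topSign ht ; even = bottom eq ; compatible = λ j j∈ → inj₁ (cong opposite (agree j j∈))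
                                  ; k = zero ; i = zero ; k∉J = u∉J ; σi = refl ; ωi = refl }
        ... | _ | no s∉J = record { σ = opposite ∘ topSign ht ; even = bottom eq ; compatible = λ j j∈ → inj₁ (cong opposite (agree j j∈))
                                  ; k = suc zero ; i = zero ; k∉J = s∉J ; σi = refl ; ωi = refl }
        ... | yes u∈J | yes s∈J = record { σ = σ₀ ; even = trans (cong opposite (prod-topSign ht n)) (cong opposite eq)
                                         ; compatible = λ { zero j∈ → inj₂ (proj₂ (vanish u∈J s∈J) , proj₁ (vanish u∈J s∈J))
                                                          ; (suc zero) j∈ → inj₂ (proj₂ (vanish u∈J s∈J) , proj₁ (vanish u∈J s∈J))
                                                          ; (suc (suc j)) j∈ → inj₁ (agree (suc (suc j)) j∈) }
                                         ; k = k ; i = k ; k∉J = k∉J ; σi = topSign-≥ ht k ≤-refl ; ωi = ∣ω-diagonal∣ (suc i) }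

    data OddCase (J : Subset n) : Set where
      is-S  : J ≡ S → OddCase J
      is-S′ : J ≡ S′ ⊎ J ∼ S′ → OddCase J
      flips : Flip J → OddCase J

    private
      odd-pred : sign-power (suc m) ≡ Sign.+
      odd-pred = opposite-injective odd
        where
        opposite-injective : ∀ {s} → opposite s ≡ Sign.- → s ≡ Sign.+
        opposite-injective {Sign.+} _ = refl

    -- S admits no `Flip`, having no index outside it, but `column-even` needs only compatibility,
    -- which is automatic as `generic ⊤` is zero. All n - 1 letters but the first are negated, an
    -- even number.
    flip-S : 2 ∣ β S′ S
    flip-S = column-even {topSign 1} even-top {S} (λ k _ → inj₂ (generic-⊤ (proj₂ (hi k)) , generic-⊤ (proj₂ (lo k)))) {suc zero} refl
      where
      even-top : ∏ {n} (topSign 1) ≡ Sign.+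
      even-top = trans (prod-topSign 1 n) odd-pred

    private
      ones : ∀ {k} {T : Subset k} → (∀ i → i ∈ₛ T) → T ≡ ⊤
      ones all = ⊆-antisym ⊆⊤ (λ {i} _ → all i)

      -- The sign changes of all letters but the first exchange S′ and S″.
      S″∼S′ : S″ ∼ S′
      S″∼S′ = conjugate⇒∼ {S″} {S′} {w} (to-S′ , to-S″)
        where
        even-w : ∏ {n} (topSign 1) ≡ Sign.+
        even-w = trans (prod-topSign 1 n) odd-pred
        w : Carrier
        w = z {topSign 1} even-w
        ω₁ : ∀ k → k ∈ₛ S″ → Stab (ω (suc zero)) (s k)
        ω₁ k k∈ = stab-ω k (suc zero) λ { refl → not-there k∈ }
          where
          not-there : ¬ suc zero ∈ₛ S″
          not-there (there ())
        ω₁-facet : Facet (ω (suc zero)) S″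
        ω₁-facet = (λ { zero → ℤ.≤-refl ; (suc zero) → ℤ.<⇒≤ (pair-ω-≡ (suc zero)) ; (suc (suc k)) → ℤ.≤-refl })
                 , (λ k k∈ → stab⇒pair≡0 k {ω (suc zero)} (ω₁ k k∈))
                 , (λ { zero _ → here ; (suc zero) eq → contradiction (pair-ω-≡ (suc zero)) (ℤ.<-irrefl (sym eq)) ; (suc (suc k)) _ → there (there ∈⊤) })
        -- The sign change carries `ω zero` to the negative of `ω (suc zero)`, and a vector and its
        -- negative have the same stabilizer.
        ω₁≗ : ∀ i → ω (suc zero) i ≡ ℤ.- (ω zero ◃ invₛ (signChange (topSign 1))) i
        ω₁≗ zero    = refl
        ω₁≗ (suc i) = refl
        ω₀≗ : ∀ i → ω zero i ≡ ℤ.- (ω (suc zero) ◃ signChange (topSign 1)) i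
        ω₀≗ zero    = refl
        ω₀≗ (suc i) = refl
        negated : ∀ {u v : Vector n} g → (∀ i → u i ≡ ℤ.- v i) → Stab u g → Stab v g
        negated {u} {v} g e st i = ℤ.neg-injective (trans (sym (ext-negated (to g (Sign.+ , i)))) (trans (st i) (e i)))
          where
          ext-negated : ∀ x → ext u x ≡ ℤ.- ext v x
          ext-negated (Sign.+ , j) = e j
          ext-negated (Sign.- , j) = cong ℤ.-_ (e j)
        to-S″ : ∀ h → ⟪ S′ ⟫ h → ⟪ S″ ⟫ (w ⁻¹ ∙ h ∙ w)
        to-S″ h h∈ = stab⇒∈ ω₁-facet (w ⁻¹ ∙ h ∙ w) (stab-conj⇐ {ω (suc zero)} w h
          (negated {ω zero} {ω (suc zero) ◃ proj₁ (w ⁻¹)} (proj₁ h) ω₀≗ (∈⇒stab ω-zero-facet {h} h∈)))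
        to-S′ : ∀ h → ⟪ S″ ⟫ h → ⟪ S′ ⟫ (w ∙ h ∙ w ⁻¹)
        to-S′ h h∈ = stab⇒∈ ω-zero-facet (w ∙ h ∙ w ⁻¹) (stab-conj⇐ {ω zero} (w ⁻¹) h
          (negated {ω (suc zero)} {ω zero ◃ proj₁ w} (proj₁ h) ω₁≗ (∈⇒stab ω₁-facet {h} h∈)))

    oddCase : ∀ J → OddCase J
    oddCase (b₀ ∷ b₁ ∷ T) with Fin.all? (λ i → i ∈? T)
    ... | no ¬all = let (i , i∉T) = Fin.¬∀⟶∃¬ m _ (λ i → i ∈? T) ¬all in flips (flip-inner i (λ { (there (there i∈)) → i∉T i∈ }))
    oddCase (true  ∷ true  ∷ T) | yes all = is-S (cong (λ T → true ∷ true ∷ T) (ones all))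
    oddCase (false ∷ true  ∷ T) | yes all = is-S′ (inj₁ (cong (λ T → false ∷ true ∷ T) (ones all)))
    oddCase (true  ∷ false ∷ T) | yes all = is-S′ (inj₂ (subst (_∼ S′) (cong (λ T → true ∷ false ∷ T) (sym (ones all))) S″∼S′))
    -- The first letter is a block by itself, and the other n - 1 letters, an even number, form the
    -- second block.
    oddCase (false ∷ false ∷ T) | yes all = flips (record
      { σ = topSign 1 ; even = trans (prod-topSign 1 n) odd-pred
      ; compatible = λ { zero () ; (suc zero) (there ()) ; (suc (suc k)) _ → inj₁ refl }
      ; k = zero ; i = suc zero ; k∉J = λ () ; σi = refl ; ωi = refl })

    -- W_{S′} is self-normalizing, as -1 is not in W.
    S′-odd : ¬ 2 ∣ β S′ S′
    S′-odd 2∣β = go (∣⇒normalizer {Among S′} (proj₂ size-W) prime[2] (size-β S′ S′) 2∣β)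
      where
      go : ¬ (∃[ y ] Normalizes (Among S′) y × ¬ ⟪ S′ ⟫ y × ⟪ S′ ⟫ (Powers._^ᴳ_ W y 2))
      go (y , norm , y∉ , _) = sign-cases _ refl
        where
        w = from (proj₁ y)
        u = ω zero ◃ proj₁ (y ⁻¹)
        wall : ∀ i → u (suc i) ≡ u (inject₁ i)
        wall i = ℤ.i-j≡0⇒i≡j _ _ (stab⇒pair≡0 (suc i) {u} (stab-cong {v = u} {generator (suc i)} {s (suc i)} (generator≈s (suc i)) (stab-conj⇒ {ω zero} y (generatorW (suc i))
          (∈⇒stab ω-zero-facet {y ⁻¹ ∙ generatorW (suc i) ∙ y} (norm (generatorW (suc i)) (simple∈ (suc i) (there ∈⊤)))))))
        constant : ∀ {k} (v : Vector (suc k)) → (∀ i → v (suc i) ≡ v (inject₁ i)) → ∀ i → v i ≡ v zero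
        constant v e zero = refl
        constant {suc k} v e (suc i) = trans (constant (v ∘ suc) (e ∘ suc) i) (e zero)
        same-sign : ∀ x y → ext (ω zero) x ≡ ext (ω zero) y → proj₁ x ≡ proj₁ y
        same-sign (Sign.+ , _) (Sign.+ , _) _ = refl
        same-sign (Sign.- , _) (Sign.- , _) _ = refl
        all-same : ∀ i → proj₁ (w (Sign.+ , i)) ≡ proj₁ (w (Sign.+ , zero))
        all-same i = same-sign (w (Sign.+ , i)) (w (Sign.+ , zero)) (constant u wall i)
        positive : ∀ x → proj₁ x ≡ Sign.+ → ext (ω zero) x ≡ 1ℤ
        positive (Sign.+ , _) refl = refl
        sign-cases : ∀ τ → proj₁ (w (Sign.+ , zero)) ≡ τ → ⊥
        sign-cases Sign.+ eq = y∉ (stab⇒∈ ω-zero-facet y (λ i → trans (sym (◃-cong {u = u} {v = ω zero} (λ j → positive (w (Sign.+ , j)) (trans (all-same j) eq)) (proj₁ y) i))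
          (◃-inv′ (ω zero) (proj₁ y) i)))
        sign-cases Sign.- eq = contradiction (trans (sym (∈W⇒even (proj₂ (y ⁻¹)))) (trans (SignΣ.sum-cong-≗ {n} (λ i → trans (all-same i) eq)) (trans (prod-minus n) odd))) λ ()

-- The table of marks modulo 2.

HasSize-singleton : ∀ {S m} → HasSize S m → (x : Setoid.Carrier S) → (∀ y → Setoid._≈_ S y x) → m ≡ 1
HasSize-singleton {S} size x contract = HasSize-unique size (record
  { to = λ _ → zero ; from = λ _ → x ; to-cong = λ _ → refl ; from-cong = λ _ → Setoid.refl S
  ; inverse = (λ { {zero} _ → refl }) , (λ {y} _ → Setoid.sym S (contract y)) })

module Transversal {m : ℕ} (2≤m : 2 ≤ m) {E : List (Subset (suc (suc m)))} (transversal : TypeD.IsTransversal (s≤s (s≤s 2≤m)) E) where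
  open SignChanges 2≤m public
  open Group W using (ε; _∙_; _⁻¹)

  ∼-refl : ∀ J → J ∼ J
  ∼-refl J = ε , (λ j j∈ → j , j∈ , λ _ → refl) , (λ k k∈ → k , k∈ , λ _ → refl)

  E-unique : ∀ {J K} → J ∈ E → K ∈ E → J ∼ K → J ≡ K
  E-unique {J} {K} J∈ K∈ J∼K = trans (sym (proj₂ (proj₂ (transversal J)) (J∈ , ∼-refl J))) (proj₂ (proj₂ (transversal J)) (K∈ , J∼K))

  -- For an index `k` outside K, W_K fixes `ω k`. Conjugating by `w`, all of W would fix `ω k ◃ w`
  -- and hence `ω k`, although s_k moves it.
  S∼⇒≡S : ∀ {K} → S ∼ K → K ≡ S
  S∼⇒≡S {K} (w , forth , _) = ⊆-antisym ⊆⊤ (λ {k} _ → member k (k ∈? K))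
    where
    member : ∀ k → Dec (k ∈ₛ K) → k ∈ₛ K
    member k (yes k∈) = k∈
    member k (no k∉) = contradiction (pair-ω-≡ k) (ℤ.<-irrefl (sym (stab⇒pair≡0 k {ω k} (stab-cong {v = ω k} {generator k} {s k} (generator≈s k) (everything k)))))
      where
      in-K : ∀ j → ⟪ K ⟫ (w ∙ generatorW j ∙ w ⁻¹)
      in-K j = gen (forth j ∈⊤)
      conj-stab : ∀ j → Stab (ω k ◃ proj₁ w) (generator j)
      conj-stab j = stab-conj⇒ {ω k} (w ⁻¹) (generatorW j) (⟪⟫-stab {K} {ω k} (λ i i∈ → stab-ω i k (λ { refl → k∉ i∈ })) {w ∙ generatorW j ∙ w ⁻¹} (in-K j))
      all-stab : ∀ g → Stab (ω k ◃ proj₁ w) (proj₁ g)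
      all-stab g = ⟪⟫-stab {S} {ω k ◃ proj₁ w} (λ j _ → stab-cong {v = ω k ◃ proj₁ w} {generator j} {s j} (generator≈s j) (conj-stab j)) {g}
        (everything∈ g)
      everything : ∀ j → Stab (ω k) (generator j)
      everything j i = trans (sym (u≗ω (to (generator j) (Sign.+ , i)))) (trans (all-stab (generatorW j) i) (u≗ω (Sign.+ , i)))
        where
        open SignedPerm
        u≗ω : ∀ x → ext (ω k ◃ proj₁ w) x ≡ ext (ω k) x
        u≗ω = ext-cong (λ i → trans (sym (all-stab (w ⁻¹) i)) (◃-inv (ω k) (proj₁ w) i))

  S∈E : S ∈ E
  S∈E = let (K , (K∈ , S∼K) , _) = transversal S in subst (_∈ E) (S∼⇒≡S S∼K) K∈

  β-S : ∀ K → β S K ≡ 1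
  β-S K = HasSize-singleton (size-β S K) (ε , λ g _ → everything∈ ((g ∙ ε) ⁻¹ ∙ ε)) (λ (x , _) → everything∈ (x ⁻¹ ∙ ε))

  prime∤1 : ∀ {p} → Prime p → p ∤ 1
  prime∤1 pp p∣1 = nonTrivial⇒≢1 {{prime⇒nonTrivial pp}} (∣1⇒≡1 p∣1)

  S-inF : ∀ {p} → Prime p → InF p E S
  S-inF {p} pp = S∈E , S , S∈E , λ p∣β → prime∤1 pp (subst (p ∣_) (β-S S) p∣β)

  module _ {p : ℕ} {K L : Subset n} where

    same⇒d : SameColumn p E K L → d p E K L ≡ 1
    same⇒d same = cong (if_then 1 else 0) (dec-true (sameColumn? p E K L) same)

    d⇒same : d p E K L ≡ 1 → SameColumn p E K L
    d⇒same eq with sameColumn? p E K L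
    ... | yes same = same

    d⇔ : ∀ {P : Set} → (SameColumn p E K L → P) → (P → SameColumn p E K L) → d p E K L ≡ 1 ⇔ P
    d⇔ f g = mk⇔ (f ∘ d⇒same) (same⇒d ∘ g)

  missing : ∀ {J} → J ≢ S → ∃[ k ] ¬ k ∈ₛ J
  missing {J} J≢S with Fin.all? (λ k → k ∈? J)
  ... | yes all = contradiction (⊆-antisym ⊆⊤ (λ {k} _ → all k)) J≢S
  ... | no ¬all = Fin.¬∀⟶∃¬ n _ (λ k → k ∈? J) ¬all

  _≟S_ : ∀ (J K : Subset n) → Dec (J ≡ K)
  _≟S_ = Vec.≡-dec Bool._≟_

  row-S : ∀ {p K L} → p ∣ ∣ β S K - β S L ∣
  row-S {p} {K} {L} = ≡mod⇒∣ (subst (λ a → a ≡ β S L [mod p ]) (trans (β-S L) (sym (β-S K))) ≡mod-refl)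

  module EvenRank (2∣n : 2 ∣ n) where

    even-row : ∀ {J} → J ≢ S → ∀ K → 2 ∣ β J K
    even-row J≢S = flip-row (flip-even 2∣n (missing J≢S))

    inF⇔ : ∀ L → InF 2 E L ⇔ L ≡ S
    inF⇔ L = mk⇔ (λ (_ , K , _ , odd) → only K odd (L ≟S S)) (λ { refl → S-inF prime[2] })
      where
      only : ∀ K → 2 ∤ β L K → Dec (L ≡ S) → L ≡ S
      only K odd (yes eq) = eq
      only K odd (no L≢S) = contradiction (even-row L≢S K) odd

    all-equal : ∀ K → d 2 E K S ≡ 1
    all-equal K = same⇒d {2} {K} {S} (All.tabulate (λ {J} _ → row J (J ≟S S)))
      where
      row : ∀ J → Dec (J ≡ S) → 2 ∣ ∣ β J K - β J S ∣
      row J (yes refl) = row-S {2} {K} {S}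
      row J (no J≢S) = ≡mod⇒∣ (∣∣⇒≡mod (even-row J≢S K) (even-row J≢S S))

  module OddRank (odd : 2 ∤ n) (S′∈E : S′ ∈ E) where

    S≢S′ : S ≢ S′
    S≢S′ ()

    data Kind (J : Subset n) : Set where
      whole  : J ≡ S → Kind J
      type-A : J ≡ S′ → Kind J
      flips  : J ≢ S → J ≢ S′ → Flip J → Kind J

    kind : ∀ {J} → J ∈ E → Kind J
    kind {J} J∈ = go (J ≟S S) (J ≟S S′) (oddCase odd J)
      where
      go : Dec (J ≡ S) → Dec (J ≡ S′) → OddCase odd J → Kind J
      go (yes eq) _ _ = whole eq
      go _ (yes eq) _ = type-A eq
      go _ _ (is-S eq) = whole eq
      go _ _ (is-S′ (inj₁ eq)) = type-A eq
      go _ _ (is-S′ (inj₂ J∼S′)) = type-A (E-unique J∈ S′∈E J∼S′)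
      go (no J≢S) (no J≢S′) (flips f) = flips J≢S J≢S′ f

    inF⇔ : ∀ L → InF 2 E L ⇔ (L ≡ S′ ⊎ L ≡ S)
    inF⇔ L = mk⇔ (λ (L∈ , K , _ , β-odd) → only K β-odd (kind L∈))
                 (λ { (inj₁ refl) → S′∈E , S′ , S′∈E , S′-odd odd ; (inj₂ refl) → S-inF prime[2] })
      where
      only : ∀ K → 2 ∤ β L K → Kind L → L ≡ S′ ⊎ L ≡ S
      only K β-odd (whole eq)    = inj₂ eq
      only K β-odd (type-A eq)   = inj₁ eq
      only K β-odd (flips _ _ f) = contradiction (flip-row f K) β-odd

    -- Together with `S′-odd` this describes the whole table modulo 2: row S is constantly 1, row S′
    -- is nonzero only in column S′, and all other rows vanish.
    column-even-unless : ∀ {K} → K ∈ E → K ≢ S′ → 2 ∣ β S′ K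
    column-even-unless {K} K∈ K≢S′ = go (kind K∈)
      where
      go : Kind K → 2 ∣ β S′ K
      go (whole refl)  = flip-S odd
      go (type-A eq)   = contradiction eq K≢S′
      go (flips _ _ f) = flip-column f

    same-S⇔ : ∀ {K} → K ∈ E → d 2 E K S ≡ 1 ⇔ ((S ≡ S × K ≢ S′) ⊎ (S ≡ S′ × K ≡ S′))
    same-S⇔ {K} K∈ = d⇔ {2} {K} {S}
      (λ same → inj₁ (refl , λ { refl → S′-odd odd (≡mod-∣ (≡mod-sym (∣⇒≡mod (All.lookup same S′∈E))) (flip-S odd)) }))
      [ (λ (_ , K≢S′) → All.tabulate (λ {J} J∈ → row K≢S′ (kind J∈))) , (λ (S≡S′ , _) → contradiction S≡S′ S≢S′) ]′
      where
      row : K ≢ S′ → ∀ {J} → Kind J → 2 ∣ ∣ β J K - β J S ∣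
      row K≢S′ (whole refl)      = row-S {2} {K} {S}
      row K≢S′ (type-A refl)     = ≡mod⇒∣ (∣∣⇒≡mod (column-even-unless K∈ K≢S′) (flip-S odd))
      row K≢S′ {J} (flips _ _ f) = ≡mod⇒∣ (∣∣⇒≡mod (flip-row f K) (flip-row f S))

    same-S′⇔ : ∀ {K} → K ∈ E → d 2 E K S′ ≡ 1 ⇔ ((S′ ≡ S × K ≢ S′) ⊎ (S′ ≡ S′ × K ≡ S′))
    same-S′⇔ {K} K∈ = d⇔ {2} {K} {S′} (λ same → inj₂ (refl , is-S′-if same (K ≟S S′)))
      [ (λ (S′≡S , _) → contradiction (sym S′≡S) S≢S′) , (λ { (_ , refl) → All.tabulate (λ {J} _ → ≡mod⇒∣ {a = β J S′} ≡mod-refl) }) ]′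
      where
      is-S′-if : SameColumn 2 E K S′ → Dec (K ≡ S′) → K ≡ S′
      is-S′-if same (yes eq)   = eq
      is-S′-if same (no K≢S′) = contradiction (≡mod-∣ (∣⇒≡mod (All.lookup same S′∈E)) (column-even-unless K∈ K≢S′)) (S′-odd odd)

    same⇔ : ∀ K L → K ∈ E → InF 2 E L → d 2 E K L ≡ 1 ⇔ ((L ≡ S × K ≢ S′) ⊎ (L ≡ S′ × K ≡ S′))
    same⇔ K L K∈ L∈F = go L (Equivalence.to (inF⇔ L) L∈F)
      where
      go : ∀ L → L ≡ S′ ⊎ L ≡ S → d 2 E K L ≡ 1 ⇔ ((L ≡ S × K ≢ S′) ⊎ (L ≡ S′ × K ≡ S′))
      go _ (inj₁ refl) = same-S′⇔ K∈
      go _ (inj₂ refl) = same-S⇔ K∈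

-- Conjugacy of Coxeter elements.

unique-resp-↭ : ∀ {A : Set} {xs ys : List A} → xs ↭ ys → Unique xs → Unique ys
unique-resp-↭ {A} e = SetoidPermₚ.Unique-resp-↭ (≡.setoid A) (Perm↭.↭⇒↭ₛ e)

-- Coxeter elements of a forest: all orders of the generators give conjugate products.  If each index k
-- has at most one neighbour above it, it is a leaf among the indices ≥ k.
module CoxeterOrders (G : Group 0ℓ 0ℓ) {n : ℕ} (g : Fin n → Group.Carrier G) (neighbour : Fin n → Fin n)
  (commute : ∀ {k x} → toℕ k < toℕ x → x ≢ neighbour k → Group._≈_ G (Group._∙_ G (g k) (g x)) (Group._∙_ G (g x) (g k))) where
  open Group G renaming (refl to ≈-refl; sym to ≈-sym; trans to ≈-trans)
  open Powers G

  productᴳ : List (Fin n) → Carrier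
  productᴳ js = foldr _∙_ ε (map g js)

  infix 4 _≋_
  -- A relation on words rather than on their products, since `leaf` proceeds by recursion on the
  -- moves.
  data _≋_ : List (Fin n) → List (Fin n) → Set where
    rotate : ∀ a r → a ∷ r ≋ r ++ a ∷ []
    swap   : ∀ xs {a b} ys → g a ∙ g b ≈ g b ∙ g a → xs ++ a ∷ b ∷ ys ≋ xs ++ b ∷ a ∷ ys
    ≋-refl : ∀ {l} → l ≋ l
    ≋-sym  : ∀ {l l′} → l ≋ l′ → l′ ≋ l
    ≋-trans : ∀ {l l′ l″} → l ≋ l′ → l′ ≋ l″ → l ≋ l″

  product-++ : ∀ xs ys → productᴳ (xs ++ ys) ≈ productᴳ xs ∙ productᴳ ys
  product-++ []       ys = ≈-sym (identityˡ _)
  product-++ (x ∷ xs) ys = ≈-trans (∙-congˡ (product-++ xs ys)) (≈-sym (assoc _ _ _))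

  ≋⇒conjugate : ∀ {l l′} → l ≋ l′ → Conjugate G (productᴳ l) (productᴳ l′)
  ≋⇒conjugate (rotate x r) = conj-trans (conj-∙ (g x) (productᴳ r))
    (conj-refl (≈-sym (≈-trans (product-++ r (x ∷ [])) (∙-congˡ (identityʳ (g x))))))
  ≋⇒conjugate (swap xs {x} {y} ys xy) = conj-refl (≈-trans (product-++ xs (x ∷ y ∷ ys))
    (≈-trans (∙-congˡ (≈-trans (≈-sym (assoc _ _ _)) (≈-trans (∙-congʳ xy) (assoc _ _ _)))) (≈-sym (product-++ xs (y ∷ x ∷ ys)))))
  ≋⇒conjugate ≋-refl = conj-refl ≈-refl
  ≋⇒conjugate (≋-sym e) = conj-sym (≋⇒conjugate e)
  ≋⇒conjugate (≋-trans e f) = conj-trans (≋⇒conjugate e) (≋⇒conjugate f)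

  ≋⇒↭ : ∀ {l l′} → l ≋ l′ → l ↭ l′
  ≋⇒↭ (rotate x r) = ↭-sym (subst (λ z → r ++ x ∷ [] ↭ x ∷ z) (++-identityʳ r) (↭ₚ.shift x r []))
  ≋⇒↭ (swap xs {x} {y} ys _) = ↭ₚ.++⁺ˡ xs (↭-swap x y ↭-refl)
  ≋⇒↭ ≋-refl = ↭-refl
  ≋⇒↭ (≋-sym e) = ↭-sym (≋⇒↭ e)
  ≋⇒↭ (≋-trans e f) = ↭-trans (≋⇒↭ e) (≋⇒↭ f)

  rotate-++ : ∀ xs ys → xs ++ ys ≋ ys ++ xs
  rotate-++ []       ys = subst (ys ≋_) (sym (++-identityʳ ys)) ≋-refl
  rotate-++ (x ∷ xs) ys = ≋-trans (rotate x (xs ++ ys))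
    (≋-trans (subst (_≋ (ys ++ x ∷ []) ++ xs) (sym (++-assoc xs ys (x ∷ []))) (rotate-++ xs (ys ++ x ∷ [])))
      (subst (_≋ ys ++ x ∷ xs) (sym (++-assoc ys (x ∷ []) xs)) ≋-refl))

  Above : Fin n → List (Fin n) → Set
  Above k l = All (λ x → toℕ k < toℕ x) l × Unique l

  above-↭ : ∀ {k l l′} → l ↭ l′ → Above k l → Above k l′
  above-↭ e (gt , uniq) = ↭ₚ.All-resp-↭ e gt , unique-resp-↭ e uniq

  bubble : ∀ k as xs ys → All (λ x → g k ∙ g x ≈ g x ∙ g k) xs → as ++ k ∷ xs ++ ys ≋ as ++ xs ++ k ∷ ys
  bubble k as []       ys _ = ≋-refl
  bubble k as (x ∷ xs) ys (kx ∷ kxs) = ≋-trans (swap as (xs ++ ys) kx)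
    (≡.subst₂ _≋_ (++-assoc as (x ∷ []) _) (++-assoc as (x ∷ []) _) (bubble k (as ++ x ∷ []) xs ys kxs))

  -- Both cases reach `a ∷ k ∷ r`, whose rotation is the target: by a swap if `a` commutes with `k`,
  -- and otherwise by rotating `k` to the end and moving it back through `r`, which no longer
  -- contains a neighbour of `k`.
  leaf-rotate : ∀ k a r → Above k (a ∷ r) → k ∷ a ∷ r ≋ k ∷ r ++ a ∷ []
  leaf-rotate k a r (gt ∷ gts , a∉ ∷ _) with a Fin.≟ neighbour k
  ... | no a≢ = ≋-trans (swap [] r (commute gt a≢)) (rotate a (k ∷ r))
  ... | yes refl = ≋-trans (rotate k (a ∷ r)) (≋-trans
        (≋-sym (subst (λ z → a ∷ k ∷ z ≋ a ∷ r ++ k ∷ []) (++-identityʳ r) (bubble k (a ∷ []) r [] (others gts a∉))))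
        (rotate a (k ∷ r)))
    where
    others : ∀ {r} → All (λ x → toℕ k < toℕ x) r → All (neighbour k ≢_) r → All (λ x → g k ∙ g x ≈ g x ∙ g k) r
    others []         []         = []
    others (gt ∷ gts) (ne ∷ nes) = commute gt (ne ∘ sym) ∷ others gts nes

  -- Moves between words in indices above `k` survive when `k` is put in front; only the rotation is
  -- not immediate.
  leaf : ∀ k {l l′} → Above k l → l ≋ l′ → k ∷ l ≋ k ∷ l′
  leaf k ab (rotate a r) = leaf-rotate k a r ab
  leaf k _ (swap xs ys xy) = swap (k ∷ xs) ys xy
  leaf k _ ≋-refl = ≋-refl
  leaf k ab (≋-sym e) = ≋-sym (leaf k (above-↭ (≋⇒↭ (≋-sym e)) ab) e)
  leaf k ab (≋-trans e f) = ≋-trans (leaf k ab e) (leaf k (above-↭ (≋⇒↭ e) ab) f)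

  private
    bring-to-front : ∀ {k l} → k ∈ l → ∃[ r ] l ≋ k ∷ r
    bring-to-front {k} k∈ with Memₚ.∈-∃++ k∈
    ... | xs , ys , refl = ys ++ xs , rotate-++ xs (k ∷ ys)

    -- Induction on the least admissible index d: if it occurs, it is rotated to the front of both
    -- words, the remaining words are related by induction, and `leaf` restores it.
    order : ∀ fuel d → d + fuel ≡ n → ∀ {l l′} → Unique l → All (λ x → d ≤ toℕ x) l → l ↭ l′ → l ≋ l′
    order zero d d≡n {[]} _ _ e = subst ([] ≋_) (sym (↭ₚ.↭-empty-inv (↭-sym e))) ≋-refl
    order zero d d≡n {x ∷ _} _ (d≤x ∷ _) _ = contradiction (≤-trans (≤-reflexive (trans (sym d≡n) (+-identityʳ d))) d≤x) (<⇒≱ (Fin.toℕ<n x))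
    order (suc fuel) d eq {l} {l′} uniq ge e = go (Any.any? (k Fin.≟_) l)
      where
      d<n : d < n
      d<n = subst (d <_) eq (m<m+n d z<s)
      k : Fin n
      k = fromℕ< d<n
      strict : ∀ {x} → d ≤ toℕ x → k ≢ x → suc d ≤ toℕ x
      strict d≤x k≢x = ≤∧≢⇒< d≤x (λ eq → k≢x (Fin.toℕ-injective (trans (Fin.toℕ-fromℕ< d<n) eq)))
      above : ∀ {r} → All (λ x → d ≤ toℕ x) r → All (k ≢_) r → All (λ x → suc d ≤ toℕ x) r
      above []         []         = []
      above (ge ∷ ges) (ne ∷ nes) = strict ge ne ∷ above ges nes
      go : Dec (k ∈ l) → l ≋ l′
      go (no k∉) = order fuel (suc d) (trans (sym (+-suc d fuel)) eq) uniq (above ge (¬Any⇒All¬ l k∉)) e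
      go (yes k∈) = combine (bring-to-front k∈) (bring-to-front (↭ₚ.∈-resp-↭ e k∈))
        where
        combine : ∃[ r ] l ≋ k ∷ r → ∃[ r ] l′ ≋ k ∷ r → l ≋ l′
        combine (r , l≋) (r′ , l′≋) = split (unique-resp-↭ (≋⇒↭ l≋) uniq) (↭ₚ.All-resp-↭ (≋⇒↭ l≋) ge)
          where
          split : Unique (k ∷ r) → All (λ x → d ≤ toℕ x) (k ∷ r) → l ≋ l′
          split (k∉r ∷ r!) (_ ∷ ges) = ≋-trans l≋ (≋-trans
            (leaf k (All.map (λ {x} lt → subst (_< toℕ x) (sym (Fin.toℕ-fromℕ< d<n)) lt) (above ges k∉r) , r!)
              (order fuel (suc d) (trans (sym (+-suc d fuel)) eq) r! (above ges k∉r)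
                (↭ₚ.drop-∷ (↭-trans (↭-sym (≋⇒↭ l≋)) (↭-trans e (≋⇒↭ l′≋))))))
            (≋-sym l′≋))

  orders-conjugate : ∀ {l l′} → Unique l → l ↭ l′ → Conjugate G (productᴳ l) (productᴳ l′)
  orders-conjugate uniq e = ≋⇒conjugate (order n 0 refl uniq (All.universal (λ _ → z≤n) _) e)

unique-members⇒↭ : ∀ {A : Set} {xs ys : List A} → Unique xs → Unique ys → (∀ x → x ∈ xs → x ∈ ys) → (∀ x → x ∈ ys → x ∈ xs) → xs ↭ ys
unique-members⇒↭ {xs = []} {[]} _ _ _ _ = ↭-refl
unique-members⇒↭ {xs = []} {y ∷ ys} _ _ _ ⊇ = contradiction (⊇ y (here refl)) λ ()
unique-members⇒↭ {xs = x ∷ xs} {ys} (x∉ ∷ xs!) ys! ⊆ ⊇ with Memₚ.∈-∃++ (⊆ x (here refl))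
... | as , bs , refl = go (unique-resp-↭ e ys!)
  where
  e : as ++ x ∷ bs ↭ x ∷ as ++ bs
  e = ↭ₚ.shift x as bs
  go : Unique (x ∷ as ++ bs) → x ∷ xs ↭ as ++ x ∷ bs
  go (x∉′ ∷ rest!) = ↭-trans (↭-prep x (unique-members⇒↭ xs! rest!
    (λ z z∈ → tail-of (All.lookup x∉ z∈) (↭ₚ.∈-resp-↭ e (⊆ z (there z∈))))
    (λ z z∈ → tail-of (All.lookup x∉′ z∈) (⊇ z (↭ₚ.∈-resp-↭ (↭-sym e) (there z∈)))))) (↭-sym e)
    where
    tail-of : ∀ {z l} → x ≢ z → z ∈ x ∷ l → z ∈ l
    tail-of x≢z (here z≡x) = contradiction (sym z≡x) x≢z
    tail-of x≢z (there z∈) = z∈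

module CoxeterClasses {m : ℕ} (2≤m : 2 ≤ m) where
  open SignedPerm
  open SignChanges 2≤m public
  open Group W using (Carrier; _≈_; _∙_; ε; _⁻¹; ∙-cong; ∙-congˡ; ∙-congʳ)
  open GroupSolver W

  ≗-trans : {f g h : Letter n → Letter n} → f ≗ g → g ≗ h → f ≗ h
  ≗-trans e e′ z = trans (e z) (e′ z)

  ≗-sym : {f g : Letter n → Letter n} → f ≗ g → g ≗ f
  ≗-sym e z = sym (e z)

  private
    -- The Dynkin diagram: u is joined to s₂, and sᵢ to sᵢ₊₁. The last index has no neighbour above
    -- it and gets the default `zero`, which is never compared with a larger index.
    neighbour : Fin n → Fin n
    neighbour zero = fromℕ< {2} (s≤s (s≤s (<⇒≤ 2≤m)))
    neighbour (suc i) with suc (suc (toℕ i)) <? n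
    ... | yes lt = fromℕ< lt
    ... | no _   = zero

    neighbour-suc : ∀ i (x : Fin n) → toℕ x ≡ suc (suc (toℕ i)) → x ≡ neighbour (suc i)
    neighbour-suc i x eq with suc (suc (toℕ i)) <? n
    ... | yes lt = Fin.toℕ-injective (trans eq (sym (Fin.toℕ-fromℕ< lt)))
    ... | no ¬lt = contradiction (subst (_< n) eq (Fin.toℕ<n x)) ¬lt

    toℕ-≢ : ∀ {k} {i j : Fin k} → toℕ i < toℕ j → j ≢ i
    toℕ-≢ lt refl = n≮n _ lt

    fixes-ends : ∀ {k x} → toℕ (proj₂ (hi k)) < toℕ (proj₂ (lo x)) → toℕ (proj₂ (lo k)) < toℕ (proj₂ (lo x)) → toℕ (proj₂ (lo x)) < toℕ (proj₂ (hi x)) →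
                 to (s k) (hi x) ≡ hi x × to (s k) (lo x) ≡ lo x
    fixes-ends {k} {x} h<l l<l l<h = s-other k (hi x) (toℕ-≢ (<-trans h<l l<h)) (toℕ-≢ (<-trans l<l l<h))
                                   , s-other k (lo x) (toℕ-≢ h<l) (toℕ-≢ l<l)

    ends : ∀ {k x} → toℕ k < toℕ x → x ≢ neighbour k →
           (to (s k) (hi x) ≡ hi x × to (s k) (lo x) ≡ lo x) ⊎ (to (s k) (hi x) ≡ neg (lo x) × to (s k) (lo x) ≡ neg (hi x))
    -- u and s₁ move the same letters and still commute: u carries the simple root of s₁ to itself,
    -- read off from the negated letters.
    ends {zero} {suc zero} _ _ = inj₂ (refl , refl)
    ends {zero} {suc (suc zero)} _ x≢ = contradiction (Fin.toℕ-injective (sym (Fin.toℕ-fromℕ< (s≤s (s≤s (<⇒≤ 2≤m)))))) x≢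
    ends {zero} {suc (suc (suc i))} _ _ = inj₁ (fixes-ends {zero} {suc (suc (suc i))} (s≤s (s≤s z≤n)) z<s (s≤s (s≤s (≤-reflexive (cong suc (Fin.toℕ-inject₁ i))))))
    ends {suc i} {suc j} lt x≢ = inj₁ (fixes-ends {suc i} {suc j} i+1<j (subst (_< toℕ (inject₁ j)) (sym (Fin.toℕ-inject₁ i)) (<-trans (n<1+n (toℕ i)) i+1<j))
        (s≤s (≤-reflexive (Fin.toℕ-inject₁ j))))
      where
      i+1<j : suc (toℕ i) < toℕ (inject₁ j)
      i+1<j = subst (suc (toℕ i) <_) (sym (Fin.toℕ-inject₁ j))
        (≤∧≢⇒< (≤-pred lt) (λ eq → x≢ (neighbour-suc i (suc j) (cong suc (sym eq)))))

    commute : ∀ {k x} → toℕ k < toℕ x → x ≢ neighbour k → generatorW k ∙ generatorW x ≈ generatorW x ∙ generatorW k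
    commute {k} {x} lt x≢ z = trans (trans (generator≈s k _) (cong (to (s k)) (generator≈s x z)))
      (trans (conjugate-simple (s k) x x (ends lt x≢) z) (sym (trans (generator≈s x _) (cong (to (s x)) (generator≈s k z)))))

  module Orders = CoxeterOrders W generatorW neighbour commute

  coxeter-conjugate : ∀ {K v w} → IsCoxeterElement K v → IsCoxeterElement K w → Conjugate W v w
  coxeter-conjugate {K} {v} {w} (js , js! , mem , e) (ks , ks! , mem′ , e′) =
    conj-trans {v} {Orders.productᴳ js} {w} (conj-refl {v} {Orders.productᴳ js} e) (conj-trans {Orders.productᴳ js} {Orders.productᴳ ks} {w}
      (Orders.orders-conjugate js! (unique-members⇒↭ js! ks!
        (λ x x∈ → Equivalence.from (mem′ x) (Equivalence.to (mem x) x∈)) (λ x x∈ → Equivalence.from (mem x) (Equivalence.to (mem′ x) x∈))))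
      (conj-refl {Orders.productᴳ ks} {w} (≗-sym e′)))

  generator-injective : ∀ {j k} → generatorW j ≈ generatorW k → j ≡ k
  generator-injective {j} {k} e with j Fin.≟ k
  ... | yes eq = eq
  ... | no j≢k = contradiction (pair-ω-≡ k) (ℤ.<-irrefl (sym (stab⇒pair≡0 k {ω k}
        (stab-cong {v = ω k} {s j} {s k} (λ x → trans (sym (generator≈s j x)) (trans (e x) (generator≈s k x))) (stab-ω j k j≢k)))))

  -- Stated for an injective endomorphism matching the generators of L and K, to cover both
  -- conjugation by an element of W and `twist`.
  module Transfer (f : Carrier → Carrier) (f-cong : ∀ {x y} → x ≈ y → f x ≈ f y) (f-injective : ∀ {x y} → f x ≈ f y → x ≈ y)
                  (f-ε : f ε ≈ ε) (f-∙ : ∀ x y → f (x ∙ y) ≈ f x ∙ f y)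
                  {L K : Subset n} (forth : ∀ j → j ∈ₛ L → Among K (f (generatorW j)))
                  (back : ∀ k → k ∈ₛ K → ∃[ j ] j ∈ₛ L × f (generatorW j) ≈ generatorW k) where

    private
      Image : Fin n → Fin n → Set
      Image j k = k ∈ₛ K × f (generatorW j) ≈ generatorW k

      images : ∀ js → All (_∈ₛ L) js → ∃[ ks ] Pointwise Image js ks
      images []       []         = [] , []
      images (j ∷ js) (j∈ ∷ js∈) = let (k , k∈ , e) = forth j j∈ ; (ks , es) = images js js∈ in k ∷ ks , (k∈ , e) ∷ es

      image-product : ∀ {js ks} → Pointwise Image js ks → f (foldr _∙_ ε (map generatorW js)) ≈ foldr _∙_ ε (map generatorW ks)
      image-product [] = f-ε
      image-product {j ∷ js} {k ∷ ks} ((_ , e) ∷ es) =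
        ≗-trans (f-∙ (generatorW j) productJ)
          (∙-cong {f (generatorW j)} {generatorW k} {f productJ} {foldr _∙_ ε (map generatorW ks)} e (image-product es))
        where productJ = foldr _∙_ ε (map generatorW js)

      image-≢ : ∀ {j k js ks} → Image j k → Pointwise Image js ks → All (j ≢_) js → All (k ≢_) ks
      image-≢ _ [] [] = []
      image-≢ {j} {k} {j′ ∷ _} {k′ ∷ _} im@(_ , e) ((_ , e′) ∷ es) (ne ∷ nes) =
        (λ { refl → ne (generator-injective (f-injective {generatorW j} {generatorW j′} (≗-trans e (≗-sym e′)))) })
        ∷ image-≢ im es nes

      image-unique : ∀ {js ks} → Pointwise Image js ks → Unique js → Unique ks
      image-unique [] [] = []
      image-unique (im ∷ es) (j∉ ∷ js!) = image-≢ im es j∉ ∷ image-unique es js!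

      image-of : ∀ {j js ks} → Pointwise Image js ks → j ∈ js → ∃[ k ] k ∈ ks × Image j k
      image-of (im ∷ es) (here refl) = _ , here refl , im
      image-of (im ∷ es) (there j∈) = let (k , k∈ , im′) = image-of es j∈ in k , there k∈ , im′

      image-∈ : ∀ {k js ks} → Pointwise Image js ks → k ∈ ks → k ∈ₛ K
      image-∈ ((k∈ , _) ∷ _) (here refl) = k∈
      image-∈ (_ ∷ es) (there k∈) = image-∈ es k∈

    transfer : ∀ {c} → IsCoxeterElement L c → IsCoxeterElement K (f c)
    transfer {c} (js , js! , mem , e) = finish (images js (All.tabulate (λ {j} j∈ → Equivalence.to (mem j) j∈)))
      where
      finish : ∃[ ks ] Pointwise Image js ks → IsCoxeterElement K (f c)
      finish (ks , es) = ks , image-unique es js! , (λ k → mk⇔ (image-∈ es) (covered k))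
        , ≗-trans (f-cong {c} {foldr _∙_ ε (map generatorW js)} e) (image-product es)
        where
        covered : ∀ k → k ∈ₛ K → k ∈ ks
        covered k k∈ = let (j , j∈ , e) = back k k∈ ; (k′ , k′∈ , (_ , e′)) = image-of es (Equivalence.from (mem j) j∈)
          in subst (_∈ ks) (generator-injective (≗-trans (≗-sym e′) e)) k′∈

  ∼⇒coxeter-conjugate : ∀ {L K v w} → L ∼ K → IsCoxeterElement L v → IsCoxeterElement K w → Conjugate W v w
  ∼⇒coxeter-conjugate {L} {K} {v} {w} (x , forth , back) coxL coxK = conj-trans {v} {x ∙ v ∙ x ⁻¹} {w} (x , λ _ → refl)
    (coxeter-conjugate {K} {x ∙ v ∙ x ⁻¹} {w} (Transfer.transfer (λ y → x ∙ y ∙ x ⁻¹)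
      (λ {y} {z} e u → cong (to (proj₁ x)) (e (from (proj₁ x) u)))
      (λ {y} {z} e → ≗-trans (group-solve (x ∷ y ∷ x ∷ x ∷ []) b (ι a ⊕ (a ⊕ b ⊕ ι a) ⊕ a) refl)
        (≗-trans (λ u → cong (from (proj₁ x)) (e (to (proj₁ x) u)))
          (group-solve (x ∷ z ∷ x ∷ x ∷ []) (ι a ⊕ (a ⊕ b ⊕ ι a) ⊕ a) b refl)))
      (group-solve (x ∷ x ∷ x ∷ x ∷ []) (a ⊕ 𝟙 ⊕ ι a) 𝟙 refl)
      (λ y z → group-solve (x ∷ y ∷ z ∷ x ∷ []) (a ⊕ (b ⊕ c) ⊕ ι a) ((a ⊕ b ⊕ ι a) ⊕ (a ⊕ c ⊕ ι a)) refl)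
      {L} {K} forth back {v} coxL) coxK)

-- The diagram automorphism exchanging u and s₁.

module Twist {m : ℕ} (2≤m : 2 ≤ m) where
  open SignedPerm
  open CoxeterClasses 2≤m public
  open Group W using (Carrier; _≈_; _∙_; ε; _⁻¹; ∙-congˡ)

  -- Conjugation by the sign change τ of the first letter, which is not in W, exchanges u and s₁.
  exchange : Fin n → Fin n
  exchange zero          = suc zero
  exchange (suc zero)    = zero
  exchange (suc (suc i)) = suc (suc i)

  abstract
    τ : SignedPerm n
    τ = signChange (λ { zero → Sign.- ; (suc _) → Sign.+ })

    τ-involutive : ∀ x → to τ (to τ x) ≡ x
    τ-involutive (σ , zero)  = cong (_, zero) (Sign.opposite-selfInverse refl)
    τ-involutive (σ , suc i) = refl

    τ-ends : ∀ j → to τ (hi j) ≡ hi (exchange j) × to τ (lo j) ≡ lo (exchange j)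
    τ-ends zero          = refl , refl
    τ-ends (suc zero)    = refl , refl
    τ-ends (suc (suc i)) = refl , refl

  exchange-involutive : ∀ j → exchange (exchange j) ≡ j
  exchange-involutive zero          = refl
  exchange-involutive (suc zero)    = refl
  exchange-involutive (suc (suc i)) = refl

  exchangeₛ : Subset n → Subset n
  exchangeₛ (b₀ ∷ b₁ ∷ T) = b₁ ∷ b₀ ∷ T

  exchange-∈ : ∀ J j → j ∈ₛ J → exchange j ∈ₛ exchangeₛ J
  exchange-∈ (_ ∷ _ ∷ _) zero          here              = there here
  exchange-∈ (_ ∷ _ ∷ _) (suc zero)    (there here)      = here
  exchange-∈ (_ ∷ _ ∷ _) (suc (suc j)) (there (there j∈)) = there (there j∈)

  exchangeₛ-involutive : ∀ J → exchangeₛ (exchangeₛ J) ≡ J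
  exchangeₛ-involutive (_ ∷ _ ∷ _) = refl

  -- Carries a subset with u but without s₁ to a subset of S′, where Coxeter elements are unsigned
  -- permutations.
  twist : Carrier → Carrier
  twist (w , w∈) = τ ∘ₛ (w ∘ₛ τ) , even⇒∈W (τ ∘ₛ (w ∘ₛ τ))
    (trans (sgn-∘ τ (w ∘ₛ τ)) (trans (cong (sgn τ Sign.*_) (sgn-∘ w τ)) (square (sgn τ) (sgn w) (∈W⇒even w∈))))
    where
    square : ∀ a b → b ≡ Sign.+ → a Sign.* (b Sign.* a) ≡ Sign.+
    square Sign.+ Sign.+ _ = refl
    square Sign.- Sign.+ _ = refl

  twist-cong : ∀ {x y} → x ≈ y → twist x ≈ twist y
  twist-cong e z = cong (to τ) (e (to τ z))

  twist-involutive : ∀ x → twist (twist x) ≈ x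
  twist-involutive x z = trans (τ-involutive _) (cong (to (proj₁ x)) (τ-involutive z))

  twist-∙ : ∀ x y → twist (x ∙ y) ≈ twist x ∙ twist y
  twist-∙ x y z = cong (to τ ∘ to (proj₁ x)) (sym (τ-involutive _))

  to-τ : ∀ y → to τ y ≡ from τ y
  to-τ y = trans (sym (strictlyInverseʳ τ (to τ y))) (cong (from τ) (τ-involutive y))

  twist-⁻¹ : ∀ x → twist (x ⁻¹) ≈ twist x ⁻¹
  twist-⁻¹ x z = trans (to-τ _) (cong (from τ ∘ from (proj₁ x)) (to-τ z))

  twist-generator : ∀ j → twist (generatorW j) ≈ generatorW (exchange j)
  twist-generator j z = trans (cong (to τ) (generator≈s j (to τ z)))
    (trans (conjugate-simple τ j (exchange j) (inj₁ (τ-ends j)) (to τ z)) (trans (cong (to (s (exchange j))) (τ-involutive z)) (sym (generator≈s (exchange j) z))))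

  twist-coxeter : ∀ {K v} → IsCoxeterElement K v → IsCoxeterElement (exchangeₛ K) (twist v)
  twist-coxeter {K} {v} = Transfer.transfer twist (λ {x} {y} → twist-cong {x} {y})
    (λ {x} {y} e → ≗-trans (≗-sym (twist-involutive x)) (≗-trans (twist-cong {twist x} {twist y} e) (twist-involutive y)))
    τ-involutive twist-∙ {K} {exchangeₛ K}
    (λ j j∈ → exchange j , exchange-∈ K j j∈ , twist-generator j)
    (λ k k∈ → exchange k , subst (exchange k ∈ₛ_) (exchangeₛ-involutive K) (exchange-∈ (exchangeₛ K) k k∈)
            , subst (λ i → twist (generatorW (exchange k)) ≈ generatorW i) (exchange-involutive k) (twist-generator (exchange k))) {v}

  twist-∈ : ∀ {J} {x} → ⟪ J ⟫ x → ⟪ exchangeₛ J ⟫ (twist x)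
  twist-∈ {J} {x} (gen (j , j∈ , e)) = gen (exchange j , exchange-∈ J j j∈ , ≗-trans (twist-cong {x} {generatorW j} e) (twist-generator j))
  twist-∈ unit = resp {x = ε} {y = twist ε} (λ z → sym (τ-involutive z)) unit
  twist-∈ (mul {x} {y} p q) = resp {x = twist x ∙ twist y} {y = twist (x ∙ y)} (≗-sym (twist-∙ x y)) (mul {x = twist x} {y = twist y} (twist-∈ p) (twist-∈ q))
  twist-∈ (inv {x} p) = resp {x = twist x ⁻¹} {y = twist (x ⁻¹)} (≗-sym (twist-⁻¹ x)) (inv {x = twist x} (twist-∈ p))
  twist-∈ (resp {x} {y} e p) = resp {x = twist x} {y = twist y} (twist-cong {x} {y} e) (twist-∈ p)

  twist-conjugate : ∀ {x y} → Conjugate W x y → Conjugate W (twist x) (twist y)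
  twist-conjugate {x} {y} (g , e) = twist g , λ z → untwisted z (from (proj₁ g) (from τ z)) refl
    where
    untwisted : ∀ z w → w ≡ from (proj₁ g) (from τ z) →
                to τ (to (proj₁ g) (to τ (to τ (to (proj₁ x) (to τ (from τ w)))))) ≡ to τ (to (proj₁ y) (to τ z))
    untwisted z w refl = trans (cong (λ v → to τ (to (proj₁ g) v)) (τ-involutive _))
      (trans (cong (λ v → to τ (to (proj₁ g) (to (proj₁ x) v))) (strictlyInverseˡ τ w))
        (trans (cong (to τ) (e (from τ z))) (cong (λ v → to τ (to (proj₁ y) v)) (sym (to-τ z)))))

  twist-pow : ∀ x k → twist (x ^ᴳ k) ≈ twist x ^ᴳ k
  twist-pow x zero    = τ-involutive
  twist-pow x (suc k) = ≗-trans (twist-∙ x (x ^ᴳ k))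
    (∙-congˡ {twist x} {twist (x ^ᴳ k)} {twist x ^ᴳ k} (twist-pow x k))

  twist-powerConjugate : ∀ {p x y} → PowerConjugate p x y → PowerConjugate p (twist x) (twist y)
  twist-powerConjugate {p} {x} {y} (k , e) = k , go (p ^ k) e
    where
    go : ∀ N → Conjugate W (x ^ᴳ N) (y ^ᴳ N) → Conjugate W (twist x ^ᴳ N) (twist y ^ᴳ N)
    go N e = conj-trans {twist x ^ᴳ N} {twist (x ^ᴳ N)} {twist y ^ᴳ N}
      (conj-refl {twist x ^ᴳ N} {twist (x ^ᴳ N)} (≗-sym (twist-pow x N)))
      (conj-trans {twist (x ^ᴳ N)} {twist (y ^ᴳ N)} {twist y ^ᴳ N} (twist-conjugate {x ^ᴳ N} {y ^ᴳ N} e)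
        (conj-refl {twist (y ^ᴳ N)} {twist y ^ᴳ N} (twist-pow y N)))

  -- By Cauchy's theorem, p divides the order of N(W_J)/W_J if and only if such an element exists.
  Normalizer-element : ℕ → Subset n → Set
  Normalizer-element p J = ∃[ y ] Normalizes (Among J) y × ¬ ⟪ J ⟫ y × ⟪ J ⟫ (y ^ᴳ p)

  twist-normalizer : ∀ {p J} → Normalizer-element p J → Normalizer-element p (exchangeₛ J)
  twist-normalizer {p} {J} (y , norm , y∉ , yᵖ∈) = twist y , norm′ , y∉′ , resp {x = twist (y ^ᴳ p)} {y = twist y ^ᴳ p} (twist-pow y p) (twist-∈ {J} {y ^ᴳ p} yᵖ∈)
    where
    untwist : ∀ {x} → ⟪ exchangeₛ J ⟫ x → ⟪ J ⟫ (twist x)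
    untwist {x} x∈ = subst (λ J → ⟪ J ⟫ (twist x)) (exchangeₛ-involutive J) (twist-∈ {exchangeₛ J} {x} x∈)
    y∉′ : ¬ ⟪ exchangeₛ J ⟫ (twist y)
    y∉′ y∈ = y∉ (resp {x = twist (twist y)} {y = y} (twist-involutive y) (untwist {twist y} y∈))
    norm′ : Normalizes (Among (exchangeₛ J)) (twist y)
    norm′ h h∈ = resp {x = twist (y ⁻¹ ∙ twist h ∙ y)} {y = twist y ⁻¹ ∙ h ∙ twist y}
      (λ z → trans (to-τ _) (cong (from τ ∘ from (proj₁ y)) (to-τ _)))
      (twist-∈ {J} {y ⁻¹ ∙ twist h ∙ y} (norm (twist h) (untwist {h} h∈)))

-- Cycle types and merging of cycles under prime powers.

Intertwines : ∀ {X Y : Set} → X ↔ Y → (X → X) → (Y → Y) → Set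
Intertwines π f g = ∀ x → Inverse.to π (f x) ≡ g (Inverse.to π x)

infix 4 _≅_
-- Conjugacy of self-maps of different sets, so that cycle types can be compared without naming
-- cycle lengths.
record _≅_ {X Y : Set} (f : X → X) (g : Y → Y) : Set where
  constructor _,_
  field
    bijection   : X ↔ Y
    intertwines : Intertwines bijection f g

infixl 9 _^∘_
_^∘_ : ∀ {X : Set} → (X → X) → ℕ → X → X
(f ^∘ N) x = fold x f N

^∘-* : ∀ {X : Set} (f : X → X) m k → f ^∘ (m * k) ≗ (f ^∘ k) ^∘ m
^∘-* f zero    k x = refl
^∘-* f (suc m) k x = trans (fold-+ x f k) (cong (λ y → fold y f k) (^∘-* f m k x))

≗⇒≅ : ∀ {X : Set} {f g : X → X} → f ≗ g → f ≅ g
≗⇒≅ e = mk↔ₛ′ id id (λ _ → refl) (λ _ → refl) , e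

≅-sym : ∀ {X Y : Set} {f : X → X} {g : Y → Y} → f ≅ g → g ≅ f
≅-sym {f = f} {g} (π , e) = Symm.inverse π , λ y → trans (cong (Inverse.from π) (trans (cong g (sym (Inverse.strictlyInverseˡ π y))) (sym (e (Inverse.from π y)))))
  (Inverse.strictlyInverseʳ π (f (Inverse.from π y)))

≅-trans : ∀ {X Y Z : Set} {f : X → X} {g : Y → Y} {h : Z → Z} → f ≅ g → g ≅ h → f ≅ h
≅-trans (π , e) (π′ , e′) = Comp.inverse π π′ , λ x → trans (cong (Inverse.to π′) (e x)) (e′ (Inverse.to π x))

≅-^∘ : ∀ {X Y : Set} {f : X → X} {g : Y → Y} N → f ≅ g → f ^∘ N ≅ g ^∘ N
≅-^∘ {f = f} {g} N (π , e) = π , go N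
  where
  go : ∀ N → Intertwines π (f ^∘ N) (g ^∘ N)
  go zero    x = refl
  go (suc N) x = trans (e (fold x f N)) (cong g (go N x))

≅-⊎ : ∀ {X Y X′ Y′ : Set} {f : X → X} {g : Y → Y} {f′ : X′ → X′} {g′ : Y′ → Y′} → f ≅ f′ → g ≅ g′ → Sum⊎.map f g ≅ Sum⊎.map f′ g′
≅-⊎ (π , e) (π′ , e′) = (π ⊎-↔ π′) , λ { (inj₁ x) → cong inj₁ (e x) ; (inj₂ y) → cong inj₂ (e′ y) }

map-^∘ : ∀ {X Y : Set} (f : X → X) (g : Y → Y) N → Sum⊎.map f g ^∘ N ≗ Sum⊎.map (f ^∘ N) (g ^∘ N)
map-^∘ f g zero    (inj₁ x) = refl
map-^∘ f g zero    (inj₂ y) = refl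
map-^∘ f g (suc N) (inj₁ x) = cong (Sum⊎.map f g) (map-^∘ f g N (inj₁ x))
map-^∘ f g (suc N) (inj₂ y) = cong (Sum⊎.map f g) (map-^∘ f g N (inj₂ y))

copies : ∀ {X : Set} q → (X → X) → Fin q × X → Fin q × X
copies q f (i , x) = i , f x

copies-^∘ : ∀ {X : Set} q (f : X → X) N → copies q f ^∘ N ≗ copies q (f ^∘ N)
copies-^∘ q f zero    x = refl
copies-^∘ q f (suc N) x = cong (copies q f) (copies-^∘ q f N x)

≅-copies : ∀ {X Y : Set} {f : X → X} {g : Y → Y} q → f ≅ g → copies q f ≅ copies q g
≅-copies q (π , e) = mk↔ₛ′ (λ (i , x) → i , Inverse.to π x) (λ (i , y) → i , Inverse.from π y)
    (λ (i , y) → cong (i ,_) (Inverse.strictlyInverseˡ π y)) (λ (i , x) → cong (i ,_) (Inverse.strictlyInverseʳ π x))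
  , λ (i , x) → cong (i ,_) (e x)

-- The transposition of 0 and 1 applied to the successor of the argument. It turns a cycle on l + 1
-- points into one on l + 2 points, in the same recursive form as `cyc`.
lengthen : ∀ {l} → Fin (suc l) → Fin (suc (suc l))
lengthen zero    = zero
lengthen (suc k) = suc (suc k)

rot : ∀ {l} → Fin (suc l) → Fin (suc l)
rot {zero}  zero    = zero
rot {suc l} zero    = suc zero
rot {suc l} (suc j) = lengthen (rot j)

rot-< : ∀ {l} (i : Fin (suc l)) → toℕ i < l → toℕ (rot i) ≡ suc (toℕ i)
rot-< {suc l} zero    _         = refl
rot-< {suc l} (suc j) (s≤s j<l) = go (rot j) (rot-< j j<l)
  where
  go : ∀ k → toℕ k ≡ suc (toℕ j) → toℕ (lengthen k) ≡ suc (suc (toℕ j))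
  go (suc k) eq = cong suc eq

rot-≡ : ∀ {l} (i : Fin (suc l)) → toℕ i ≡ l → rot i ≡ zero
rot-≡ {zero}  zero    _  = refl
rot-≡ {suc l} (suc j) eq = cong lengthen (rot-≡ j (suc-injective eq))

toℕ-rot : ∀ {l} (i : Fin (suc l)) → toℕ (rot i) ≡ suc (toℕ i) % suc l
toℕ-rot {l} i with m≤n⇒m<n∨m≡n (≤-pred (Fin.toℕ<n i))
... | inj₁ i<l = trans (rot-< i i<l) (sym (m<n⇒m%n≡m (s≤s i<l)))
... | inj₂ i≡l = trans (cong toℕ (rot-≡ i i≡l)) (sym (trans (cong (λ z → suc z % suc l) i≡l) (n%n≡0 (suc l))))

module _ (j : ℕ) .{{_ : NonZero j}} where

  [a+b%j]%j : ∀ a b → (a + b % j) % j ≡ (a + b) % j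
  [a+b%j]%j a b = trans (%-distribˡ-+ a (b % j) j) (trans (cong (λ z → (a % j + z) % j) (m%n%n≡m%n b j)) (sym (%-distribˡ-+ a b j)))

  [a*b%j]%j : ∀ a b → (a * (b % j)) % j ≡ (a * b) % j
  [a*b%j]%j a b = trans (%-distribˡ-* a (b % j) j) (trans (cong (λ z → ((a % j) * z) % j) (m%n%n≡m%n b j)) (sym (%-distribˡ-* a b j)))

toℕ-rot^ : ∀ {l} N (i : Fin (suc l)) → toℕ ((rot ^∘ N) i) ≡ (N + toℕ i) % suc l
toℕ-rot^ {l} zero    i = sym (m<n⇒m%n≡m (Fin.toℕ<n i))
toℕ-rot^ {l} (suc N) i = trans (toℕ-rot ((rot ^∘ N) i)) (trans (cong (λ z → suc z % suc l) (toℕ-rot^ N i)) ([a+b%j]%j (suc l) 1 (N + toℕ i)))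

multiply : ∀ {l} → ℕ → Fin (suc l) → Fin (suc l)
multiply {l} u x = fromℕ< (m%n<n (u * toℕ x) (suc l))

toℕ-multiply : ∀ {l} u (x : Fin (suc l)) → toℕ (multiply u x) ≡ (u * toℕ x) % suc l
toℕ-multiply {l} u x = Fin.toℕ-fromℕ< (m%n<n (u * toℕ x) (suc l))

multiply-inverse : ∀ {l u t q} → t * u ≡ 1 + suc l * q → ∀ (x : Fin (suc l)) → multiply t (multiply u x) ≡ x
multiply-inverse {l} {u} {t} {q} eq x = Fin.toℕ-injective (begin
  toℕ (multiply t (multiply u x))       ≡⟨ trans (toℕ-multiply t (multiply u x)) (cong (λ z → (t * z) % suc l) (toℕ-multiply u x)) ⟩
  (t * ((u * toℕ x) % suc l)) % suc l   ≡⟨ [a*b%j]%j (suc l) t (u * toℕ x) ⟩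
  (t * (u * toℕ x)) % suc l             ≡⟨ cong (_% suc l) (trans (sym (*-assoc t u (toℕ x))) (cong (_* toℕ x) eq)) ⟩
  ((1 + suc l * q) * toℕ x) % suc l     ≡⟨ cong (_% suc l) (solve 3 (λ j q x → (con 1 :+ j :* q) :* x := x :+ (q :* x) :* j) refl (suc l) q (toℕ x)) ⟩
  (toℕ x + (q * toℕ x) * suc l) % suc l ≡⟨ [m+kn]%n≡m%n (toℕ x) (q * toℕ x) (suc l) ⟩
  toℕ x % suc l                         ≡⟨ m<n⇒m%n≡m (Fin.toℕ<n x) ⟩
  toℕ x                                 ∎)
  where
  open ≡.≡-Reasoning
  open +-*-Solver

module _ {p} (pp : Prime p) where
  private instance _ = prime⇒nonZero pp

  -- With suc l = pᵏ b and p ∤ b, the unit p + b of ℤ/(suc l) carries translation by pᵏ to translation by pᵏ⁺¹.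
  rot-stable : ∀ l → ∃[ k ] rot {l} ^∘ (p ^ k) ≅ rot {l} ^∘ (p ^ suc k)
  rot-stable l with prime-power-part pp (suc l) z<s
  ... | k , b , j≡ , p∤b , 0<b with coprime-inverse {p + b} {suc l} coprime (<-≤-trans (>-nonZero⁻¹ p) (m≤m+n p b)) z<s
    where
    p∤u : p ∤ p + b
    p∤u p∣u = p∤b (∣m+n∣m⇒∣n p∣u ∣-refl)
    coprime : Coprime (p + b) (suc l)
    -- As p does not divide p + b, a common divisor is prime to pᵏ. Hence it divides b, then also p,
    -- and these are coprime.
    coprime {d} (d∣u , d∣j) = prime∤⇒coprime pp p∤b (d∣p , d∣b)
      where
      d⊥pᵏ : Coprime d (p ^ k)
      d⊥pᵏ (e∣d , e∣pᵏ) = coprime-^ pp k (prime∤⇒coprime pp p∤u) (e∣pᵏ , ∣-trans e∣d d∣u)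
      d∣b : d ∣ b
      d∣b = Coprime.coprime-divisor d⊥pᵏ (subst (d ∣_) j≡ d∣j)
      d∣p : d ∣ p
      d∣p = ∣m+n∣m⇒∣n (subst (d ∣_) (+-comm p b) d∣u) d∣b
  ... | t , q , ut≡ = k , mk↔ₛ′ (multiply u) (multiply t) (multiply-inverse {u = t} {t = u} ut≡) (multiply-inverse {u = u} {t = t} (trans (*-comm t u) ut≡)) , twine
    where
    u = p + b
    P = p ^ k
    open ≡.≡-Reasoning
    open +-*-Solver
    twine : ∀ x → multiply u ((rot ^∘ P) x) ≡ (rot ^∘ (p ^ suc k)) (multiply u x)
    twine x = Fin.toℕ-injective (begin
      toℕ (multiply u ((rot ^∘ P) x))          ≡⟨ trans (toℕ-multiply u _) (cong (λ z → (u * z) % suc l) (toℕ-rot^ P x)) ⟩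
      (u * ((P + toℕ x) % suc l)) % suc l      ≡⟨ [a*b%j]%j (suc l) u (P + toℕ x) ⟩
      (u * (P + toℕ x)) % suc l                ≡⟨ cong (_% suc l) (solve 4 (λ p b P x → (p :+ b) :* (P :+ x) := (p :* P :+ (p :+ b) :* x) :+ P :* b) refl p b P (toℕ x)) ⟩
      ((p * P + u * toℕ x) + P * b) % suc l    ≡⟨ cong (λ z → ((p * P + u * toℕ x) + z) % suc l) (sym j≡) ⟩
      ((p * P + u * toℕ x) + suc l) % suc l    ≡⟨ [m+n]%n≡m%n (p * P + u * toℕ x) (suc l) ⟩
      (p * P + u * toℕ x) % suc l              ≡⟨ [a+b%j]%j (suc l) (p * P) (u * toℕ x) ⟨
      (p * P + (u * toℕ x) % suc l) % suc l    ≡⟨ cong (λ z → (p * P + z) % suc l) (toℕ-multiply u x) ⟨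
      (p * P + toℕ (multiply u x)) % suc l     ≡⟨ toℕ-rot^ (p * P) (multiply u x) ⟨
      toℕ ((rot ^∘ (p ^ suc k)) (multiply u x)) ∎)

-- The p-th power of a cycle of length p j is a product of p cycles of length j.
rot-split : ∀ r l → copies (suc r) (rot {l}) ≅ rot {r + l * suc r} ^∘ suc r
rot-split r l = mk↔ₛ′ (λ (i , x) → Fin.combine x i) (λ y → let (x , i) = Fin.remQuot (suc r) y in i , x)
    (Fin.combine-remQuot {suc l} (suc r)) (λ (i , x) → cong (λ (x , i) → i , x) (Fin.remQuot-combine x i))
  , λ (i , x) → Fin.toℕ-injective (trans (Fin.toℕ-combine (rot x) i) (trans (go i x (m≤n⇒m<n∨m≡n (≤-pred (Fin.toℕ<n x))))
      (sym (trans (toℕ-rot^ (suc r) (Fin.combine x i)) (cong (λ z → (suc r + z) % (suc l * suc r)) (Fin.toℕ-combine x i))))))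
  where
  open +-*-Solver
  go : ∀ (i : Fin (suc r)) (x : Fin (suc l)) → toℕ x < l ⊎ toℕ x ≡ l →
       suc r * toℕ (rot x) + toℕ i ≡ (suc r + (suc r * toℕ x + toℕ i)) % (suc l * suc r)
  go i x (inj₁ x<l) = trans (cong (λ z → suc r * z + toℕ i) (rot-< x x<l))
    (trans regroup (sym (m<n⇒m%n≡m (subst (_< suc l * suc r) regroup small))))
    where
    regroup : suc r * suc (toℕ x) + toℕ i ≡ suc r + (suc r * toℕ x + toℕ i)
    regroup = solve 3 (λ r x i → r :* (con 1 :+ x) :+ i := r :+ (r :* x :+ i)) refl (suc r) (toℕ x) (toℕ i)
    small : suc r * suc (toℕ x) + toℕ i < suc l * suc r
    small = <-≤-trans (+-monoʳ-< (suc r * suc (toℕ x)) (Fin.toℕ<n i))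
      (≤-trans (≤-reflexive (solve 2 (λ r x → r :* (con 1 :+ x) :+ r := (con 1 :+ (con 1 :+ x)) :* r) refl (suc r) (toℕ x))) (*-monoˡ-≤ (suc r) (s≤s x<l)))
  go i x (inj₂ x≡l) = trans (cong (λ z → suc r * toℕ z + toℕ i) (rot-≡ x x≡l))
    (trans (cong (_+ toℕ i) (*-zeroʳ r)) (sym (trans (cong (_% (suc l * suc r)) regroup)
      (trans ([m+n]%n≡m%n (toℕ i) (suc l * suc r)) (m<n⇒m%n≡m (<-≤-trans (Fin.toℕ<n i) (m≤m+n (suc r) (l * suc r))))))))
    where
    regroup : suc r + (suc r * toℕ x + toℕ i) ≡ toℕ i + suc l * suc r
    regroup = trans (cong (λ z → suc r + (suc r * z + toℕ i)) x≡l) (solve 3 (λ r l i → r :+ (r :* l :+ i) := i :+ (r :+ l :* r)) refl (suc r) l (toℕ i))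

-- A list entry l stands for a block of size suc l.
Blocks : List ℕ → Set
Blocks []       = ⊥
Blocks (l ∷ ls) = Fin (suc l) ⊎ Blocks ls

rotate-blocks : ∀ ls → Blocks ls → Blocks ls
rotate-blocks []       = id
rotate-blocks (l ∷ ls) = Sum⊎.map rot (rotate-blocks ls)

blocks-↭ : ∀ {ls ls′} → ls ↭ ls′ → rotate-blocks ls ≅ rotate-blocks ls′
blocks-↭ Perm↭.refl          = ≗⇒≅ (λ _ → refl)
blocks-↭ (Perm↭.prep l e)    = ≅-⊎ (≗⇒≅ (λ _ → refl)) (blocks-↭ e)
blocks-↭ (Perm↭.swap l l′ e) = ≅-trans (≅-⊎ (≗⇒≅ (λ _ → refl)) (≅-⊎ (≗⇒≅ (λ _ → refl)) (blocks-↭ e)))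
  (mk↔ₛ′ exchange exchange involutive involutive , λ { (inj₁ _) → refl ; (inj₂ (inj₁ _)) → refl ; (inj₂ (inj₂ _)) → refl })
  where
  exchange : ∀ {A B C : Set} → A ⊎ (B ⊎ C) → B ⊎ (A ⊎ C)
  exchange (inj₁ x)        = inj₂ (inj₁ x)
  exchange (inj₂ (inj₁ x)) = inj₁ x
  exchange (inj₂ (inj₂ x)) = inj₂ (inj₂ x)
  involutive : ∀ {A B C : Set} (x : A ⊎ (B ⊎ C)) → exchange (exchange x) ≡ x
  involutive (inj₁ x)        = refl
  involutive (inj₂ (inj₁ x)) = refl
  involutive (inj₂ (inj₂ x)) = refl
blocks-↭ (Perm↭.trans e f)   = ≅-trans (blocks-↭ e) (blocks-↭ f)

blocks-++ : ∀ xs ys → rotate-blocks (xs ++ ys) ≅ Sum⊎.map (rotate-blocks xs) (rotate-blocks ys)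
blocks-++ [] ys = mk↔ₛ′ inj₂ (λ { (inj₁ ()) ; (inj₂ y) → y }) (λ { (inj₁ ()) ; (inj₂ y) → refl }) (λ _ → refl) , λ _ → refl
blocks-++ (x ∷ xs) ys = ≅-trans (≅-⊎ (≗⇒≅ (λ _ → refl)) (blocks-++ xs ys))
  (mk↔ₛ′ Sum⊎.assocˡ Sum⊎.assocʳ
    (λ { (inj₁ (inj₁ _)) → refl ; (inj₁ (inj₂ _)) → refl ; (inj₂ _) → refl })
    (λ { (inj₁ _) → refl ; (inj₂ (inj₁ _)) → refl ; (inj₂ (inj₂ _)) → refl })
  , λ { (inj₁ _) → refl ; (inj₂ (inj₁ _)) → refl ; (inj₂ (inj₂ _)) → refl })

blocks-replicate : ∀ q l → rotate-blocks (replicate q l) ≅ copies q (rot {l})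
blocks-replicate zero l = mk↔ₛ′ (λ ()) (λ ()) (λ ()) (λ ()) , λ ()
blocks-replicate (suc q) l = ≅-trans (≅-⊎ (≗⇒≅ (λ _ → refl)) (blocks-replicate q l))
  (mk↔ₛ′ (λ { (inj₁ x) → zero , x ; (inj₂ (i , x)) → suc i , x }) (λ { (zero , x) → inj₁ x ; (suc i , x) → inj₂ (i , x) })
    (λ { (zero , _) → refl ; (suc i , _) → refl }) (λ { (inj₁ _) → refl ; (inj₂ _) → refl })
  , λ { (inj₁ _) → refl ; (inj₂ _) → refl })

-- Sizes are stored minus one, so this entry stands for a block of size p (l + 1). The value at p =
-- 0 is a default.
merged : ℕ → ℕ → ℕ
merged zero    l = 0
merged (suc r) l = r + l * suc r

-- With j = l + 1, `rot-split` turns p cycles of length j into the p-th power of a cycle of length p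
-- j. The additional factor p in the exponent is harmless for high powers, by `rot-stable`.
merge-blocks : ∀ {p} → Prime p → ∀ {ls l rest} → ls ↭ replicate p l ++ rest →
               ∃[ a ] rotate-blocks ls ^∘ (p ^ a) ≅ rotate-blocks (merged p l ∷ rest) ^∘ (p ^ a)
merge-blocks {zero} pp = contradiction pp ¬prime[0]
merge-blocks {p@(suc r)} pp {ls} {l} {rest} e = go (rot-stable pp l)
  where
  go : ∃[ k ] rot {l} ^∘ (p ^ k) ≅ rot {l} ^∘ (p ^ suc k) → ∃[ a ] rotate-blocks ls ^∘ (p ^ a) ≅ rotate-blocks (merged p l ∷ rest) ^∘ (p ^ a)
  go (k , stable) = suc k ,
    ≅-trans (≅-^∘ N (≅-trans (blocks-↭ e) (≅-trans (blocks-++ (replicate p l) rest) (≅-⊎ (blocks-replicate p l) (≗⇒≅ (λ _ → refl))))))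
      (≅-trans (≗⇒≅ (map-^∘ (copies p (rot {l})) (rotate-blocks rest) N))
        (≅-trans (≅-⊎ merge (≗⇒≅ (λ _ → refl)))
          (≗⇒≅ (λ x → sym (map-^∘ (rot {merged p l}) (rotate-blocks rest) N x)))))
    where
    N = p ^ suc k
    merge : copies p (rot {l}) ^∘ N ≅ rot {merged p l} ^∘ N
    merge = ≅-trans (≗⇒≅ (copies-^∘ p rot N)) (≅-trans (≅-copies p (≅-sym stable))
      (≅-trans (≗⇒≅ (λ x → sym (copies-^∘ p rot (p ^ k) x))) (≅-trans (≅-^∘ (p ^ k) (rot-split r l))
        (≗⇒≅ (λ x → trans (sym (^∘-* rot (p ^ k) p x)) (cong (λ M → (rot ^∘ M) x) (*-comm (p ^ k) p)))))))

-- Subsets of the generators as sequences of blocks.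

-- A bit tells whether two neighbouring positions are joined. The first block is kept apart from the
-- list because it is the one still growing, and the one that may be of type D.
shape : ∀ {k} → Vec Bool k → ℕ × List ℕ
shape []           = 0 , []
shape (true ∷ bs)  = suc (proj₁ (shape bs)) , proj₂ (shape bs)
shape (false ∷ bs) = 0 , proj₁ (shape bs) ∷ proj₂ (shape bs)

sizes : ∀ {k} → Vec Bool k → List ℕ
sizes bs = proj₁ (shape bs) ∷ proj₂ (shape bs)

-- The product of the adjacent transpositions (i, i + 1) whose bit is set.
cyc : ∀ {k} → Vec Bool k → Fin (suc k) → Fin (suc k)
cyc []           i       = i
cyc (true ∷ bs)  zero    = suc zero
cyc (true ∷ bs)  (suc j) = lengthen (cyc bs j)
cyc (false ∷ bs) zero    = zero
cyc (false ∷ bs) (suc j) = suc (cyc bs j)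

module _ where
  private
    toBlocks : ∀ {k} (bs : Vec Bool k) → Fin (suc k) → Blocks (sizes bs)
    toBlocks bs           zero    = inj₁ zero
    toBlocks (true ∷ bs)  (suc i) = Sum⊎.map suc id (toBlocks bs i)
    toBlocks (false ∷ bs) (suc i) = inj₂ (toBlocks bs i)

    fromBlocks : ∀ {k} (bs : Vec Bool k) → Blocks (sizes bs) → Fin (suc k)
    fromBlocks bs           (inj₁ zero)    = zero
    fromBlocks (true ∷ bs)  (inj₁ (suc x)) = suc (fromBlocks bs (inj₁ x))
    fromBlocks (true ∷ bs)  (inj₂ y)       = suc (fromBlocks bs (inj₂ y))
    fromBlocks (false ∷ bs) (inj₂ y)       = suc (fromBlocks bs y)

    toBlocks-fromBlocks : ∀ {k} (bs : Vec Bool k) z → toBlocks bs (fromBlocks bs z) ≡ z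
    toBlocks-fromBlocks []           (inj₁ zero)    = refl
    toBlocks-fromBlocks (true ∷ bs)  (inj₁ zero)    = refl
    toBlocks-fromBlocks (false ∷ bs) (inj₁ zero)    = refl
    toBlocks-fromBlocks (true ∷ bs)  (inj₁ (suc x)) = cong (Sum⊎.map suc id) (toBlocks-fromBlocks bs (inj₁ x))
    toBlocks-fromBlocks (true ∷ bs)  (inj₂ y)       = cong (Sum⊎.map suc id) (toBlocks-fromBlocks bs (inj₂ y))
    toBlocks-fromBlocks (false ∷ bs) (inj₂ y)       = cong inj₂ (toBlocks-fromBlocks bs y)

    fromBlocks-map : ∀ {k} (bs : Vec Bool k) z → fromBlocks (true ∷ bs) (Sum⊎.map suc id z) ≡ suc (fromBlocks bs z)
    fromBlocks-map bs (inj₁ x) = refl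
    fromBlocks-map bs (inj₂ y) = refl

    fromBlocks-zero : ∀ {k} (bs : Vec Bool k) → fromBlocks bs (inj₁ zero) ≡ zero
    fromBlocks-zero []           = refl
    fromBlocks-zero (true ∷ bs)  = refl
    fromBlocks-zero (false ∷ bs) = refl

    fromBlocks-toBlocks : ∀ {k} (bs : Vec Bool k) i → fromBlocks bs (toBlocks bs i) ≡ i
    fromBlocks-toBlocks bs           zero    = fromBlocks-zero bs
    fromBlocks-toBlocks (true ∷ bs)  (suc i) = trans (fromBlocks-map bs (toBlocks bs i)) (cong suc (fromBlocks-toBlocks bs i))
    fromBlocks-toBlocks (false ∷ bs) (suc i) = cong suc (fromBlocks-toBlocks bs i)

    map-rotate : ∀ {k} (bs : Vec Bool k) z i → toBlocks bs i ≡ rotate-blocks (sizes bs) z →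
                 toBlocks (true ∷ bs) (lengthen i) ≡ rotate-blocks (sizes (true ∷ bs)) (Sum⊎.map suc id z)
    map-rotate bs (inj₁ x) zero    eq = cong (inj₁ ∘ lengthen) (inj₁-injective eq)
    map-rotate bs (inj₂ y) zero    ()
    map-rotate bs (inj₁ x) (suc i) eq = trans (cong (Sum⊎.map suc id) eq) (go (rot x) eq)
      where
      go : ∀ r → toBlocks bs (suc i) ≡ inj₁ r → inj₁ (suc r) ≡ inj₁ (lengthen r)
      go zero    eq = contradiction (trans (sym (fromBlocks-toBlocks bs (suc i))) (trans (cong (fromBlocks bs) eq) (fromBlocks-zero bs))) λ ()
      go (suc r) _  = refl
    map-rotate bs (inj₂ y) (suc i) eq = cong (Sum⊎.map suc id) eq

    toBlocks-cyc : ∀ {k} (bs : Vec Bool k) i → toBlocks bs (cyc bs i) ≡ rotate-blocks (sizes bs) (toBlocks bs i)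
    toBlocks-cyc []           zero    = refl
    toBlocks-cyc (true ∷ bs)  zero    = refl
    toBlocks-cyc (true ∷ bs)  (suc j) = map-rotate bs (toBlocks bs j) (cyc bs j) (toBlocks-cyc bs j)
    toBlocks-cyc (false ∷ bs) zero    = refl
    toBlocks-cyc (false ∷ bs) (suc j) = cong inj₂ (toBlocks-cyc bs j)

  position : ∀ {k} (bs : Vec Bool k) → cyc bs ≅ rotate-blocks (sizes bs)
  position bs = mk↔ₛ′ (toBlocks bs) (fromBlocks bs) (toBlocks-fromBlocks bs) (fromBlocks-toBlocks bs) , toBlocks-cyc bs

blockOf : ∀ ls → Blocks ls → Fin (length ls)
blockOf (l ∷ ls) (inj₁ _) = zero
blockOf (l ∷ ls) (inj₂ z) = suc (blockOf ls z)

posOf : ∀ {k} (bs : Vec Bool k) → Fin (suc k) → Blocks (sizes bs)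
posOf bs = Inverse.to (_≅_.bijection (position bs))

index : ∀ {k} → Vec Bool k → Fin (suc k) → ℕ
index bs i = toℕ (blockOf (sizes bs) (posOf bs i))

index-true : ∀ {k} (bs : Vec Bool k) i → index (true ∷ bs) (suc i) ≡ index bs i
index-true bs i = go (posOf bs i)
  where
  go : ∀ z → toℕ (blockOf (sizes (true ∷ bs)) (Sum⊎.map suc id z)) ≡ toℕ (blockOf (sizes bs) z)
  go (inj₁ _) = refl
  go (inj₂ _) = refl

index-adjacent : ∀ {k} (bs : Vec Bool k) i → index bs (suc i) ≡ (if Vec.lookup bs i then 0 else 1) + index bs (inject₁ i)
index-adjacent (true ∷ bs)  zero    = index-true bs zero
index-adjacent (false ∷ bs) zero    = refl
index-adjacent (true ∷ bs)  (suc i) = trans (index-true bs (suc i)) (trans (index-adjacent bs i)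
  (cong (λ z → (if Vec.lookup bs i then 0 else 1) + z) (sym (index-true bs (inject₁ i)))))
index-adjacent (false ∷ bs) (suc i) = trans (cong suc (index-adjacent bs i)) (sym (+-suc (if Vec.lookup bs i then 0 else 1) _))

entry : (ls : List ℕ) → Fin (length ls) → ℕ
entry ls = Vec.lookup (Vec.fromList ls)

private
  embed : ∀ ls i → Fin (suc (entry ls i)) → Blocks ls
  embed (l ∷ ls) zero    x = inj₁ x
  embed (l ∷ ls) (suc i) x = inj₂ (embed ls i x)

  blockOf-embed : ∀ ls i x → blockOf ls (embed ls i x) ≡ i
  blockOf-embed (l ∷ ls) zero    x = refl
  blockOf-embed (l ∷ ls) (suc i) x = cong suc (blockOf-embed ls i x)

  embed-injective : ∀ ls i {x y} → embed ls i x ≡ embed ls i y → x ≡ y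
  embed-injective (l ∷ ls) zero    refl = refl
  embed-injective (l ∷ ls) (suc i) eq   = embed-injective ls i (inj₂-injective eq)

  locate : ∀ ls i z → blockOf ls z ≡ i → ∃[ x ] embed ls i x ≡ z
  locate (l ∷ ls) zero    (inj₁ x) _  = x , refl
  locate (l ∷ ls) (suc i) (inj₂ z) eq = let (x , e) = locate ls i z (Fin.suc-injective eq) in x , cong inj₂ e

-- By the last hypothesis `f` restricts to an injection of the block of `z` into the block of `f z`.
entry-≤ : ∀ ls (f : Blocks ls → Blocks ls) → (∀ {z z′} → f z ≡ f z′ → z ≡ z′) →
          ∀ z → (∀ z′ → blockOf ls z′ ≡ blockOf ls z → blockOf ls (f z′) ≡ blockOf ls (f z)) →
          entry ls (blockOf ls z) ≤ entry ls (blockOf ls (f z))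
entry-≤ ls f f-injective z stable = ≤-pred (Fin.injective⇒≤ {f = λ x → proj₁ (image x)}
  (λ {x} {y} eq → embed-injective ls (blockOf ls z) (f-injective (trans (sym (proj₂ (image x)))
    (trans (cong (embed ls (blockOf ls (f z))) eq) (proj₂ (image y)))))))
  where
  image : ∀ x → ∃[ y ] embed ls (blockOf ls (f z)) y ≡ f (embed ls (blockOf ls z) x)
  image x = locate ls _ _ (stable (embed ls (blockOf ls z) x) (blockOf-embed ls (blockOf ls z) x))

private
  toList-removeAt : ∀ {n} (xs : Vec ℕ (suc n)) i → Vec.toList xs ↭ Vec.lookup xs i ∷ Vec.toList (Vec.removeAt xs i)
  toList-removeAt (x ∷ xs)         zero    = ↭-refl
  toList-removeAt (x ∷ xs@(_ ∷ _)) (suc i) = ↭-trans (↭-prep x (toList-removeAt xs i)) (↭-swap x (Vec.lookup xs i) ↭-refl)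

  equal-entries-vec : ∀ {q n l} (xs : Vec ℕ n) (e : Fin q → Fin n) → (∀ {j k} → e j ≡ e k → j ≡ k) → (∀ k → Vec.lookup xs (e k) ≡ l) →
                      ∃[ rest ] Vec.toList xs ↭ replicate q l ++ rest
  equal-entries-vec {zero} xs e _ _ = Vec.toList xs , ↭-refl
  equal-entries-vec {suc q} {zero} xs e _ _ = contradiction (e zero) Fin.¬Fin0
  equal-entries-vec {suc q} {suc n} {l} xs e e-inj same =
    let (rest , p) = equal-entries-vec (Vec.removeAt xs (e zero)) (λ k → Fin.punchOut (apart k))
                       (λ {j} {k} eq → Fin.suc-injective (e-inj (Fin.punchOut-injective (apart j) (apart k) eq)))
                       (λ k → trans (Vec.removeAt-punchOut xs (apart k)) (same (suc k)))
    in rest , ↭-trans (toList-removeAt xs (e zero)) (subst (λ x → Vec.lookup xs (e zero) ∷ Vec.toList (Vec.removeAt xs (e zero)) ↭ x ∷ replicate q l ++ rest) (same zero) (↭-prep _ p))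
    where
    apart : ∀ k → e zero ≢ e (suc k)
    apart k eq = contradiction (e-inj eq) λ ()

equal-entries : ∀ {q l} ls (e : Fin q → Fin (length ls)) → (∀ {j k} → e j ≡ e k → j ≡ k) → (∀ k → entry ls (e k) ≡ l) →
                ∃[ rest ] ls ↭ replicate q l ++ rest
equal-entries {q} {l} ls e e-inj same = let (rest , p) = equal-entries-vec (Vec.fromList ls) e e-inj same
  in rest , subst (_↭ replicate q l ++ rest) (Vec.toList∘fromList ls) p

total : List ℕ → ℕ
total []       = 0
total (l ∷ ls) = suc l + total ls

Blocks-size : ∀ ls → Fin (total ls) ↔ Blocks ls
Blocks-size [] = mk↔ₛ′ (λ ()) (λ ()) (λ ()) (λ ())
Blocks-size (l ∷ ls) = Comp.inverse (Fin.+↔⊎ {suc l} {total ls}) (≗-id ⊎-↔ Blocks-size ls)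
  where
  ≗-id : Fin (suc l) ↔ Fin (suc l)
  ≗-id = mk↔ₛ′ id id (λ _ → refl) (λ _ → refl)

shape-surjective : ∀ k h hs → total (h ∷ hs) ≡ suc k → ∃[ bs ] shape {k} bs ≡ (h , hs)
shape-surjective zero    zero    []       eq = [] , refl
shape-surjective (suc k) (suc h) hs       eq = let (bs , e) = shape-surjective k h hs (suc-injective eq) in true ∷ bs , cong (λ (h , hs) → suc h , hs) e
shape-surjective (suc k) zero    (l ∷ ls) eq = let (bs , e) = shape-surjective k l ls (suc-injective eq) in false ∷ bs , cong (λ (h , hs) → 0 , h ∷ hs) e

shape-surjective-≅ : ∀ {k} (bs : Vec Bool k) h hs → Blocks (sizes bs) ↔ Blocks (h ∷ hs) → ∃[ bs′ ] shape {k} bs′ ≡ (h , hs)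
shape-surjective-≅ {k} bs h hs π = shape-surjective k h hs
  (Perm.↔⇒≡ (Comp.inverse (Blocks-size (h ∷ hs)) (Comp.inverse (Symm.inverse π) (Symm.inverse (_≅_.bijection (position bs))))))

ones : ∀ {k} → Vec Bool k → ℕ
ones []           = 0
ones (true ∷ bs)  = suc (ones bs)
ones (false ∷ bs) = ones bs

ones+blocks : ∀ {k} (bs : Vec Bool k) → ones bs + length (sizes bs) ≡ suc k
ones+blocks []           = refl
ones+blocks (true ∷ bs)  = cong suc (ones+blocks bs)
ones+blocks (false ∷ bs) = trans (+-suc (ones bs) _) (cong suc (ones+blocks bs))

-- Provides the measure for repeated merging: fewer blocks means more generators.
fewer-blocks : ∀ {k} (bs bs′ : Vec Bool k) → length (sizes bs′) < length (sizes bs) → ones bs < ones bs′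
fewer-blocks bs bs′ lt = ≰⇒> λ le → <-irrefl (trans (ones+blocks bs′) (sym (ones+blocks bs))) (+-mono-≤-< le lt)

elements : ∀ {k} → Vec Bool k → List (Fin k)
elements []           = []
elements (true ∷ bs)  = zero ∷ map suc (elements bs)
elements (false ∷ bs) = map suc (elements bs)

∈-elements⁺ : ∀ {k} (bs : Vec Bool k) {j} → j ∈ₛ bs → j ∈ elements bs
∈-elements⁺ (true ∷ bs)  here       = here refl
∈-elements⁺ (true ∷ bs)  (there j∈) = there (Memₚ.∈-map⁺ suc (∈-elements⁺ bs j∈))
∈-elements⁺ (false ∷ bs) (there j∈) = Memₚ.∈-map⁺ suc (∈-elements⁺ bs j∈)

∈-elements⁻ : ∀ {k} (bs : Vec Bool k) {j} → j ∈ elements bs → j ∈ₛ bs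
∈-elements⁻ (true ∷ bs)  (here refl) = here
∈-elements⁻ (true ∷ bs)  (there j∈) with Memₚ.∈-map⁻ suc j∈
... | _ , i∈ , refl = there (∈-elements⁻ bs i∈)
∈-elements⁻ (false ∷ bs) j∈ with Memₚ.∈-map⁻ suc j∈
... | _ , i∈ , refl = there (∈-elements⁻ bs i∈)

elements-unique : ∀ {k} (bs : Vec Bool k) → Unique (elements bs)
elements-unique []           = []
elements-unique (true ∷ bs)  = All.tabulate (λ j∈ 0≡j → case Memₚ.∈-map⁻ suc (subst (_∈ map suc (elements bs)) (sym 0≡j) j∈) of λ { (_ , _ , ()) })
  ∷ Uniqueₚ.map⁺ Fin.suc-injective (elements-unique bs)
elements-unique (false ∷ bs) = Uniqueₚ.map⁺ Fin.suc-injective (elements-unique bs)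

transpositions : ∀ {k} → List (Fin k) → Fin (suc k) → Fin (suc k)
transpositions []       i = i
transpositions (j ∷ js) i = PC.transpose (inject₁ j) (suc j) (transpositions js i)

private
  transpose-suc : ∀ {k} (i j x : Fin k) → PC.transpose (suc i) (suc j) (suc x) ≡ suc (PC.transpose i j x)
  transpose-suc i j x with does (x Fin.≟ i)
  ... | true  = refl
  ... | false with does (x Fin.≟ j)
  ...   | true  = refl
  ...   | false = refl

  transpositions-suc : ∀ {k} (js : List (Fin k)) i → transpositions (map suc js) (suc i) ≡ suc (transpositions js i)
  transpositions-suc []       i = refl
  transpositions-suc (j ∷ js) i = trans (cong (PC.transpose (suc (inject₁ j)) (suc (suc j))) (transpositions-suc js i)) (transpose-suc (inject₁ j) (suc j) (transpositions js i))

  transpositions-zero : ∀ {k} (js : List (Fin k)) → transpositions (map suc js) zero ≡ zero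
  transpositions-zero []       = refl
  transpositions-zero (j ∷ js) = cong (PC.transpose (suc (inject₁ j)) (suc (suc j))) (transpositions-zero js)

transpositions-cyc : ∀ {k} (bs : Vec Bool k) i → transpositions (elements bs) i ≡ cyc bs i
transpositions-cyc []           i       = refl
transpositions-cyc (true ∷ bs)  zero    = cong (PC.transpose zero (suc zero)) (transpositions-zero (elements bs))
transpositions-cyc (true ∷ bs)  (suc i) = trans (cong (PC.transpose zero (suc zero)) (trans (transpositions-suc (elements bs) i) (cong suc (transpositions-cyc bs i)))) (swap (cyc bs i))
  where
  swap : ∀ {k} (j : Fin (suc k)) → PC.transpose zero (suc zero) (suc j) ≡ lengthen j
  swap zero    = refl
  swap (suc j) = refl
transpositions-cyc (false ∷ bs) zero    = transpositions-zero (elements bs)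
transpositions-cyc (false ∷ bs) (suc i) = trans (transpositions-suc (elements bs) i) (cong suc (transpositions-cyc bs i))

-- Action of the normalizer of a parabolic subgroup on its blocks.

module BlockAction {m : ℕ} (2≤m : 2 ≤ m) where
  open SignedPerm
  open Twist 2≤m public
  open Group W using (Carrier; _≈_; _∙_; ε; _⁻¹)

  standard : Subset n → Carrier
  standard K = foldr _∙_ ε (map generatorW (elements K))

  standard-coxeter : ∀ K → IsCoxeterElement K (standard K)
  standard-coxeter K = elements K , elements-unique K , (λ j → mk⇔ (∈-elements⁻ K) (∈-elements⁺ K)) , λ _ → refl

  private
    unsigned-product : ∀ js σ i → to (product (map suc js)) (σ , i) ≡ (σ , transpositions js i)
    unsigned-product []       σ i = refl
    unsigned-product (j ∷ js) σ i = cong (to (s (suc j))) (unsigned-product js σ i)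

  standard-false : ∀ bs σ i → to (proj₁ (standard (false ∷ bs))) (σ , i) ≡ (σ , cyc bs i)
  standard-false bs σ i = trans (product≈ (map suc (elements bs)) (σ , i)) (trans (unsigned-product (elements bs) σ i) (cong (σ ,_) (transpositions-cyc bs i)))

  standard-true : ∀ bs σ i → to (proj₁ (standard (true ∷ bs))) (σ , i) ≡ to (s zero) (σ , cyc bs i)
  standard-true bs σ i = cong (to (s zero)) (standard-false bs σ i)

  -- The values of v on the blocks of K are distinct, and v vanishes on the block of type D, if there is one.
  module _ (b₀ : Bool) (bs : Vec Bool (suc m)) (good : b₀ ≡ true → Vec.lookup bs zero ≡ true) where

    -- If u belongs to K, then `good` puts s₁ in K as well, so the first block is of type D and must
    -- get the value 0. Otherwise the values start at 1, so that none vanishes.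
    offset : ℕ
    offset = if b₀ then 0 else 1

    blockVector : Vector n
    blockVector i = + (offset + index bs i)

    private
      K = b₀ ∷ bs
      v = blockVector

    block-facet : Facet v K
    block-facet = dominant , vanishing , member
      where
      gap : Bool → ℕ
      gap b = if b then 0 else 1
      pair-suc : ∀ i → pair (suc i) v ≡ + gap (Vec.lookup bs i)
      pair-suc i = trans (cong (λ z → + (offset + z) ℤ.- v (inject₁ i)) (index-adjacent bs i))
        (trans (cong (ℤ._- v (inject₁ i)) (trans (ℤ.pos-+ offset _) (cong (λ z → + offset ℤ.+ z) (ℤ.pos-+ (gap (Vec.lookup bs i)) _))))
          (trans (cong (λ z → (+ offset ℤ.+ (+ gap (Vec.lookup bs i) ℤ.+ + index bs (inject₁ i))) ℤ.- z) (ℤ.pos-+ offset _))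
            (solve 3 (λ o g i → (o :+ (g :+ i)) :- (o :+ i) := g) refl (+ offset) (+ gap (Vec.lookup bs i)) (+ index bs (inject₁ i)))))
        where open ℤ-Solver
      pair-zero : pair zero v ≡ + (offset + index bs (suc zero) + (offset + index bs zero))
      pair-zero = trans (cong (λ z → v (suc zero) ℤ.+ z) (ℤ.neg-involutive (v zero))) (sym (ℤ.pos-+ (offset + index bs (suc zero)) _))
      dominant : Dominant v
      dominant zero    = subst (0ℤ ℤ.≤_) (sym pair-zero) (+≤+ z≤n)
      dominant (suc i) = subst (0ℤ ℤ.≤_) (sym (pair-suc i)) (+≤+ z≤n)
      vanishing : ∀ k → k ∈ₛ K → pair k v ≡ 0ℤ
      vanishing zero    k∈ = trans pair-zero (cong +_ (go b₀ k∈ good))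
        where
        go : ∀ b₀ → zero ∈ₛ (b₀ ∷ bs) → (b₀ ≡ true → Vec.lookup bs zero ≡ true) →
             (if b₀ then 0 else 1) + index bs (suc zero) + ((if b₀ then 0 else 1) + index bs zero) ≡ 0
        go true here good = cong₂ _+_ (trans (index-adjacent bs zero) (cong (λ b → (if b then 0 else 1) + index bs zero) (good refl))) refl
      vanishing (suc i) (there k∈) = trans (pair-suc i) (cong (λ b → + (if b then 0 else 1)) (Vec.[]=⇒lookup k∈))
      member : ∀ k → pair k v ≡ 0ℤ → k ∈ₛ K
      member zero    eq = go b₀ (ℤ.+-injective (trans (sym pair-zero) eq))
        where
        go : ∀ b₀ → (if b₀ then 0 else 1) + index bs (suc zero) + ((if b₀ then 0 else 1) + index bs zero) ≡ 0 → zero ∈ₛ (b₀ ∷ bs)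
        go true  _ = here
        go false ()
      member (suc i) eq = there (Vec.lookup⇒[]= i bs (go (Vec.lookup bs i) (ℤ.+-injective (trans (sym (pair-suc i)) eq))))
        where
        go : ∀ b → gap b ≡ 0 → b ≡ true
        go true _ = refl

    private
      ∣ext∣ : ∀ x → ℤ.∣ ext v x ∣ ≡ offset + index bs (proj₂ x)
      ∣ext∣ (Sign.+ , i) = refl
      ∣ext∣ (Sign.- , i) = ℤ.∣-i∣≡∣i∣ (v i)

      transposition : Fin n → Fin n → SignedPerm n
      transposition i j = signed (λ _ → Sign.+) (Perm.transpose i j)

      transposition-stab : ∀ i j → v i ≡ v j → Stab v (transposition i j)
      transposition-stab i j eq k = go (k Fin.≟ i) (k Fin.≟ j)
        where
        go : Dec (k ≡ i) → Dec (k ≡ j) → v (PC.transpose i j k) ≡ v k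
        go (yes refl) _ = trans (cong v (transpose-matchˡ i j)) (sym eq)
        go _ (yes refl) = trans (cong v (transpose-matchʳ i j)) eq
        go (no k≢i) (no k≢j) = cong v (transpose-mismatch i j k k≢i k≢j)

      Level-preserving : (Letter n → Letter n) → Set
      Level-preserving z = ∀ x y → ext v x ≡ ext v y → ext v (z x) ≡ ext v (z y)

      neg-fixed : ∀ i → ℤ.- i ≡ i → i ≡ 0ℤ
      neg-fixed (+ zero)  _ = refl
      neg-fixed (+ suc _) ()
      neg-fixed -[1+ _ ]  ()

    -- Letters of equal value are related by elements of W_K, and by normalization the values at
    -- their images under y⁻¹ agree. Transpositions serve for letters of equal sign; the value 0,
    -- the only one shared by letters of opposite sign, is handled by an element negating the first
    -- letter.
    normalizes⇒level-preserving : ∀ y → Normalizes (Among K) y → Level-preserving (from (proj₁ y))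
    normalizes⇒level-preserving y norm = preserving
      where
      ζ = from (proj₁ y)
      ζ-neg : ∀ x → ζ (neg x) ≡ neg (ζ x)
      ζ-neg = commutes (invₛ (proj₁ y))
      moved : ∀ h → ⟪ K ⟫ h → ∀ x → ext v (ζ (to (proj₁ h) x)) ≡ ext v (ζ x)
      moved h h∈ x = trans (cong (λ w → ext v (ζ (to (proj₁ h) w))) (sym (strictlyInverseˡ (proj₁ y) x)))
        (stab-ext {v = v} {proj₁ (y ⁻¹ ∙ h ∙ y)} (∈⇒stab block-facet {y ⁻¹ ∙ h ∙ y} (norm h h∈)) (ζ x))
      positive : ∀ i j → v i ≡ v j → ext v (ζ (Sign.+ , i)) ≡ ext v (ζ (Sign.+ , j))
      positive i j eq = trans (sym (moved t (stab⇒∈ block-facet t (transposition-stab i j eq)) (Sign.+ , i)))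
        (cong (λ k → ext v (ζ (Sign.+ , k))) (transpose-matchˡ i j))
        where
        t : Carrier
        t = transposition i j , even⇒∈W (transposition i j) (SignΣ.sum-replicate-zero n)
      zero-level : ∀ i → v i ≡ 0ℤ → ext v (ζ (Sign.+ , i)) ≡ 0ℤ
      zero-level i vi≡0 = go b₀ refl
        where
        go : ∀ b → b₀ ≡ b → ext v (ζ (Sign.+ , i)) ≡ 0ℤ
        go false eq = contradiction (ℤ.+-injective vi≡0) (λ e → nonzero (trans (cong (λ b → (if b then 0 else 1) + index bs i) (sym eq)) e))
          where
          nonzero : ¬ (suc (index bs i) ≡ 0)
          nonzero ()
        -- The product u s₁ lies in W_K and negates the first letter, so the value at the image of
        -- this letter equals its own negative.
        go true eq = trans (positive i zero (trans vi≡0 (sym v₀≡0))) (neg-fixed _ (trans (sym (ext-neg v (ζ (Sign.+ , zero))))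
          (trans (cong (ext v) (sym (ζ-neg (Sign.+ , zero)))) (trans (cong (λ w → ext v (ζ w)) (sym h₀)) (moved h (mul {x = generatorW zero} {y = generatorW (suc zero)} (simple∈ zero u∈) (simple∈ (suc zero) s∈)) (Sign.+ , zero))))))
          where
          v₀≡0 : v zero ≡ 0ℤ
          v₀≡0 = cong (λ b → + ((if b then 0 else 1) + 0)) eq
          h : Carrier
          h = generatorW zero ∙ generatorW (suc zero)
          h₀ : to (proj₁ h) (Sign.+ , zero) ≡ (Sign.- , zero)
          h₀ = refl
          u∈ : zero ∈ₛ K
          u∈ = subst (λ b → zero ∈ₛ (b ∷ bs)) (sym eq) here
          s∈ : suc zero ∈ₛ K
          s∈ = there (Vec.lookup⇒[]= zero bs (good eq))
      opposite-levels : ∀ i j → v i ≡ ℤ.- v j → v i ≡ 0ℤ × v j ≡ 0ℤ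
      opposite-levels i j = go (offset + index bs i) (offset + index bs j)
        where
        go : ∀ a b → + a ≡ ℤ.- (+ b) → + a ≡ 0ℤ × + b ≡ 0ℤ
        go zero zero _ = refl , refl
        go (suc a) zero ()
        go a (suc b) ()
      preserving : Level-preserving ζ
      preserving (Sign.+ , i) (Sign.+ , j) eq = positive i j eq
      preserving (Sign.- , i) (Sign.- , j) eq = trans (cong (ext v) (ζ-neg (Sign.+ , i))) (trans (ext-neg v (ζ (Sign.+ , i)))
        (trans (cong ℤ.-_ (positive i j (ℤ.neg-injective eq))) (trans (sym (ext-neg v (ζ (Sign.+ , j)))) (cong (ext v) (sym (ζ-neg (Sign.+ , j)))))))
      preserving (Sign.+ , i) (Sign.- , j) eq = let (i0 , j0) = opposite-levels i j eq in
        trans (zero-level i i0) (sym (trans (cong (ext v) (ζ-neg (Sign.+ , j))) (trans (ext-neg v (ζ (Sign.+ , j))) (cong ℤ.-_ (zero-level j j0)))))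
      preserving (Sign.- , i) (Sign.+ , j) eq = let (j0 , i0) = opposite-levels j i (sym eq) in
        trans (trans (cong (ext v) (ζ-neg (Sign.+ , i))) (trans (ext-neg v (ζ (Sign.+ , i))) (cong ℤ.-_ (zero-level i i0)))) (sym (zero-level j j0))

    module _ {p} (pp : Prime p) (p≢2 : p ≢ 2) (element : Normalizer-element p K) where
      private
        instance _ = prime⇒nonZero pp

        y : Carrier
        y = proj₁ element

        norm : Normalizes (Among K) y
        norm = proj₁ (proj₂ element)

        y∉ : ¬ ⟪ K ⟫ y
        y∉ = proj₁ (proj₂ (proj₂ element))

        yᵖ∈ : ⟪ K ⟫ (y ^ᴳ p)
        yᵖ∈ = proj₂ (proj₂ (proj₂ element))

        ζ : Letter n → Letter n
        ζ = from (proj₁ y)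

        ζ^ : ℕ → Letter n → Letter n
        ζ^ k x = fold x ζ k

        ζ^-+ : ∀ a b x → ζ^ (a + b) x ≡ ζ^ a (ζ^ b x)
        ζ^-+ a b x = fold-+ x ζ a

        ζ-neg : ∀ k x → ζ^ k (neg x) ≡ neg (ζ^ k x)
        ζ-neg zero    x = refl
        ζ-neg (suc k) x = trans (cong ζ (ζ-neg k x)) (commutes (invₛ (proj₁ y)) (ζ^ k x))

        level : ∀ k → Level-preserving (ζ^ k)
        level zero    x y eq = eq
        level (suc k) x y eq = normalizes⇒level-preserving _ norm _ _ (level k x y eq)

        ζ^p : ∀ x → ext v (ζ^ p x) ≡ ext v x
        ζ^p x = trans (cong (ext v) (sym (pow-from p x))) (stab-ext {v = v} {invₛ (proj₁ (y ^ᴳ p))} (stab-inv {v = v} {proj₁ (y ^ᴳ p)} (∈⇒stab block-facet {y ^ᴳ p} yᵖ∈)) x)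
          where
          pow-from : ∀ k x → from (proj₁ (y ^ᴳ k)) x ≡ ζ^ k x
          pow-from zero    x = refl
          pow-from (suc k) x = trans (pow-from k (ζ x)) (fold-comm ζ x k 1)

        moved : ∃[ i ] ext v (ζ (Sign.+ , i)) ≢ v i
        moved = Fin.¬∀⟶∃¬ n _ (λ i → ext v (ζ (Sign.+ , i)) ℤ.≟ v i) λ st →
          y∉ (stab⇒∈ block-facet y (λ i → trans (sym (stab-ext {v = v} {invₛ (proj₁ y)} st (to (proj₁ y) (Sign.+ , i)))) (cong (ext v) (strictlyInverseʳ (proj₁ y) (Sign.+ , i)))))

        x₀ : Letter n
        x₀ = Sign.+ , proj₁ moved

        Return : ℕ → Set
        Return k = ext v (ζ^ k x₀) ≡ ext v x₀

        period : ∀ {d} → Return d → p ∣ d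
        period = prime∣period pp Return
          (λ a b Ra Rb → trans (cong (ext v) (ζ^-+ a b x₀)) (trans (level a _ _ Rb) Ra))
          (λ a b Ra Rab → trans (sym (trans (cong (ext v) (trans (cong (λ k → ζ^ k x₀) (+-comm a b)) (ζ^-+ b a x₀))) (level b _ _ Ra))) Rab)
          (ζ^p x₀) (proj₂ moved)

        back : ∀ k x → k ≤ p → ext v (ζ^ k x₀) ≡ ext v x → ext v x₀ ≡ ext v (ζ^ (p ∸ k) x)
        back k x k≤p eq = trans (sym (ζ^p x₀)) (trans (cong (λ j → ext v (ζ^ j x₀)) (sym (m∸n+n≡m k≤p)))
          (trans (cong (ext v) (ζ^-+ (p ∸ k) k x₀)) (level (p ∸ k) _ _ eq)))

        2∤p-cancel : ∀ e → p ∣ e + e → p ∣ e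
        2∤p-cancel e p∣2e with euclidsLemma 2 e pp (subst (p ∣_) (cong (λ w → e + w) (sym (+-identityʳ e))) p∣2e)
        ... | inj₁ p∣2 = contradiction (≤-antisym (∣⇒≤ p∣2) (nonTrivial⇒n>1 p {{prime⇒nonTrivial pp}})) p≢2
        ... | inj₂ p∣e = p∣e

        ∣∣-cases : ∀ i j → ℤ.∣ i ∣ ≡ ℤ.∣ j ∣ → i ≡ j ⊎ i ≡ ℤ.- j
        ∣∣-cases (+ a) (+ b) eq = inj₁ (cong +_ eq)
        ∣∣-cases (+ a) -[1+ b ] eq = inj₂ (cong +_ eq)
        ∣∣-cases -[1+ a ] (+ suc b) eq = inj₂ (cong -[1+_] (suc-injective eq))
        ∣∣-cases -[1+ a ] -[1+ b ] eq = inj₁ (cong -[1+_] (suc-injective eq))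

        p∣return : ∀ k l → k ≤ p → ℤ.∣ ext v (ζ^ k x₀) ∣ ≡ ℤ.∣ ext v (ζ^ l x₀) ∣ → p ∣ (p ∸ k) + l
        p∣return k l k≤p eq with ∣∣-cases _ _ eq
        ... | inj₁ same = period (trans (cong (ext v) (ζ^-+ (p ∸ k) l x₀)) (sym (back k (ζ^ l x₀) k≤p same)))
        -- If the values are opposite, `e` steps lead from the value of x₀ to its negative and 2 e
        -- steps lead back, so p divides 2 e. This is where p ≠ 2 enters.
        ... | inj₂ opposite-level = 2∤p-cancel e (period (trans (cong (ext v) (ζ^-+ e e x₀)) (trans (sym (ℤ.neg-involutive _))
                (trans (cong ℤ.-_ (trans (sym (ext-neg v (ζ^ e (ζ^ e x₀)))) (cong (ext v) (sym (ζ-neg e (ζ^ e x₀)))))) (trans (cong ℤ.-_ (sym (level e x₀ (neg (ζ^ e x₀)) x₀≡))) (trans (cong ℤ.-_ xₑ≡) (ℤ.neg-involutive _)))))))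
          where
          e = (p ∸ k) + l
          x₀≡ : ext v x₀ ≡ ext v (neg (ζ^ e x₀))
          x₀≡ = trans (back k (neg (ζ^ l x₀)) k≤p (trans opposite-level (sym (ext-neg v (ζ^ l x₀)))))
            (cong (ext v) (trans (ζ-neg (p ∸ k) (ζ^ l x₀)) (cong neg (sym (ζ^-+ (p ∸ k) l x₀)))))
          xₑ≡ : ext v (ζ^ e x₀) ≡ ℤ.- ext v x₀
          xₑ≡ = trans (sym (ℤ.neg-involutive _)) (cong ℤ.-_ (trans (sym (ext-neg v (ζ^ e x₀))) (sym x₀≡)))

        letter : ℕ → Fin n
        letter k = proj₂ (ζ^ k x₀)

      -- The blocks, regardless of sign, through which the powers of y⁻¹ carry a letter whose value
      -- y⁻¹ changes.
      orbitBlock : Fin p → Fin (length (sizes bs))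
      orbitBlock k = blockOf (sizes bs) (posOf bs (letter (toℕ k)))

      private
        same-∣∣ : ∀ {x x′} → index bs (proj₂ x) ≡ index bs (proj₂ x′) → ℤ.∣ ext v x ∣ ≡ ℤ.∣ ext v x′ ∣
        same-∣∣ {x} {x′} eq = trans (∣ext∣ x) (trans (cong (λ w → offset + w) eq) (sym (∣ext∣ x′)))

        same-index : ∀ {x x′} → ℤ.∣ ext v x ∣ ≡ ℤ.∣ ext v x′ ∣ → index bs (proj₂ x) ≡ index bs (proj₂ x′)
        same-index {x} {x′} eq = +-cancelˡ-≡ offset _ _ (trans (sym (∣ext∣ x)) (trans eq (∣ext∣ x′)))

        ordered : ∀ {k l} → k ≤ l → l < p → ℤ.∣ ext v (ζ^ k x₀) ∣ ≡ ℤ.∣ ext v (ζ^ l x₀) ∣ → k ≡ l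
        ordered {k} {l} k≤l l<p eq = ≤-antisym k≤l (m∸n≡0⇒m≤n (small (l ∸ k) p∣d (≤-<-trans (m∸n≤m l k) l<p)))
          where
          k≤p = ≤-trans k≤l (<⇒≤ l<p)
          p∣d : p ∣ l ∸ k
          p∣d = ∣m+n∣m⇒∣n (subst (p ∣_) regroup (p∣return k l k≤p eq)) ∣-refl
            where
            regroup : (p ∸ k) + l ≡ p + (l ∸ k)
            regroup = trans (cong (λ w → (p ∸ k) + w) (sym (m+[n∸m]≡n k≤l))) (trans (sym (+-assoc (p ∸ k) k (l ∸ k))) (cong (_+ (l ∸ k)) (m∸n+n≡m k≤p)))
          small : ∀ d → p ∣ d → d < p → d ≡ 0
          small zero    _ _ = refl
          small (suc d) p∣d d<p = contradiction p∣d (>⇒∤ d<p)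

      orbitBlock-injective : ∀ {j k} → orbitBlock j ≡ orbitBlock k → j ≡ k
      orbitBlock-injective {j} {k} eq = Fin.toℕ-injective (go (≤-total (toℕ j) (toℕ k)))
        where
        same : ℤ.∣ ext v (ζ^ (toℕ j) x₀) ∣ ≡ ℤ.∣ ext v (ζ^ (toℕ k) x₀) ∣
        same = same-∣∣ {ζ^ (toℕ j) x₀} {ζ^ (toℕ k) x₀} (cong toℕ eq)
        go : toℕ j ≤ toℕ k ⊎ toℕ k ≤ toℕ j → toℕ j ≡ toℕ k
        go (inj₁ j≤k) = ordered j≤k (Fin.toℕ<n k) same
        go (inj₂ k≤j) = sym (ordered k≤j (Fin.toℕ<n j) (sym same))

      private
        size : Fin n → ℕ
        size i = entry (sizes bs) (blockOf (sizes bs) (posOf bs i))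

        size-≤ : ∀ d x → size (proj₂ x) ≤ size (proj₂ (ζ^ d x))
        size-≤ d x = subst (λ i → size (proj₂ x) ≤ size i) (trans (cong f′ (π.strictlyInverseʳ (proj₂ x))) (sym (abs-ζ (ζ^ d) (ζ-neg d) x)))
          (entry-≤ (sizes bs) F F-injective (posOf bs (proj₂ x)) stable)
          where
          module π = Inverse (_≅_.bijection (position bs))
          abs-ζ : ∀ (w : Letter n → Letter n) → (∀ x → w (neg x) ≡ neg (w x)) → ∀ x → proj₂ (w x) ≡ proj₂ (w (Sign.+ , proj₂ x))
          abs-ζ w w-neg (Sign.+ , i) = refl
          abs-ζ w w-neg (Sign.- , i) = cong proj₂ (w-neg (Sign.+ , i))
          f′ : Fin n → Fin n
          f′ i = proj₂ (ζ^ d (Sign.+ , i))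
          f′-injective : ∀ d {i j} → proj₂ (ζ^ d (Sign.+ , i)) ≡ proj₂ (ζ^ d (Sign.+ , j)) → i ≡ j
          f′-injective zero    eq = eq
          f′-injective (suc d) {i} {j} eq = f′-injective d (abs-injective (invₛ (proj₁ y)) {ζ^ d (Sign.+ , i)} {ζ^ d (Sign.+ , j)} eq)
          F : Blocks (sizes bs) → Blocks (sizes bs)
          F w = posOf bs (f′ (π.from w))
          F-injective : ∀ {w w′} → F w ≡ F w′ → w ≡ w′
          F-injective {w} {w′} eq = trans (sym (π.strictlyInverseˡ w)) (trans (cong π.to (f′-injective d
            (trans (sym (π.strictlyInverseʳ _)) (trans (cong π.from eq) (π.strictlyInverseʳ _))))) (π.strictlyInverseˡ w′))
          stable : ∀ w → blockOf (sizes bs) w ≡ blockOf (sizes bs) (posOf bs (proj₂ x)) → blockOf (sizes bs) (F w) ≡ blockOf (sizes bs) (F (posOf bs (proj₂ x)))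
          stable w eq = Fin.toℕ-injective (trans (same-index {ζ^ d (Sign.+ , π.from w)} {ζ^ d (Sign.+ , proj₂ x)} (cong ℤ.∣_∣
            (level d (Sign.+ , π.from w) (Sign.+ , proj₂ x) (cong (λ k → + (offset + k)) (trans (cong (toℕ ∘ blockOf (sizes bs)) (π.strictlyInverseˡ w)) (cong toℕ eq))))))
            (cong (λ i → index bs (f′ i)) (sym (π.strictlyInverseʳ (proj₂ x)))))

        size-p : size (proj₂ (ζ^ p x₀)) ≡ size (proj₂ x₀)
        size-p = cong (entry (sizes bs)) (Fin.toℕ-injective (same-index {ζ^ p x₀} {x₀} (cong ℤ.∣_∣ (ζ^p x₀))))

      -- Being injective and level-preserving, y⁻¹ cannot decrease block sizes along the orbit, and
      -- after p steps the orbit is back in its first block.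
      orbitBlock-size : ∀ k → entry (sizes bs) (orbitBlock k) ≡ size (proj₂ x₀)
      orbitBlock-size k = ≤-antisym
        (≤-trans (size-≤ (p ∸ toℕ k) (ζ^ (toℕ k) x₀)) (≤-reflexive (trans (cong (size ∘ proj₂)
          (trans (sym (ζ^-+ (p ∸ toℕ k) (toℕ k) x₀)) (cong (λ j → ζ^ j x₀) (m∸n+n≡m (<⇒≤ (Fin.toℕ<n k)))))) size-p)))
        (size-≤ (toℕ k) x₀)

      -- Only the value 0 is shared by a letter and its negative, so level preservation keeps an
      -- orbit that meets the block of type D inside it throughout. But the orbit starts with a
      -- letter whose value changes.
      orbitBlock-nonzero : b₀ ≡ true → ∀ k → orbitBlock k ≢ zero
      orbitBlock-nonzero b₀≡ k eq = proj₂ moved (trans (at-zero 1) (sym (at-zero 0)))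
        where
        xₖ = ζ^ (toℕ k) x₀
        xₖ≡0 : ext v xₖ ≡ 0ℤ
        xₖ≡0 = ℤ.∣i∣≡0⇒i≡0 (trans (∣ext∣ xₖ) (cong₂ (λ b j → (if b then 0 else 1) + j) b₀≡ (cong toℕ eq)))
        self-neg : ext v xₖ ≡ ext v (neg xₖ)
        self-neg = trans xₖ≡0 (sym (trans (ext-neg v xₖ) (cong ℤ.-_ xₖ≡0)))
        x₀≡ : ext v x₀ ≡ 0ℤ
        x₀≡ = neg-fixed _ (trans (cong ℤ.-_ (back (toℕ k) xₖ (<⇒≤ (Fin.toℕ<n k)) refl))
          (trans (sym (ext-neg v (ζ^ (p ∸ toℕ k) xₖ))) (trans (cong (ext v) (sym (ζ-neg (p ∸ toℕ k) xₖ))) (sym (back (toℕ k) (neg xₖ) (<⇒≤ (Fin.toℕ<n k)) self-neg)))))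
        at-zero : ∀ d → ext v (ζ^ d x₀) ≡ 0ℤ
        at-zero d = neg-fixed _ (trans (sym (ext-neg v (ζ^ d x₀))) (trans (cong (ext v) (sym (ζ-neg d x₀)))
          (level d (neg x₀) x₀ (trans (ext-neg v x₀) (trans (cong ℤ.-_ x₀≡) (sym x₀≡))))))

-- Enlarging a subset by merging blocks.

-- The position of `zero` is recorded because `u` moves this letter: blocks of type D have to be
-- matched point by point.
layout : ∀ {k} (bs : Vec Bool k) {h hs} → shape bs ≡ (h , hs) →
         Σ (cyc bs ≅ rotate-blocks (h ∷ hs)) λ P → Inverse.to (_≅_.bijection P) zero ≡ inj₁ zero
layout bs refl = position bs , refl

leading-one : ∀ {k} (bs : Vec Bool (suc k)) {h hs} → shape bs ≡ (suc h , hs) → ∃[ bs′ ] bs ≡ true ∷ bs′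
leading-one (true ∷ bs) _ = bs , refl

length-merged : ∀ {p} → 1 < p → ∀ {l} (ls rest : List ℕ) → ls ↭ replicate p l ++ rest → suc (length rest) < length ls
length-merged {p} 1<p {l} ls rest e = <-≤-trans (+-monoˡ-< (length rest) 1<p) (≤-reflexive (sym (trans (↭ₚ.↭-length e)
  (trans (length-++ (replicate p l)) (cong (_+ length rest) (length-replicate p))))))

module Merging {m : ℕ} (2≤m : 2 ≤ m) where
  open SignedPerm
  open BlockAction 2≤m public
  open Group W using (Carrier; _≈_; _∙_; ε; _⁻¹; setoid)

  private
    to-pow : ∀ x k z → to (proj₁ (x ^ᴳ k)) z ≡ fold z (to (proj₁ x)) k
    to-pow x zero    z = refl
    to-pow x (suc k) z = cong (to (proj₁ x)) (to-pow x k z)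

    -- Unsigned permutations are even, so conjugators of this form lie in W without any correction
    -- of signs.
    unsigned : Fin n ↔ Fin n → Carrier
    unsigned π = signed (λ _ → Sign.+) π , even⇒∈W (signed (λ _ → Sign.+) π) (SignΣ.sum-replicate-zero n)

    unsigned-conjugate : ∀ π v w N → (∀ z → to (proj₁ (unsigned π)) (fold z (to (proj₁ v)) N) ≡ fold (to (proj₁ (unsigned π)) z) (to (proj₁ w)) N) →
                         Conjugate W (v ^ᴳ N) (w ^ᴳ N)
    unsigned-conjugate π v w N e = unsigned π , λ z → trans (cong (to g) (to-pow v N (from g z)))
      (trans (e (from g z)) (trans (cong (λ x → fold x (to (proj₁ w)) N) (strictlyInverseˡ g z)) (sym (to-pow w N z))))
      where g = proj₁ (unsigned π)

    Larger : ℕ → Subset n → Set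
    Larger p K = ∃[ K′ ] ones K < ones K′ × PowerConjugate p (standard K) (standard K′)

  module _ {p} (pp : Prime p) where

    merge-A : ∀ bs {l rest} → sizes bs ↭ replicate p l ++ rest → Larger p (false ∷ bs)
    merge-A bs {l} {rest} e = go (merge-blocks pp e)
      where
      go : ∃[ k ] rotate-blocks (sizes bs) ^∘ (p ^ k) ≅ rotate-blocks (merged p l ∷ rest) ^∘ (p ^ k) → Larger p (false ∷ bs)
      go (k , μ) = build (shape-surjective-≅ bs (merged p l) rest (_≅_.bijection μ))
        where
        N = p ^ k
        build : ∃[ bs′ ] shape bs′ ≡ (merged p l , rest) → Larger p (false ∷ bs)
        build (bs′ , eq) = false ∷ bs′ , fewer-blocks bs bs′ fewer , k , unsigned-conjugate (_≅_.bijection Θ) (standard (false ∷ bs)) (standard (false ∷ bs′)) N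
            (λ (σ , i) → trans (cong (to (proj₁ (unsigned (_≅_.bijection Θ)))) (fold-standard bs N σ i))
              (trans (cong (σ ,_) (_≅_.intertwines Θ i)) (sym (fold-standard bs′ N σ (Inverse.to (_≅_.bijection Θ) i)))))
          where
          Θ : cyc bs ^∘ N ≅ cyc bs′ ^∘ N
          Θ = ≅-trans (≅-^∘ N (position bs)) (≅-trans μ (≅-sym (≅-^∘ N (proj₁ (layout bs′ eq)))))
          fewer : length (sizes bs′) < length (sizes bs)
          fewer = subst (_< length (sizes bs)) (cong (λ (h , hs) → length (h ∷ hs)) (sym eq)) (length-merged (nonTrivial⇒n>1 p {{prime⇒nonTrivial pp}}) (sizes bs) rest e)
          fold-standard : ∀ bs N σ i → fold (σ , i) (to (proj₁ (standard (false ∷ bs)))) N ≡ (σ , (cyc bs ^∘ N) i)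
          fold-standard bs zero    σ i = refl
          fold-standard bs (suc N) σ i = trans (cong (to (proj₁ (standard (false ∷ bs)))) (fold-standard bs N σ i)) (standard-false bs σ _)

    -- The block of type D is left alone.
    module _ {h hs} (bs : Vec Bool (suc m)) (P : cyc bs ≅ rotate-blocks (suc h ∷ hs)) where
      private
        pos : Fin n → Blocks (suc h ∷ hs)
        pos = Inverse.to (_≅_.bijection P)

        coxeter : Letter n → Letter n
        coxeter = to (proj₁ (standard (true ∷ bs)))

      module _ (pos₀ : pos zero ≡ inj₁ zero) (pos₁ : pos (suc zero) ≡ inj₁ (suc zero)) where

        -- The first two letters lie in the block of type D, so `u` fixes all letters outside it,
        -- and there the Coxeter element acts as an unsigned product of cycles.
        tail-fold : ∀ N σ i y → pos i ≡ inj₂ y → fold (σ , i) coxeter N ≡ (σ , (cyc bs ^∘ N) i) × pos ((cyc bs ^∘ N) i) ≡ inj₂ ((rotate-blocks hs ^∘ N) y)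
        tail-fold zero    σ i y eq = refl , eq
        tail-fold (suc N) σ i y eq = let (c≡ , pos≡) = tail-fold N σ i y eq in extend c≡ (trans (_≅_.intertwines P ((cyc bs ^∘ N) i)) (cong (rotate-blocks (suc h ∷ hs)) pos≡))
          where
          extend : fold (σ , i) coxeter N ≡ (σ , (cyc bs ^∘ N) i) → pos ((cyc bs ^∘ suc N) i) ≡ inj₂ ((rotate-blocks hs ^∘ suc N) y) →
                   fold (σ , i) coxeter (suc N) ≡ (σ , (cyc bs ^∘ suc N) i) × pos ((cyc bs ^∘ suc N) i) ≡ inj₂ ((rotate-blocks hs ^∘ suc N) y)
          extend c≡ pos≡ = trans (cong coxeter c≡) (trans (standard-true bs σ _) (s-other zero _ (apart pos₁) (apart pos₀))) , pos≡
            where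
            apart : ∀ {j x} → pos j ≡ inj₁ x → (cyc bs ^∘ suc N) i ≢ j
            apart posⱼ refl = contradiction (trans (sym posⱼ) pos≡) λ ()

        head-closed : ∀ z x → pos (proj₂ z) ≡ inj₁ x → ∃[ x′ ] pos (proj₂ (coxeter z)) ≡ inj₁ x′
        head-closed (σ , i) x eq = subst (λ w → ∃[ x′ ] pos (proj₂ w) ≡ inj₁ x′) (sym (standard-true bs σ i)) (go (view zero (σ , cyc bs i)))
          where
          cyc-head : pos (cyc bs i) ≡ inj₁ (rot x)
          cyc-head = trans (_≅_.intertwines P i) (cong (rotate-blocks (suc h ∷ hs)) eq)
          go′ : ∀ {w} → View zero w → pos (proj₂ w) ≡ inj₁ (rot x) → ∃[ x′ ] pos (proj₂ (to (s zero) w)) ≡ inj₁ x′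
          go′ is-hi       _  = zero , pos₀
          go′ is-lo       _  = suc zero , pos₁
          go′ is-neghi    _  = zero , pos₀
          go′ is-neglo    _  = suc zero , pos₁
          go′ (other {w} a b) eq = rot x , trans (cong (λ w → pos (proj₂ w)) (s-other zero w a b)) eq
          go : View zero (σ , cyc bs i) → ∃[ x′ ] pos (proj₂ (to (s zero) (σ , cyc bs i))) ≡ inj₁ x′
          go v = go′ v cyc-head

    module _ {h hs hs′} (bs bs′ : Vec Bool (suc m)) (P : cyc bs ≅ rotate-blocks (suc h ∷ hs)) (P′ : cyc bs′ ≅ rotate-blocks (suc h ∷ hs′)) where
      private
        module π = Inverse (_≅_.bijection P)
        module π′ = Inverse (_≅_.bijection P′)

      module _ (pos₀ : π.to zero ≡ inj₁ zero) (pos₁ : π.to (suc zero) ≡ inj₁ (suc zero))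
               (pos₀′ : π′.to zero ≡ inj₁ zero) (pos₁′ : π′.to (suc zero) ≡ inj₁ (suc zero))
               (N : ℕ) (μ : rotate-blocks hs ^∘ N ≅ rotate-blocks hs′ ^∘ N) where
        private
          η : Blocks (suc h ∷ hs) ↔ Blocks (suc h ∷ hs′)
          η = mk↔ₛ′ id id (λ _ → refl) (λ _ → refl) ⊎-↔ _≅_.bijection μ

          θ : Fin n ↔ Fin n
          θ = Comp.inverse (_≅_.bijection P) (Comp.inverse η (Symm.inverse (_≅_.bijection P′)))

          module θ = Inverse θ

          pos-θ : ∀ i → π′.to (θ.to i) ≡ Inverse.to η (π.to i)
          pos-θ i = π′.strictlyInverseˡ _

          injective′ : ∀ {i j} → π′.to i ≡ π′.to j → i ≡ j
          injective′ {i} {j} eq = trans (sym (π′.strictlyInverseʳ i)) (trans (cong π′.from eq) (π′.strictlyInverseʳ j))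

          c c′ g : Letter n → Letter n
          c  = to (proj₁ (standard (true ∷ bs)))
          c′ = to (proj₁ (standard (true ∷ bs′)))
          g  = to (proj₁ (unsigned θ))

          θ₀ : θ.to zero ≡ zero
          θ₀ = injective′ (trans (pos-θ zero) (trans (cong (Inverse.to η) pos₀) (sym pos₀′)))

          θ₁ : θ.to (suc zero) ≡ suc zero
          θ₁ = injective′ (trans (pos-θ (suc zero)) (trans (cong (Inverse.to η) pos₁) (sym pos₁′)))

          g-s : ∀ z → g (to (s zero) z) ≡ to (s zero) (g z)
          g-s = conjugate-simple (proj₁ (unsigned θ)) zero zero (inj₁ (cong (Sign.+ ,_) θ₁ , cong (Sign.- ,_) θ₀))

          head-cyc : ∀ i x → π.to i ≡ inj₁ x → θ.to (cyc bs i) ≡ cyc bs′ (θ.to i)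
          head-cyc i x eq = injective′ (trans (pos-θ (cyc bs i)) (trans (cong (Inverse.to η) (trans (_≅_.intertwines P i) (cong (rotate-blocks (suc h ∷ hs)) eq)))
            (sym (trans (_≅_.intertwines P′ (θ.to i)) (cong (rotate-blocks (suc h ∷ hs′)) (trans (pos-θ i) (cong (Inverse.to η) eq)))))))

          head-step : ∀ z x → π.to (proj₂ z) ≡ inj₁ x → g (c z) ≡ c′ (g z)
          head-step (σ , i) x eq = trans (cong g (standard-true bs σ i)) (trans (g-s (σ , cyc bs i))
            (trans (cong (λ j → to (s zero) (σ , j)) (head-cyc i x eq)) (sym (standard-true bs′ σ (θ.to i)))))

          head-fold : ∀ k z x → π.to (proj₂ z) ≡ inj₁ x → g (fold z c k) ≡ fold (g z) c′ k × ∃[ x′ ] π.to (proj₂ (fold z c k)) ≡ inj₁ x′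
          head-fold zero    z x eq = refl , x , eq
          head-fold (suc k) z x eq = let (g≡ , x′ , eq′) = head-fold k z x eq in
            trans (head-step (fold z c k) x′ eq′) (cong c′ g≡) , head-closed bs P pos₀ pos₁ (fold z c k) x′ eq′

          tail-case : ∀ σ i y → π.to i ≡ inj₂ y → g (fold (σ , i) c N) ≡ fold (g (σ , i)) c′ N
          tail-case σ i y eq = trans (cong g (proj₁ left)) (trans (cong (σ ,_) same) (sym (proj₁ right)))
            where
            left = tail-fold bs P pos₀ pos₁ N σ i y eq
            right = tail-fold bs′ P′ pos₀′ pos₁′ N σ (θ.to i) (Inverse.to (_≅_.bijection μ) y) (trans (pos-θ i) (cong (Inverse.to η) eq))
            same : θ.to ((cyc bs ^∘ N) i) ≡ (cyc bs′ ^∘ N) (θ.to i)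
            same = injective′ (trans (pos-θ _) (trans (cong (Inverse.to η) (proj₂ left)) (trans (cong inj₂ (_≅_.intertwines μ y)) (sym (proj₂ right)))))

        -- The bijection `θ` matches the blocks of type D point by point; it fixes the first two
        -- letters and so commutes with `u`. On these blocks it intertwines the Coxeter elements
        -- themselves, on the others only their N-th powers.
        conjugate-D : Conjugate W (standard (true ∷ bs) ^ᴳ N) (standard (true ∷ bs′) ^ᴳ N)
        conjugate-D = unsigned-conjugate θ (standard (true ∷ bs)) (standard (true ∷ bs′)) N (λ z → by-position z (π.to (proj₂ z)) refl)
          where
          by-position : ∀ z w → π.to (proj₂ z) ≡ w → g (fold z c N) ≡ fold (g z) c′ N
          by-position z       (inj₁ x) eq = proj₁ (head-fold N z x eq)
          by-position (σ , i) (inj₂ y) eq = tail-case σ i y eq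

    private
      second : ∀ {h hs} (bs : Vec Bool m) (P : cyc (true ∷ bs) ≅ rotate-blocks (suc h ∷ hs)) → Inverse.to (_≅_.bijection P) zero ≡ inj₁ zero →
               Inverse.to (_≅_.bijection P) (suc zero) ≡ inj₁ (suc zero)
      second {h} {hs} bs P eq = trans (_≅_.intertwines P zero) (cong (rotate-blocks (suc h ∷ hs)) eq)

    merge-D : ∀ bs {l rest} → proj₂ (shape {suc m} (true ∷ bs)) ↭ replicate p l ++ rest → Larger p (true ∷ true ∷ bs)
    merge-D bs {l} {rest} e = go (merge-blocks pp e)
      where
      h  = proj₁ (shape bs)
      hs = proj₂ (shape bs)
      go : ∃[ k ] rotate-blocks hs ^∘ (p ^ k) ≅ rotate-blocks (merged p l ∷ rest) ^∘ (p ^ k) → Larger p (true ∷ true ∷ bs)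
      go (k , μ) = build (shape-surjective-≅ (true ∷ bs) (suc h) (merged p l ∷ rest) (mk↔ₛ′ id id (λ _ → refl) (λ _ → refl) ⊎-↔ _≅_.bijection μ))
        where
        build : ∃[ bs′ ] shape bs′ ≡ (suc h , merged p l ∷ rest) → Larger p (true ∷ true ∷ bs)
        build (bs′ , eq) = build′ (leading-one bs′ eq) eq
          where
          build′ : ∃[ bs″ ] bs′ ≡ true ∷ bs″ → shape bs′ ≡ (suc h , merged p l ∷ rest) → Larger p (true ∷ true ∷ bs)
          build′ (bs″ , refl) eq = true ∷ true ∷ bs″
            , s≤s (fewer-blocks (true ∷ bs) (true ∷ bs″) (subst (_< suc (length hs)) (cong (λ (h , hs) → length (h ∷ hs)) (sym eq))
                (s≤s (length-merged (nonTrivial⇒n>1 p {{prime⇒nonTrivial pp}}) hs rest e))))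
            , k , conjugate-D (true ∷ bs) (true ∷ bs″) (position (true ∷ bs)) (proj₁ (layout (true ∷ bs″) eq))
                    refl refl (proj₂ (layout (true ∷ bs″) eq)) (second bs″ (proj₁ (layout (true ∷ bs″) eq)) (proj₂ (layout (true ∷ bs″) eq))) (p ^ k) μ

    module _ (p≢2 : p ≢ 2) where

      enlarge-A : ∀ bs → Normalizer-element p (false ∷ bs) → Larger p (false ∷ bs)
      enlarge-A bs y = let (rest , e) = equal-entries (sizes bs) (orbitBlock false bs good pp p≢2 y) (orbitBlock-injective false bs good pp p≢2 y)
                                          (orbitBlock-size false bs good pp p≢2 y)
                       in merge-A bs e
        where
        good : false ≡ true → Vec.lookup bs zero ≡ true
        good ()

      enlarge-D : ∀ bs → Normalizer-element p (true ∷ true ∷ bs) → Larger p (true ∷ true ∷ bs)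
      enlarge-D bs y = let (rest , e′) = equal-entries hs e e-injective e-size in merge-D bs e′
        where
        hs = proj₂ (shape bs)
        orbit : Fin p → Fin (length (sizes (true ∷ bs)))
        orbit = orbitBlock true (true ∷ bs) (λ _ → refl) pp p≢2 y
        tail : ∀ (i : Fin (suc (length hs))) → i ≢ zero → ∃[ j ] i ≡ suc j
        tail zero    i≢0 = contradiction refl i≢0
        tail (suc j) _   = j , refl
        tails : ∀ k → ∃[ j ] orbit k ≡ suc j
        tails k = tail (orbit k) (orbitBlock-nonzero true (true ∷ bs) (λ _ → refl) pp p≢2 y refl k)
        e : Fin p → Fin (length hs)
        e k = proj₁ (tails k)
        e-injective : ∀ {j k} → e j ≡ e k → j ≡ k
        e-injective {j} {k} eq = orbitBlock-injective true (true ∷ bs) (λ _ → refl) pp p≢2 y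
          (trans (proj₂ (tails j)) (trans (cong suc eq) (sym (proj₂ (tails k)))))
        e-size : ∀ k → entry hs (e k) ≡ _
        e-size k = trans (cong (entry (sizes (true ∷ bs))) (sym (proj₂ (tails k)))) (orbitBlock-size true (true ∷ bs) (λ _ → refl) pp p≢2 y k)

      enlarge : ∀ K → Normalizer-element p K → Larger p K
      enlarge (false ∷ bs)        y = enlarge-A bs y
      enlarge (true ∷ true ∷ bs)  y = enlarge-D bs y
      enlarge (true ∷ false ∷ bs) y = untwist (enlarge-A (true ∷ bs) (twist-normalizer {p} {true ∷ false ∷ bs} y))
        where
        K = true ∷ false ∷ bs
        ones-exchange : ∀ J → ones (exchangeₛ J) ≡ ones J
        ones-exchange (true ∷ true ∷ _)   = refl
        ones-exchange (true ∷ false ∷ _)  = refl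
        ones-exchange (false ∷ true ∷ _)  = refl
        ones-exchange (false ∷ false ∷ _) = refl
        untwist : Larger p (exchangeₛ K) → Larger p K
        untwist (K″ , lt , conj) = exchangeₛ K″ , subst (ones K <_) (sym (ones-exchange K″)) lt
          , powerConj-trans p {standard K} {twist (standard (exchangeₛ K))} {standard (exchangeₛ K″)}
              (powerConj-conj p {standard K} {twist (standard (exchangeₛ K))} (coxeter-conjugate {K} {standard K} {twist (standard (exchangeₛ K))} (standard-coxeter K)
                (twist-coxeter {exchangeₛ K} {standard (exchangeₛ K)} (standard-coxeter (exchangeₛ K)))))
              (powerConj-trans p {twist (standard (exchangeₛ K))} {twist (standard K″)} {standard (exchangeₛ K″)}
                (twist-powerConjugate {p} {standard (exchangeₛ K)} {standard K″} conj)
                (powerConj-conj p {twist (standard K″)} {standard (exchangeₛ K″)} (coxeter-conjugate {exchangeₛ K″} {twist (standard K″)} {standard (exchangeₛ K″)}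
                  (twist-coxeter {K″} {standard K″} (standard-coxeter K″)) (standard-coxeter (exchangeₛ K″)))))

      ones≤ : ∀ {k} (bs : Vec Bool k) → ones bs ≤ k
      ones≤ bs = ≤-pred (subst (suc (ones bs) ≤_) (ones+blocks bs) (≤-trans (s≤s (m≤m+n (ones bs) _)) (≤-reflexive (sym (+-suc (ones bs) _)))))

      -- Every enlargement adds a generator, so at most n of them occur; `fuel` bounds how many
      -- generators can still be added.
      saturate : ∀ K → ∃[ L ] PowerConjugate p (standard K) (standard L) × p ∤ β L L
      saturate K = go n K (m≤n+m n (ones K))
        where
        go : ∀ fuel K → n ≤ ones K + fuel → ∃[ L ] PowerConjugate p (standard K) (standard L) × p ∤ β L L
        go fuel K enough = decide fuel enough (p ∣? β K K)
          where
          decide : ∀ fuel → n ≤ ones K + fuel → Dec (p ∣ β K K) → ∃[ L ] PowerConjugate p (standard K) (standard L) × p ∤ β L L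
          decide _ _ (no p∤β) = K , powerConj-conj p {standard K} {standard K} (conj-refl {standard K} {standard K} (λ _ → refl)) , p∤β
          decide fuel enough (yes p∣β) = larger fuel enough (enlarge K (∣⇒normalizer {Among K} (proj₂ size-W) pp (size-β K K) p∣β))
            where
            larger : ∀ fuel → n ≤ ones K + fuel → Larger p K → ∃[ L ] PowerConjugate p (standard K) (standard L) × p ∤ β L L
            larger zero enough (K′ , lt , _) = contradiction (ones≤ K′) (<⇒≱ (≤-<-trans (subst (n ≤_) (+-identityʳ (ones K)) enough) lt))
            larger (suc fuel) enough (K′ , lt , conj) =
              let (L , conj′ , p∤β) = go fuel K′ (≤-trans enough (≤-trans (≤-reflexive (+-suc (ones K) fuel)) (+-monoˡ-≤ fuel lt)))
              in L , powerConj-trans p {standard K} {standard K′} {standard L} conj conj′ , p∤β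

-- Primes other than 2: equal columns and conjugate regular parts.

module OddPrime {m : ℕ} (2≤m : 2 ≤ m) {p : ℕ} (pp : Prime p) where
  open SignedPerm
  open Merging 2≤m public
  open Group W using (Carrier; _≈_; _∙_; ε; _⁻¹; setoid)
  open GroupSolver W using (group-solve; var; _⊕_; ι)

  private
    ⟪⟫-conj : ∀ {J J′} w → (∀ j → j ∈ₛ J → ⟪ J′ ⟫ (w ∙ generatorW j ∙ w ⁻¹)) → ∀ {x} → ⟪ J ⟫ x → ⟪ J′ ⟫ (w ∙ x ∙ w ⁻¹)
    ⟪⟫-conj w f (gen {x} (j , j∈ , e)) = resp {x = w ∙ generatorW j ∙ w ⁻¹} {y = w ∙ x ∙ w ⁻¹} (λ z → cong (to (proj₁ w)) (sym (e (from (proj₁ w) z)))) (f j j∈)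
    ⟪⟫-conj w f unit = resp {x = ε} {y = w ∙ ε ∙ w ⁻¹} (λ z → sym (strictlyInverseˡ (proj₁ w) z)) unit
    ⟪⟫-conj w f (mul {x} {y} p q) = resp {x = (w ∙ x ∙ w ⁻¹) ∙ (w ∙ y ∙ w ⁻¹)} {y = w ∙ (x ∙ y) ∙ w ⁻¹}
      (λ z → cong (to (proj₁ w) ∘ to (proj₁ x)) (strictlyInverseʳ (proj₁ w) _)) (mul {x = w ∙ x ∙ w ⁻¹} {y = w ∙ y ∙ w ⁻¹} (⟪⟫-conj w f p) (⟪⟫-conj w f q))
    ⟪⟫-conj w f (inv {x} p) = resp {x = (w ∙ x ∙ w ⁻¹) ⁻¹} {y = w ∙ x ⁻¹ ∙ w ⁻¹} (λ _ → refl) (inv {x = w ∙ x ∙ w ⁻¹} (⟪⟫-conj w f p))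
    ⟪⟫-conj w f (resp {x} {y} e p) = resp {x = w ∙ x ∙ w ⁻¹} {y = w ∙ y ∙ w ⁻¹} (λ z → cong (to (proj₁ w)) (e (from (proj₁ w) z))) (⟪⟫-conj w f p)

  -- Columns are compared only in the rows from E, to which the saturation of a subset need not
  -- belong; its row is that of its representative.
  β-row : ∀ {J J′} → J ∼ J′ → ∀ K → β J K ≡ β J′ K
  β-row {J} {J′} (w , forth , back) K = HasSize-unique (size-β J K) (HasSize-resp shift (size-β J′ K))
    where
    module C  = Setoid (cosets W (Among J))
    module C′ = Setoid (cosets W (Among J′))
    to-J′ : ∀ {x} → ⟪ J ⟫ x → ⟪ J′ ⟫ (w ∙ x ∙ w ⁻¹)
    to-J′ = ⟪⟫-conj w (λ j j∈ → gen (forth j j∈))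
    to-J : ∀ {x} → ⟪ J′ ⟫ x → ⟪ J ⟫ (w ⁻¹ ∙ x ∙ w)
    to-J {x} x∈ = resp {x = w ⁻¹ ∙ x ∙ (w ⁻¹) ⁻¹} {y = w ⁻¹ ∙ x ∙ w} (λ _ → refl) (⟪⟫-conj (w ⁻¹) generator-back x∈)
      where
      generator-back : ∀ k → k ∈ₛ J′ → ⟪ J ⟫ (w ⁻¹ ∙ generatorW k ∙ (w ⁻¹) ⁻¹)
      generator-back k k∈ = let (j , j∈ , e) = back k k∈ in resp {x = generatorW j} {y = w ⁻¹ ∙ generatorW k ∙ (w ⁻¹) ⁻¹}
        (λ z → sym (trans (cong (from (proj₁ w)) (sym (e (to (proj₁ w) z))))
          (trans (strictlyInverseʳ (proj₁ w) _) (cong (to (generator j)) (strictlyInverseʳ (proj₁ w) z))))) (simple∈ j j∈)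
    push : ∀ {x y} → x C.≈ y → (x ∙ w ⁻¹) C′.≈ (y ∙ w ⁻¹)
    push {x} {y} e = resp {x = w ∙ (x ⁻¹ ∙ y) ∙ w ⁻¹} {y = (x ∙ w ⁻¹) ⁻¹ ∙ (y ∙ w ⁻¹)} (λ _ → refl) (to-J′ e)
    pull : ∀ {x y} → x C′.≈ y → (x ∙ w) C.≈ (y ∙ w)
    pull {x} {y} e = resp {x = w ⁻¹ ∙ (x ⁻¹ ∙ y) ∙ w} {y = (x ∙ w) ⁻¹ ∙ (y ∙ w)} (λ _ → refl) (to-J e)
    shift : Inverse (FixedPoints J K) (FixedPoints J′ K)
    shift = record
      { to = λ (x , fix) → x ∙ w ⁻¹ , λ g g∈ → resp {x = ((g ∙ x) ∙ w ⁻¹) ⁻¹ ∙ (x ∙ w ⁻¹)} {y = (g ∙ (x ∙ w ⁻¹)) ⁻¹ ∙ (x ∙ w ⁻¹)} (λ _ → refl) (push {g ∙ x} {x} (fix g g∈))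
      ; from = λ (x , fix) → x ∙ w , λ g g∈ → resp {x = ((g ∙ x) ∙ w) ⁻¹ ∙ (x ∙ w)} {y = (g ∙ (x ∙ w)) ⁻¹ ∙ (x ∙ w)} (λ _ → refl) (pull {g ∙ x} {x} (fix g g∈))
      ; to-cong = λ {x} {y} → push {proj₁ x} {proj₁ y}
      ; from-cong = λ {x} {y} → pull {proj₁ x} {proj₁ y}
      ; inverse = (λ {x} {y} e → C′.trans {proj₁ y ∙ w ⁻¹} {(proj₁ x ∙ w) ∙ w ⁻¹} {proj₁ x} (push {proj₁ y} {proj₁ x ∙ w} e)
                    (coset-≈ {Among J′} {(proj₁ x ∙ w) ∙ w ⁻¹} {proj₁ x} (λ z → cong (to (proj₁ (proj₁ x))) (strictlyInverseˡ (proj₁ w) z))))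
                , (λ {x} {y} e → C.trans {proj₁ y ∙ w} {(proj₁ x ∙ w ⁻¹) ∙ w} {proj₁ x} (pull {proj₁ y} {proj₁ x ∙ w ⁻¹} e)
                    (coset-≈ {Among J} {(proj₁ x ∙ w ⁻¹) ∙ w} {proj₁ x} (λ z → cong (to (proj₁ (proj₁ x))) (strictlyInverseʳ (proj₁ w) z))))
      }

  fixed-point : ∀ {J K} → p ∤ β J K → ∃[ x ] IsFixed W (Among J) (Among K) x
  fixed-point {J} {K} p∤β = go (β J K) (size-β J K) p∤β
    where
    go : ∀ k → HasSize (FixedPoints J K) k → p ∤ k → ∃[ x ] IsFixed W (Among J) (Among K) x
    go zero    _    p∤0 = contradiction (p ∣0) p∤0
    go (suc k) size _   = Inverse.from size zero

  module _ (p≢2 : p ≢ 2) {E : List (Subset n)} (transversal : IsTransversal E) where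

    -- If p divided `β L L`, an element of order p in the quotient of the normalizer of W_L by W_L
    -- would act freely on the cosets counted by each entry of row L, and the row would vanish
    -- modulo p.
    diagonal : ∀ {L} → InF p E L → p ∤ β L L
    diagonal {L} (_ , K , _ , p∤β) p∣ββ = go (∣⇒normalizer {Among L} (proj₂ size-W) pp (size-β L L) p∣ββ)
      where
      go : ¬ Normalizer-element p L
      go (y , norm , y∉ , yᵖ∈) = p∤β (normalizer⇒∣ {Among L} pp {y} norm y∉ yᵖ∈ {Among K} (size-β L K))

    -- The columns of K and of the saturation of K agree, which makes the latter conjugate to L.
    same⇒powerConjugate : ∀ {K L} → InF p E L → SameColumn p E K L → PowerConjugate p (standard K) (standard L)
    same⇒powerConjugate {K} {L} L∈F same = go (saturate pp p≢2 K)
      where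
      go : ∃[ M ] PowerConjugate p (standard K) (standard M) × p ∤ β M M → PowerConjugate p (standard K) (standard L)
      go (M , conj , p∤M) = powerConj-trans p {standard K} {standard M} {standard L} conj
          (powerConj-conj p {standard M} {standard L} (conj-sym {standard L} {standard M} (∼⇒coxeter-conjugate {L} {M} {standard L} {standard M}
            (contain (fixed-point p∤LM) (fixed-point p∤ML)) (standard-coxeter L) (standard-coxeter M))))
        where
        column : ∀ J → β J K ≡ β J M [mod p ]
        column = β-powerConjugate pp {K} {M} {standard K} {standard M} (standard-coxeter K) (standard-coxeter M) conj
        -- Modulo p, `β L M` agrees with `β L K` and then with `β L L`. In the same way `β M L`
        -- agrees with `β M K` and `β M M`.
        p∤LM : p ∤ β L M
        p∤LM p∣ = diagonal L∈F (≡mod-∣ (∣⇒≡mod (All.lookup same (proj₁ L∈F))) (≡mod-∣ (≡mod-sym (column L)) p∣))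
        M₀ = transversal M
        p∤ML : p ∤ β M L
        p∤ML p∣ = p∤M (≡mod-∣ (column M) (subst (p ∣_) (sym (row K)) (≡mod-∣ (≡mod-sym (∣⇒≡mod (All.lookup same (proj₁ (proj₁ (proj₂ M₀)))))) (subst (p ∣_) (row L) p∣))))
          where
          row : ∀ J → β M J ≡ β (proj₁ M₀) J
          row = β-row (proj₂ (proj₁ (proj₂ M₀)))
        contain : ∃[ x ] IsFixed W (Among L) (Among M) x → ∃[ y ] IsFixed W (Among M) (Among L) y → L ∼ M
        contain (x , fx) (y , fy) = mutual-containment {L} {M} {x} {y} fx fy

    same⇔regular : ∀ K L → InF p E L → ∀ cK cL → IsCoxeterElement K cK → IsCoxeterElement L cL →
                   SameColumn p E K L ⇔ ConjugateRegularParts W p cK cL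
    same⇔regular K L L∈F cK cL coxK coxL = mk⇔
      (λ same → powerConjugate⇒regular (proj₂ size-W) pp {cK} {cL} (powerConj-trans p {cK} {standard K} {cL}
        (powerConj-conj p {cK} {standard K} (coxeter-conjugate {K} {cK} {standard K} coxK (standard-coxeter K)))
        (powerConj-trans p {standard K} {standard L} {cL} (same⇒powerConjugate L∈F same)
          (powerConj-conj p {standard L} {cL} (coxeter-conjugate {L} {standard L} {cL} (standard-coxeter L) coxL)))))
      (λ conj → All.tabulate (λ {J} _ → ≡mod⇒∣ (β-powerConjugate pp {K} {L} {cK} {cL} coxK coxL (regular⇒powerConjugate (proj₂ size-W) pp {cK} {cL} conj) J)))

theorem8 : ∀ (n : ℕ) (4≤n : 4 ≤ n) (p : ℕ) → Prime p →
    let open TypeD 4≤n in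
    ∀ (E : List (Subset n)) → IsTransversal E →
    (p ≢ 2 →
    ∀ K L → K ∈ E → InF p E L →
    ∀ cK cL → IsCoxeterElement K cK → IsCoxeterElement L cL →
    d p E K L ≡ 1 ⇔ ConjugateRegularParts W p cK cL)
    × (p ≡ 2 → 2 ∣ n →
    (∀ L → InF p E L ⇔ L ≡ S)
    × (∀ K → K ∈ E → d p E K S ≡ 1))
    × (p ≡ 2 → 2 ∤ n → S′ ∈ E →
    (∀ L → InF p E L ⇔ (L ≡ S′ ⊎ L ≡ S))
    × (∀ K L → K ∈ E → InF p E L →
    d p E K L ≡ 1 ⇔ ((L ≡ S × K ≢ S′) ⊎ (L ≡ S′ × K ≡ S′))))
theorem8 (suc (suc m)) (s≤s (s≤s 2≤m)) p pp E transversal =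
    (λ p≢2 K L K∈E L∈F cK cL coxK coxL →
      let same⇔ = OddPrime.same⇔regular 2≤m pp p≢2 transversal K L L∈F cK cL coxK coxL
      in T.d⇔ {p} {K} {L} (Equivalence.to same⇔) (Equivalence.from same⇔))
  , (λ { refl 2∣n → T.EvenRank.inF⇔ 2∣n , λ K _ → T.EvenRank.all-equal 2∣n K })
  , (λ { refl 2∤n S′∈E → T.OddRank.inF⇔ 2∤n S′∈E , T.OddRank.same⇔ 2∤n S′∈E })
  where module T = Transversal 2≤m transversal
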